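{- Let $n\ge 1$ and let $A=(a_{ij})_{1\le i<j\le 2n}$ be a skew-symmetric $2n\times 2n$ matrix. Suppose $I\subset[2n]$ is a subset of even cardinality. Then $$\mathrm{pf}_{I,\bar I}(A)=\sum_{D\in\mathcal{D}_{\max}(I)}\mathrm{Pfaf}_D(A).$$
   Context: Pfaffians. $[2n]=\{1,\dots,2n\}$. A skew-symmetric matrix is identified with the array $(a_{ij})_{i<j}$ of its entries above the diagonal. $F_{2n}$ is the set of perfect matchings $\pi$ of $[2n]$, and $a_\pi=\prod_{(i<j)\in\pi}a_{ij}$. The pfaffian is $\mathrm{pf}(A)=\sum_{\pi\in F_{2n}}(-1)^{\mathrm{cn}(\pi)}a_\pi$, where $\mathrm{cn}(\pi)$ is the number of crossings of the arcs of $\pi$ when the vertices are placed in order on a line and the edges drawn as arcs above it. For $I\subset[2n]$ of even size, $\mathrm{pf}_I(A)$ is the pfaffian of the submatrix with rows and columns in $I$ ($\mathrm{pf}_\emptyset=1$), $\bar I=[2n]\setminus I$, and $\mathrm{pf}_{I,\bar I}(A)=\mathrm{pf}_I(A)\,\mathrm{pf}_{\bar I}(A)$. Symmetric TL-diagrams. Place points $1,\dots,2n$ on the left side and $1',\dots,(2n)'$ on the right side of a rectangle, numbered from top to bottom. A TL-diagram is a non-crossing perfect matching of these $4n$ points (drawn inside the rectangle); it is symmetric if invariant under the mirror reflection $i\leftrightarrow i'$. Then every edge is either horizontal, of the form $(i,i')$, or belongs to a mirror pair of vertical edges $\{(i,j),(i',j')\}$. The order $|D|$ is the number of edges with both ends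 on the left side. $\mathcal{T}_n$ is the set of symmetric TL-diagrams and $\mathcal{T}^e_n$ the subset of those with $|D|$ even. Diagram pfaffinants. For $\pi\in F_{2n}$ let $\nu(\pi)$ be the matching of $[2n]\cup[2n]'$ with edges $(i,j')$ and $(i',j)$ for each $(i,j)\in\pi$. Fix for each $\pi$ a nice embedding of $\nu(\pi)$: all edges lie in the rectangle, every pair of edges meets at most once, the picture is mirror symmetric, no two edges are tangent, no three edges pass through one point. An unpaired crossing is a crossing of $(i,j')$ with its mirror image $(i',j)$; all other crossings come in mirror-symmetric pairs (paired crossings). Each edge joins the left side to the right side, so at a crossing of two edges there are two half-edges leading to left endpoints and two leading to right endpoints. The vertical uncrossing replaces the crossing by one strand joining the two left half-edges and one joining the two right half-edges (picture ")("); the horizontal uncrossing joins the left half-edge of each edge to the right half-edge of the other edge without crossing. $X(\pi)$ is the set of diagrams obtained by uncrossing every crossing of $\nu(\pi)$ in one of the two ways, the two members of a paired crossing being uncrossed in the same way. Each $x\in X(\pi)$ is mirror symmetric, and is topologically an element $D(x)\in\mathcal{T}_n$ together with some closed loops. Set $\mathrm{wt}(x)=2^{l(x)}(-1)^{\mathrm{uv}(x)+\mathrm{ph}(x)}$, where $l(x)$ is the number of closed loops (a pair of mirror-symmetric loops counted once), $\mathrm{uv}(x)$ the number of unpaired crossings uncrossed vertically, and $\mathrm{ph}(x)$ the number of pairs of paired crossings uncrossed horizontally. Put $f_D(\pi)=\sum_{x\in X(\pi),\,D(x)=D}\mathrm{wt}(x)$ and $\mathrm{Pfaf}'_D(A)=\sum_{\pi\in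 F_{2n}}f_D(\pi)\,a_\pi$ for $D\in\mathcal{T}_n$. TL-pfaffinants. A vertical left edge $(i,j)$ with $i<j$ is odd if $i$ is odd, even otherwise. For $D\in\mathcal{T}_n$, $S(D)$ is the set of all diagrams in $\mathcal{T}_n$ obtained from $D$ by erasing several (possibly zero) odd edges and their mirror images, and matching the resulting unmatched vertices by horizontal edges $(i,i')$. For $D\in\mathcal{T}^e_n$, $\mathrm{Pfaf}_D(A)=\sum_{D'\in S(D)}\mathrm{Pfaf}'_{D'}(A)$. Compatibility. The $I$-coloring of $[2n]\cup[2n]'$ colors $I\cup(\bar I)'$ black and $I'\cup\bar I$ white. $D\in\mathcal{T}_n$ is $I$-compatible if each edge of $D$ has ends of different colors; $\mathcal{D}(I)$ is the set of $I$-compatible diagrams. For $|I|$ even and $D'\in\mathcal{D}(I)$ there is a unique $D_{\max}\in\mathcal{T}^e_n\cap\mathcal{D}(I)$ with $D'\in S(D_{\max})$ and such that $S(D)\subset S(D_{\max})$ whenever $D\in\mathcal{D}(I)$ and $D'\in S(D)$. $\mathcal{D}_{\max}(I)\subset\mathcal{T}_n^e$ is the set of all diagrams $D_{\max}$ arising in this way from some $D'\in\mathcal{D}(I)$. -}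

module Defs where

open import Algebra.Bundles using (CommutativeRing)
open import Data.Bool.Base using (Bool; not)
import Data.Bool.Properties as Bool
open import Data.Fin.Base as Fin
  using (Fin; zero; suc; toℕ; opposite; splitAt; combine; _↑ˡ_)
import Data.Fin.Properties as Fin
open import Data.Fin.Permutation.Components using (transpose)
open import Data.Fin.Subset using (Subset; inside; outside; ∣_∣; ∁; _∈_)
open import Data.Fin.Subset.Properties using (_∈?_; anySubset?)
open import Data.List.Base as List
  using (List; []; _∷_; _++_; [_]; map; foldr; filter; length; concat; concatMap;
         partition; allFin; upTo; cartesianProduct; cartesianProductWith)
import Data.List.Membership.DecPropositional as DecMembership
open import Data.List.Relation.Binary.Subset.DecPropositional using (_⊆?_)
open import Data.List.Relation.Binary.Subset.Propositional using (_⊆_)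
open import Data.List.Relation.Unary.All as All using (All)
open import Data.List.Relation.Unary.AllPairs using (AllPairs)
open import Data.List.Relation.Unary.Any as Any using (Any)
open import Data.Nat.Base as ℕ using (ℕ; zero; suc)
open import Data.Nat.Divisibility using (_∣_; _∣?_)
import Data.Nat.Properties as ℕ
open import Data.Product.Base as Product using (∃; _×_; _,_; swap)
import Data.Product.Properties as Product
open import Data.Sum.Base using (_⊎_; inj₁; inj₂; [_,_]′)
open import Data.Vec.Base as Vec using (Vec; []; _∷_; lookup; tabulate; toList)
import Data.Vec.Properties as Vec
open import Function.Base using (_∘_; id)
open import Relation.Binary.Definitions using (DecidableEquality)
open import Relation.Binary.PropositionalEquality.Core using (_≡_; _≢_; refl)
open import Relation.Nullary.Decidable using (Dec; yes; no; ¬?; _×-dec_; _⊎-dec_; _→-dec_)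
open import Relation.Nullary.Negation using (¬_)
open import Relation.Unary using (Decidable)

vectors : ∀ {a} {A : Set a} → List A → (m : ℕ) → List (Vec A m)
vectors xs zero    = [ [] ]
vectors xs (suc m) = cartesianProductWith _∷_ xs (vectors xs m)

pairs : ∀ m → List (Fin m × Fin m)
pairs m = cartesianProduct (allFin m) (allFin m)

-- Perfect matchings of {0,…,m-1}: the entry at i is the partner of i.

Pairing : ℕ → Set
Pairing m = Vec (Fin m) m

_≟ᴾ_ : ∀ {m} → DecidableEquality (Pairing m)
_≟ᴾ_ = Vec.≡-dec Fin._≟_

IsMatching : ∀ {m} → Pairing m → Set
IsMatching π = ∀ i → lookup π i ≢ i × lookup π (lookup π i) ≡ i

isMatching? : ∀ {m} → Decidable (IsMatching {m})
isMatching? π = Fin.all? λ i →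
  ¬? (lookup π i Fin.≟ i) ×-dec (lookup π (lookup π i) Fin.≟ i)

matchings : ∀ m → List (Pairing m)
matchings m = filter isMatching? (vectors (allFin m) m)

Edge : ∀ {m} → Pairing m → Fin m × Fin m → Set
Edge π (i , j) = i Fin.< j × lookup π i ≡ j

edge? : ∀ {m} (π : Pairing m) → Decidable (Edge π)
edge? π (i , j) = (i Fin.<? j) ×-dec (lookup π i Fin.≟ j)

edges : ∀ {m} → Pairing m → List (Fin m × Fin m)
edges π = filter (edge? π) (pairs _)

-- The arcs starting at i and at k cross, the one starting at i being the left one.
Cross : ∀ {m} → Pairing m → Fin m × Fin m → Set
Cross π (i , k) =
  i Fin.< k × k Fin.< lookup π i × lookup π i Fin.< lookup π k

cross? : ∀ {m} (π : Pairing m) → Decidable (Cross π)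
cross? π (i , k) =
  (i Fin.<? k) ×-dec ((k Fin.<? lookup π i) ×-dec (lookup π i Fin.<? lookup π k))

cn : ∀ {m} → Pairing m → ℕ
cn π = length (filter (cross? π) (pairs _))

members : ∀ {m} (I : Subset m) → Vec (Fin m) ∣ I ∣
members []            = []
members (inside  ∷ I) = zero ∷ Vec.map suc (members I)
members (outside ∷ I) = Vec.map suc (members I)

-- Connected components of the graph on the given vertices with the given links.

module Components {a} {V : Set a} (_≟_ : DecidableEquality V) where

  open DecMembership _≟_ renaming (_∈_ to _∈ˡ_; _∈?_ to _∈ˡ?_)

  merge : V × V → List (List V) → List (List V)
  merge (p , q) cs =
    let touched , untouched = partition (λ C → (p ∈ˡ? C) ⊎-dec (q ∈ˡ? C)) cs
    in  concat touched ∷ untouched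

  components : List V → List (V × V) → List (List V)
  components vertices links = foldr merge (map [_] vertices) links

  Together : V → V → List (List V) → Set a
  Together p q = Any (λ C → p ∈ˡ C × q ∈ˡ C)

  together? : ∀ p q → Decidable (Together p q)
  together? p q = Any.any? (λ C → (p ∈ˡ? C) ×-dec (q ∈ˡ? C))

-- An embedding of ν(π) is recorded up to isotopy by its left half, drawn as a
-- wiring diagram: the 2n strands leaving the left side are read from left to
-- right up to the mirror axis, and each crossing exchanges two neighbouring
-- levels.  The right half is the mirror image.  On the axis, the strands at
-- levels 2k and 2k+1 (counted from 0) meet their mirror images, and cross there:
-- these n points are the unpaired crossings.  A crossing of the left half
-- together with its mirror image is a pair of paired crossings.

record Crossing (m : ℕ) : Set where
  field
    upper lower : Fin m
    adjacent    : toℕ lower ≡ suc (toℕ upper)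
open Crossing public

LeftHalf : ℕ → Set
LeftHalf m = List (Crossing m)

exchange : ∀ {m} → Crossing m → Fin m → Fin m
exchange a = transpose (upper a) (lower a)

-- Here s sends a level to the left endpoint of the strand running there.
strandsFrom : ∀ {m} → (Fin m → Fin m) → LeftHalf m → (Fin m → Fin m)
strandsFrom s []      = s
strandsFrom s (a ∷ w) = strandsFrom (s ∘ exchange a) w

crossedFrom : ∀ {m} → (Fin m → Fin m) → LeftHalf m → List (Fin m × Fin m)
crossedFrom s []      = []
crossedFrom s (a ∷ w) = (s (upper a) , s (lower a)) ∷ crossedFrom (s ∘ exchange a) w

data Uncrossing : Set where
  horizontal vertical : Uncrossing

_≟ᵁ_ : DecidableEquality Uncrossing
horizontal ≟ᵁ horizontal = yes refl
horizontal ≟ᵁ vertical   = no λ ()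
vertical   ≟ᵁ horizontal = no λ ()
vertical   ≟ᵁ vertical   = yes refl

uncrossings : List Uncrossing
uncrossings = horizontal ∷ vertical ∷ []

number : ∀ {m} → Uncrossing → Vec Uncrossing m → ℕ
number u c = length (filter (_≟ᵁ u) (toList c))

data Side : Set where
  left right : Side

_≟ˢ_ : DecidableEquality Side
left  ≟ˢ left  = yes refl
left  ≟ˢ right = no λ ()
right ≟ˢ left  = no λ ()
right ≟ˢ right = yes refl

otherSide : Side → Side
otherSide left  = right
otherSide right = left

-- The vertices of an uncrossed picture: (side of the axis, column, level).
-- Column t lies after t crossings of that half; column 0 is the side of the
-- rectangle, so its slots are the endpoints i and i′.

Slot : ℕ → Set
Slot m = Side × ℕ × Fin m

_≟ˢˡ_ : ∀ {m} → DecidableEquality (Slot m)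
_≟ˢˡ_ = Product.≡-dec _≟ˢ_ (Product.≡-dec ℕ._≟_ Fin._≟_)

mirrorSlot : ∀ {m} → Slot m → Slot m
mirrorSlot (s , t , p) = otherSide s , t , p

Strand : ℕ → Set
Strand m = Slot m × Slot m

-- The strands between columns t and t+1.
uncross : ∀ {m} → Uncrossing → Side → ℕ → Crossing m → List (Strand m)
uncross horizontal s t a = map (λ p → (s , t , p) , (s , suc t , p)) (allFin _)
uncross vertical   s t a =
  ((s , t , upper a) , (s , t , lower a)) ∷
  ((s , suc t , upper a) , (s , suc t , lower a)) ∷
  map (λ p → (s , t , p) , (s , suc t , p))
      (filter (λ p → ¬? (p Fin.≟ upper a) ×-dec ¬? (p Fin.≟ lower a)) (allFin _))

uncrossHalf : ∀ {m} (s : Side) → ℕ → (w : LeftHalf m) → Vec Uncrossing (length w) →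
              List (Strand m)
uncrossHalf s t []      []      = []
uncrossHalf s t (a ∷ w) (u ∷ c) = uncross u s t a ++ uncrossHalf s (suc t) w c

-- In the sequel n is half the number of vertices, and [2n] is Fin (n * 2): the
-- vertex numbered i ∈ {1,…,2n} is the element i-1.

module _ (n : ℕ) where

  private
    2n = n ℕ.* 2

  axisUpper axisLower : Fin n → Fin 2n
  axisUpper k = combine k zero
  axisLower k = combine k (suc zero)

  -- An edge (i , π(i)′) of ν(π) is named by its left endpoint i; thus the mirror
  -- image of the strand of i belongs to the edge named π(i).
  meetings : Pairing 2n → LeftHalf 2n → List (Fin 2n × Fin 2n)
  meetings π w =
    crossedFrom id w ++
    map (λ k → s (axisUpper k) , s (axisLower k)) (allFin n) ++
    map (Product.map (lookup π) (lookup π)) (crossedFrom id w)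
    where s = strandsFrom id w

  record IsNiceEmbedding (π : Pairing 2n) (w : LeftHalf 2n) : Set where
    field
      drawsν    : ∀ k → lookup π (strandsFrom id w (axisUpper k))
                        ≡ strandsFrom id w (axisLower k)
      meetOnce  : AllPairs (λ e f → e ≢ f × e ≢ swap f) (meetings π w)

  -- A member of X(π): the first component uncrosses the paired crossings, the
  -- second one the unpaired crossings.

  Resolution : LeftHalf 2n → Set
  Resolution w = Vec Uncrossing (length w) × Vec Uncrossing n

  resolutions : (w : LeftHalf 2n) → List (Resolution w)
  resolutions w = cartesianProduct (vectors uncrossings (length w)) (vectors uncrossings n)

  uncrossAxis : ℕ → Uncrossing → Fin n → List (Strand 2n)
  uncrossAxis t horizontal k =
    ((left , t , axisUpper k) , (right , t , axisUpper k)) ∷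
    ((left , t , axisLower k) , (right , t , axisLower k)) ∷ []
  uncrossAxis t vertical k =
    ((left  , t , axisUpper k) , (left  , t , axisLower k)) ∷
    ((right , t , axisUpper k) , (right , t , axisLower k)) ∷ []

  slots : LeftHalf 2n → List (Slot 2n)
  slots w = cartesianProduct (left ∷ right ∷ [])
              (cartesianProduct (upTo (suc (length w))) (allFin 2n))

  strands : (w : LeftHalf 2n) → Resolution w → List (Strand 2n)
  strands w (c , d) =
    uncrossHalf left 0 w c ++
    concatMap (λ k → uncrossAxis (length w) (lookup d k) k) (allFin n) ++
    uncrossHalf right 0 w c

  open Components (_≟ˢˡ_ {2n})

  IsClosed : List (Slot 2n) → Set
  IsClosed = All (λ (_ , t , _) → t ≢ 0)

  isClosed? : Decidable IsClosed
  isClosed? = All.all? (λ (_ , t , _) → ¬? (t ℕ.≟ 0))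

  -- Linking every slot to its mirror image identifies each loop with its mirror
  -- image, so that a mirror pair is counted once.
  loops : (w : LeftHalf 2n) → Resolution w → ℕ
  loops w x = length (filter isClosed?
    (components (slots w) (strands w x ++ map (λ p → p , mirrorSlot p) (slots w))))

  -- The 4n boundary points of the rectangle, read counterclockwise starting
  -- with 1,…,2n: these are followed by (2n)′,…,1′, so that the mirror reflection
  -- is the reversal of this order, and non-crossing in the rectangle means
  -- non-crossing for this linear order.

  Point : Set
  Point = Fin (2n ℕ.+ 2n)

  mirror : Point → Point
  mirror = opposite

  leftPoint rightPoint : Fin 2n → Point
  leftPoint  i = i ↑ˡ 2n
  rightPoint i = mirror (leftPoint i)

  side : Point → Fin 2n ⊎ Fin 2n
  side p = [ inj₁ , inj₂ ∘ opposite ]′ (splitAt 2n p)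

  Diagram : Set
  Diagram = Pairing (2n ℕ.+ 2n)

  record IsSymmetricTL (D : Diagram) : Set where
    constructor symmetricTL
    field
      matching    : IsMatching D
      noncrossing : ∀ p q → ¬ Cross D (p , q)
      symmetric   : ∀ p → lookup D (mirror p) ≡ mirror (lookup D p)

  isSymmetricTL? : Decidable IsSymmetricTL
  isSymmetricTL? D
    with isMatching? D
       | Fin.all? (λ p → Fin.all? λ q → ¬? (cross? D (p , q)))
       | Fin.all? (λ p → lookup D (mirror p) Fin.≟ mirror (lookup D p))
  ... | yes m | yes c | yes s = yes (symmetricTL m c s)
  ... | no ¬m | _     | _     = no (¬m ∘ IsSymmetricTL.matching)
  ... | yes _ | no ¬c | _     = no (¬c ∘ IsSymmetricTL.noncrossing)
  ... | yes _ | yes _ | no ¬s = no (¬s ∘ IsSymmetricTL.symmetric)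

  𝒯 : List Diagram
  𝒯 = filter isSymmetricTL? (vectors (allFin _) _)

  LeftEdge : Diagram → Fin 2n × Fin 2n → Set
  LeftEdge D (i , j) = i Fin.< j × lookup D (leftPoint i) ≡ leftPoint j

  leftEdge? : ∀ D → Decidable (LeftEdge D)
  leftEdge? D (i , j) = (i Fin.<? j) ×-dec (lookup D (leftPoint i) Fin.≟ leftPoint j)

  order : Diagram → ℕ
  order D = length (filter (leftEdge? D) (pairs 2n))

  𝒯ᵉ : List Diagram
  𝒯ᵉ = filter (λ D → 2 ∣? order D) 𝒯

  -- D(x) = D, for D in 𝒯: the endpoints matched by D are joined in the picture x.

  slotOf : Point → Slot 2n
  slotOf p = [ (λ i → left , 0 , i) , (λ i → right , 0 , i) ]′ (side p)

  HasShape : (w : LeftHalf 2n) → Resolution w → Diagram → Set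
  HasShape w x D = ∀ p →
    Together (slotOf p) (slotOf (lookup D p)) (components (slots w) (strands w x))

  hasShape? : ∀ w D → Decidable (λ x → HasShape w x D)
  hasShape? w D x = Fin.all? λ p →
    together? (slotOf p) (slotOf (lookup D p)) (components (slots w) (strands w x))

  -- The odd edges of D, given by their upper ends; i is odd in the numbering
  -- from 1 when toℕ i is even.

  OddUpperEnd : Diagram → Fin 2n → Set
  OddUpperEnd D i = 2 ∣ toℕ i × ∃ λ j → LeftEdge D (i , j)

  oddUpperEnd? : ∀ D → Decidable (OddUpperEnd D)
  oddUpperEnd? D i = (2 ∣? toℕ i) ×-dec Fin.any? (λ j → leftEdge? D (i , j))

  OnEdgeFrom : Diagram → Subset 2n → Point → Set
  OnEdgeFrom D X p = ∃ λ i → i ∈ X ×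
    ((p ≡ leftPoint i  ⊎ p ≡ lookup D (leftPoint i)) ⊎
     (p ≡ rightPoint i ⊎ p ≡ lookup D (rightPoint i)))

  onEdgeFrom? : ∀ D X → Decidable (OnEdgeFrom D X)
  onEdgeFrom? D X p = Fin.any? λ i → (i ∈? X) ×-dec
    (((p Fin.≟ leftPoint i)  ⊎-dec (p Fin.≟ lookup D (leftPoint i))) ⊎-dec
     ((p Fin.≟ rightPoint i) ⊎-dec (p Fin.≟ lookup D (rightPoint i))))

  erase : Diagram → Subset 2n → Diagram
  erase D X = tabulate partner
    where
    partner : Point → Point
    partner p with onEdgeFrom? D X p
    ... | yes _ = mirror p
    ... | no  _ = lookup D p

  ErasedFrom : Diagram → Diagram → Set
  ErasedFrom D E = ∃ λ X → (∀ i → i ∈ X → OddUpperEnd D i) × E ≡ erase D X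

  erasedFrom? : ∀ D → Decidable (ErasedFrom D)
  erasedFrom? D E = anySubset? λ X →
    Fin.all? (λ i → (i ∈? X) →-dec oddUpperEnd? D i) ×-dec (E ≟ᴾ erase D X)

  S : Diagram → List Diagram
  S D = filter (erasedFrom? D) 𝒯

  black : Subset 2n → Point → Bool
  black I p = [ lookup I , not ∘ lookup I ]′ (side p)

  Compatible : Subset 2n → Diagram → Set
  Compatible I D = ∀ p → black I p ≢ black I (lookup D p)

  compatible? : ∀ I → Decidable (Compatible I)
  compatible? I D = Fin.all? λ p → ¬? (black I p Bool.≟ black I (lookup D p))

  𝒟 : Subset 2n → List Diagram
  𝒟 I = filter (compatible? I) 𝒯

  open DecMembership (_≟ᴾ_ {2n ℕ.+ 2n}) renaming (_∈_ to _∈ᴰ_; _∈?_ to _∈ᴰ?_)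

  -- For D in 𝒯ᵉ ∩ 𝒟(I) and D′ in 𝒟(I): D is the diagram D_max determined by D′.
  IsDmaxOf : Subset 2n → Diagram → Diagram → Set
  IsDmaxOf I D′ D = D′ ∈ᴰ S D × All (λ E → D′ ∈ᴰ S E → S E ⊆ S D) (𝒟 I)

  isDmaxOf? : ∀ I D′ D → Dec (IsDmaxOf I D′ D)
  isDmaxOf? I D′ D = (D′ ∈ᴰ? S D) ×-dec
    All.all? (λ E → (D′ ∈ᴰ? S E) →-dec (_⊆?_ _≟ᴾ_ (S E) (S D))) (𝒟 I)

  𝒟max : Subset 2n → List Diagram
  𝒟max I = filter (λ D → Any.any? (λ D′ → isDmaxOf? I D′ D) (𝒟 I))
                  (filter (compatible? I) 𝒯ᵉ)

module _ {c ℓ} (R : CommutativeRing c ℓ) where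

  open CommutativeRing R
  open import Algebra.Properties.Semiring.Exp semiring using (_^_)

  ∑ ∏ : ∀ {a} {A : Set a} → List A → (A → Carrier) → Carrier
  ∑ xs f = foldr (λ x r → f x + r) 0# xs
  ∏ xs f = foldr (λ x r → f x * r) 1# xs

  Matrix : ℕ → Set c
  Matrix m = Fin m → Fin m → Carrier

  IsSkewSymmetric : ∀ {m} → Matrix m → Set ℓ
  IsSkewSymmetric A = ∀ i j → A i j ≈ - A j i

  monomial : ∀ {m} → Matrix m → Pairing m → Carrier
  monomial A π = ∏ (edges π) (λ (i , j) → A i j)

  pf : ∀ {m} → Matrix m → Carrier
  pf {m} A = ∑ (matchings m) λ π → (- 1#) ^ cn π * monomial A π

  pf[_] : ∀ {m} → Subset m → Matrix m → Carrier
  pf[ I ] A = pf (λ i j → A (lookup (members I) i) (lookup (members I) j))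

  pf-product : ∀ {m} → Subset m → Matrix m → Carrier
  pf-product I A = pf[ I ] A * pf[ ∁ I ] A

  module _ (n : ℕ) where

    wt : (w : LeftHalf (n ℕ.* 2)) → Resolution n w → Carrier
    wt w x@(paired , unpaired) =
      (1# + 1#) ^ loops n w x *
      (- 1#) ^ (number vertical unpaired ℕ.+ number horizontal paired)

    -- The integer f_D(π), mapped to R, for the embedding of ν(π) given by w.
    f : LeftHalf (n ℕ.* 2) → Diagram n → Carrier
    f w D = ∑ (filter (hasShape? n w D) (resolutions n w)) (wt w)

    -- In Pfaf′ and Pfaf, ε is the choice of an embedding of ν(π) for each π.

    Pfaf′ : (Pairing (n ℕ.* 2) → LeftHalf (n ℕ.* 2)) → Diagram n → Matrix (n ℕ.* 2) → Carrier
    Pfaf′ ε D A = ∑ (matchings (n ℕ.* 2)) λ π → f (ε π) D * monomial A π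

    Pfaf : (Pairing (n ℕ.* 2) → LeftHalf (n ℕ.* 2)) → Diagram n → Matrix (n ℕ.* 2) → Carrier
    Pfaf ε D A = ∑ (S n D) λ E → Pfaf′ ε E A

{-# OPTIONS --safe #-}
module Submission where

-- Orient the strands of an uncrossed picture so that the mirror reflection reverses
-- all orientations: closed loops account for the factor 2^l, and the boundary
-- orientations are the I-colourings compatible with the diagram.  Locally, the two
-- uncrossings of a paired crossing, weighted by -1 and 1, add up to the two strands
-- crossing each other, with sign -1 when they are equally oriented; on the axis the
-- sum is 1 or 0 according to whether the two strands are equally oriented or not.
-- Hence the sum of f_D(π) over all I-compatible D vanishes unless π matches I with
-- itself, in which case it is -1 to the number of crossings of equally coloured
-- strands, which has the parity of cn(π|I) + cn(π|Ī).  Finally the sets S(D) with D in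
-- 𝒟max(I) partition 𝒟(I): from above, D_max joins the (2k-1)-st and the 2k-th horizontal
-- edge of D′ to vertical edges whenever their colours differ.

open import Defs
open import Algebra.Bundles using (CommutativeMonoid; CommutativeRing)
open import Data.Bool.Base using (Bool; true; false; not; _∧_; _xor_; if_then_else_)
import Data.Bool.Properties as Bool
open import Data.Empty using (⊥; ⊥-elim)
open import Data.Fin.Base as Fin using (Fin; zero; suc; toℕ; fromℕ<; opposite; splitAt; combine; remQuot; _↑ˡ_; _↑ʳ_)
import Data.Fin.Properties as Fin
open import Data.Fin.Permutation.Components using (transpose)
open import Data.Fin.Subset using (Subset; ∣_∣; ∁; _∈_)
open import Data.List.Base as List
  using (List; []; _∷_; _++_; [_]; map; foldr; filter; length; concat; concatMap;
         partition; allFin; upTo; cartesianProduct; cartesianProductWith)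
open import Data.List.Membership.Propositional using () renaming (_∈_ to _∈ˡ_)
open import Data.List.Membership.Propositional.Properties
open import Data.List.Membership.Propositional.Properties.WithK using (unique∧set⇒bag)
import Data.List.Properties as List
open import Data.List.Relation.Binary.BagAndSetEquality using (∼bag⇒↭)
open import Data.List.Relation.Binary.Permutation.Propositional using (_↭_; ↭⇒↭ₛ′)
open import Data.List.Relation.Unary.All as All using (All; []; _∷_)
import Data.List.Relation.Unary.All.Properties as All
open import Data.List.Relation.Unary.AllPairs as AllPairs using (AllPairs; []; _∷_)
open import Data.List.Relation.Unary.Any as Any using (Any; here; there)
import Data.List.Relation.Unary.Any.Properties as Any
open import Data.List.Relation.Unary.Unique.Propositional using (Unique)
import Data.List.Relation.Unary.Unique.Propositional.Properties as Unique
open import Data.Nat.Base as ℕ using (ℕ; zero; suc; _≤_; z≤n; s≤s)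
open import Data.Nat.Divisibility as ℕ using (_∣_; _∣?_)
import Data.Nat.Properties as ℕ
open import Data.Product.Base as Product using (∃; _×_; _,_; proj₁; proj₂; swap)
open import Data.Sum.Base as Sum using (_⊎_; inj₁; inj₂; [_,_]′)
open import Data.Vec.Base as Vec using (Vec; []; _∷_; lookup; tabulate)
import Data.Vec.Properties as Vec
open import Function.Base using (_∘_; id; case_of_)
open import Function.Bundles using (mk⇔)
open import Relation.Binary.Core using (Rel)
open import Relation.Binary.Definitions using (DecidableEquality; tri<; tri≈; tri>)
open import Relation.Binary.PropositionalEquality
  using (_≡_; _≢_; _≗_; refl; sym; trans; cong; cong₂; subst; subst₂; module ≡-Reasoning)
open import Relation.Binary.Structures using (IsEquivalence)
open import Relation.Nullary.Decidable using (Dec; yes; no; does; ¬?; _×-dec_; _⊎-dec_; _→-dec_; dec-true; dec-false)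
open import Relation.Nullary.Negation using (¬_; contradiction)
open import Relation.Unary using (Pred; Decidable)

-- Sums over lists

-- No single f_D(π) is ever evaluated: only the sum over the compatible diagrams can be computed
-- crossing by crossing. By mirror symmetry everything is done with left halves: a symmetric diagram
-- becomes an involution of the levels, and i and i′ carry opposite colours automatically, so that
-- only arcs restrict a colouring. Three obstacles shape the proof. The shape of a picture is
-- defined through connected components of lists of slots, while the sum needs it by recursion on
-- the crossings; the recursion is justified from both sides, since every equivalence relation
-- containing the strands joins what `shape` joins, and colourings constant on the strands separate
-- the rest. The embedding is arbitrary, so the crossings of the left half are known only through
-- the order in which the strands reach the axis; the two ends of an arc arrive side by side, and
-- the order of different arcs cancels modulo 2. D_max is defined by maximality among the sets S(D);
-- erasure turns out to be a partial order on half diagrams, with an explicit greatest element among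
-- the compatible ones above a given one.

module Fold {c ℓ} (M : CommutativeMonoid c ℓ) where

  open CommutativeMonoid M renaming (refl to ≈-refl; sym to ≈-sym; trans to ≈-trans)
  open import Algebra.Properties.CommutativeSemigroup commutativeSemigroup using (interchange)
  open import Data.List.Relation.Binary.Permutation.Setoid.Properties setoid using (foldr-commMonoid)
  open import Data.List.Relation.Binary.Permutation.Propositional.Properties using (map⁺)
  open import Relation.Binary.Reasoning.Setoid setoid

  ⨁ : ∀ {a} {A : Set a} → List A → (A → Carrier) → Carrier
  ⨁ xs g = foldr (λ x r → g x ∙ r) ε xs

  -- Conditions are moved from the lists into the summands: a sum over a filtered list becomes one
  -- over the whole list, and two sums can then be interchanged.
  when : Bool → Carrier → Carrier
  when b x = if b then x else ε

  when-congʳ : ∀ b {x y} → x ≈ y → when b x ≈ when b y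
  when-congʳ true  x≈y = x≈y
  when-congʳ false _   = ≈-refl

  when-cong⇒ : ∀ b {x y} → (b ≡ true → x ≈ y) → when b x ≈ when b y
  when-cong⇒ true  x≈y = x≈y refl
  when-cong⇒ false _   = ≈-refl

  when-congˡ : ∀ {b b′} x → b ≡ b′ → when b x ≈ when b′ x
  when-congˡ x refl = ≈-refl

  when-ε : ∀ b → when b ε ≈ ε
  when-ε true  = ≈-refl
  when-ε false = ≈-refl

  when-∙ : ∀ b x y → when b (x ∙ y) ≈ when b x ∙ when b y
  when-∙ true  x y = ≈-refl
  when-∙ false x y = ≈-sym (identityˡ ε)

  module _ {a} {A : Set a} where

    ⨁-cong∈ : ∀ (xs : List A) {g h} → (∀ {x} → x ∈ˡ xs → g x ≈ h x) → ⨁ xs g ≈ ⨁ xs h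
    ⨁-cong∈ []       eq = ≈-refl
    ⨁-cong∈ (x ∷ xs) eq = ∙-cong (eq (here refl)) (⨁-cong∈ xs (eq ∘ there))

    ⨁-cong : ∀ (xs : List A) {g h} → (∀ x → g x ≈ h x) → ⨁ xs g ≈ ⨁ xs h
    ⨁-cong xs eq = ⨁-cong∈ xs (λ {x} _ → eq x)

    ⨁-ε : ∀ (xs : List A) {g} → (∀ {x} → x ∈ˡ xs → g x ≈ ε) → ⨁ xs g ≈ ε
    ⨁-ε []       eq = ≈-refl
    ⨁-ε (x ∷ xs) eq = ≈-trans (∙-cong (eq (here refl)) (⨁-ε xs (eq ∘ there))) (identityˡ ε)

    ⨁-∙ : ∀ (xs : List A) g h → ⨁ xs (λ x → g x ∙ h x) ≈ ⨁ xs g ∙ ⨁ xs h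
    ⨁-∙ []       g h = ≈-sym (identityˡ ε)
    ⨁-∙ (x ∷ xs) g h = ≈-trans (∙-congˡ (⨁-∙ xs g h)) (interchange _ _ _ _)

    ⨁-++ : ∀ (xs ys : List A) g → ⨁ (xs ++ ys) g ≈ ⨁ xs g ∙ ⨁ ys g
    ⨁-++ []       ys g = ≈-sym (identityˡ _)
    ⨁-++ (x ∷ xs) ys g = ≈-trans (∙-congˡ (⨁-++ xs ys g)) (≈-sym (assoc _ _ _))

    ⨁-when : ∀ b (xs : List A) g → when b (⨁ xs g) ≈ ⨁ xs (λ x → when b (g x))
    ⨁-when true  xs g = ≈-refl
    ⨁-when false xs g = ≈-sym (⨁-ε xs (λ _ → ≈-refl))

    ⨁-filter : ∀ {p} {P : Pred A p} (P? : Decidable P) xs g →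
               ⨁ (filter P? xs) g ≈ ⨁ xs (λ x → when (does (P? x)) (g x))
    ⨁-filter P? []       g = ≈-refl
    ⨁-filter P? (x ∷ xs) g with does (P? x)
    ... | true  = ∙-congˡ (⨁-filter P? xs g)
    ... | false = ≈-trans (⨁-filter P? xs g) (≈-sym (identityˡ _))

    ⨁-single : ∀ {xs : List A} {y g} → Unique xs → y ∈ˡ xs →
               (∀ {x} → x ∈ˡ xs → x ≢ y → g x ≈ ε) → ⨁ xs g ≈ g y
    ⨁-single {x ∷ xs} (x∉ ∷ _) (here refl) z =
      ≈-trans (∙-congˡ (⨁-ε xs (λ x′∈ → z (there x′∈) (λ { refl → All.lookup x∉ x′∈ refl })))) (identityʳ _)
    ⨁-single {x ∷ xs} (x∉ ∷ u) (there y∈) z =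
      ≈-trans (∙-cong (z (here refl) (All.lookup x∉ y∈)) (⨁-single u y∈ (z ∘ there))) (identityˡ _)

  ⨁-map : ∀ {a b} {A : Set a} {B : Set b} (k : A → B) xs g → ⨁ (map k xs) g ≈ ⨁ xs (g ∘ k)
  ⨁-map k []       g = ≈-refl
  ⨁-map k (x ∷ xs) g = ∙-congˡ (⨁-map k xs g)

  module _ {a b} {A : Set a} {B : Set b} where

    ⨁-swap : ∀ (xs : List A) (ys : List B) (g : A → B → Carrier) →
             ⨁ xs (λ x → ⨁ ys (g x)) ≈ ⨁ ys (λ y → ⨁ xs (λ x → g x y))
    ⨁-swap []       ys g = ≈-sym (⨁-ε ys (λ _ → ≈-refl))
    ⨁-swap (x ∷ xs) ys g =
      ≈-trans (∙-congˡ (⨁-swap xs ys g)) (≈-sym (⨁-∙ ys (g x) _))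

    ⨁-product : ∀ {c} {C : Set c} (k : A → B → C) xs ys g →
                ⨁ (cartesianProductWith k xs ys) g ≈ ⨁ xs (λ x → ⨁ ys (λ y → g (k x y)))
    ⨁-product k []       ys g = ≈-refl
    ⨁-product k (x ∷ xs) ys g =
      ≈-trans (⨁-++ (map (k x) ys) _ g) (∙-cong (⨁-map (k x) ys g) (⨁-product k xs ys g))

  ⨁-↭ : ∀ {a} {A : Set a} {xs ys : List A} → xs ↭ ys → ∀ g → ⨁ xs g ≈ ⨁ ys g
  ⨁-↭ {xs = xs} {ys} p g = begin
    ⨁ xs g                  ≈⟨ ⨁-map g xs id ⟨
    foldr _∙_ ε (map g xs)  ≈⟨ foldr-commMonoid isCommutativeMonoid (↭⇒↭ₛ′ isEquivalence (map⁺ g p)) ⟩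
    foldr _∙_ ε (map g ys)  ≈⟨ ⨁-map g ys id ⟩
    ⨁ ys g                  ∎

-- Reindexing, truth values of decisions, vectors and transpositions

unique-↭ : ∀ {a} {A : Set a} {xs ys : List A} → Unique xs → Unique ys →
           (∀ {x} → x ∈ˡ xs → x ∈ˡ ys) → (∀ {x} → x ∈ˡ ys → x ∈ˡ xs) → xs ↭ ys
unique-↭ u v f g = ∼bag⇒↭ (unique∧set⇒bag u v (mk⇔ f g))

-- Summands are guarded by the Booleans `does P?`; equivalent conditions give equal guards, whatever
-- the decision procedures.
does-⇔ : ∀ {p q} {P : Set p} {Q : Set q} (P? : Dec P) (Q? : Dec Q) →
         (P → Q) → (Q → P) → does P? ≡ does Q?
does-⇔ (yes p) Q? f g = sym (dec-true Q? (f p))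
does-⇔ (no ¬p) Q? f g = sym (dec-false Q? (¬p ∘ g))

does-true : ∀ {p} {P : Set p} (P? : Dec P) → does P? ≡ true → P
does-true (yes p) _ = p

module _ {a} {A : Set a} where

  ∈-vectors : ∀ {xs : List A} {m} (v : Vec A m) → (∀ i → lookup v i ∈ˡ xs) → v ∈ˡ vectors xs m
  ∈-vectors []      _  = here refl
  ∈-vectors (x ∷ v) x∈ = ∈-cartesianProductWith⁺ _∷_ (x∈ zero) (∈-vectors v (x∈ ∘ suc))

  vectors-unique : ∀ {xs : List A} → Unique xs → ∀ m → Unique (vectors xs m)
  vectors-unique u zero    = [] ∷ []
  vectors-unique u (suc m) =
    Unique.cartesianProductWith⁺ _∷_ (λ eq → Vec.∷-injective eq) u (vectors-unique u m)

∈-pairings : ∀ {m k} (v : Vec (Fin m) k) → v ∈ˡ vectors (allFin m) k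
∈-pairings v = ∈-vectors v (λ i → ∈-allFin (lookup v i))

lookup-ext : ∀ {a} {A : Set a} {m} {u v : Vec A m} → (∀ i → lookup u i ≡ lookup v i) → u ≡ v
lookup-ext {u = u} {v} eq =
  trans (sym (Vec.tabulate∘lookup u)) (trans (Vec.tabulate-cong eq) (Vec.tabulate∘lookup v))

transpose-fst : ∀ {m} (i j : Fin m) → transpose i j i ≡ j
transpose-fst i j rewrite dec-true (i Fin.≟ i) refl = refl

transpose-snd : ∀ {m} (i j : Fin m) → transpose i j j ≡ i
transpose-snd i j with j Fin.≟ i
... | yes refl = refl
... | no _ rewrite dec-true (j Fin.≟ j) refl = refl

transpose-other : ∀ {m} (i j : Fin m) {k} → k ≢ i → k ≢ j → transpose i j k ≡ k
transpose-other i j {k} k≢i k≢j rewrite dec-false (k Fin.≟ i) k≢i | dec-false (k Fin.≟ j) k≢j = refl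

-- Joining two neighbouring levels of a half diagram

Between : ∀ {m} → Fin m → Fin m → Fin m → Set
Between x y q = x Fin.< q × q Fin.< y

-- Stability under τ and absence of fixed points are bundled because the interior of an arc must
-- have both, and `join` preserves them only together.
Closed : ∀ {m} → (Fin m → Fin m) → (Fin m → Set) → Set
Closed τ Q = ∀ {q} → Q q → Q (τ q) × τ q ≢ q

-- The left half of a symmetric TL-diagram: a vertical edge (i , j) is a 2-cycle
-- of τ and a horizontal edge (i , i′) a fixed point.  A fixed point below an arc
-- would give a crossing of the two mirror images of the arc with (i , i′).
record HalfTL {m} (τ : Fin m → Fin m) : Set where
  field
    involutive : ∀ p → τ (τ p) ≡ p
    nested     : ∀ p → Closed τ (Between p (τ p))

  injective : ∀ {p q} → τ p ≡ τ q → p ≡ q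
  injective {p} {q} eq = trans (sym (involutive p)) (trans (cong τ eq) (involutive q))

  flip : ∀ {p q} → τ p ≡ q → τ q ≡ p
  flip {p} refl = involutive p

bool-≢≢ : ∀ {x y z : Bool} → x ≢ y → y ≢ z → x ≡ z
bool-≢≢ {false} {false} x≢y _ = contradiction refl x≢y
bool-≢≢ {false} {true} {false} _ _ = refl
bool-≢≢ {false} {true} {true} _ y≢z = contradiction refl y≢z
bool-≢≢ {true} {true} x≢y _ = contradiction refl x≢y
bool-≢≢ {true} {false} {true} _ _ = refl
bool-≢≢ {true} {false} {false} _ y≢z = contradiction refl y≢z

module Join {m} (a : Crossing m) (τ : Fin m → Fin m) where

  u l : Fin m
  u = upper a
  l = lower a

  -- The half diagram obtained by attaching the vertical uncrossing of a.
  join : Fin m → Fin m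
  join p =
    if does (p Fin.≟ u) then l else
    if does (p Fin.≟ l) then u else
    if does (τ p Fin.≟ u) then (if does (τ l Fin.≟ l) then p else τ l) else
    if does (τ p Fin.≟ l) then (if does (τ u Fin.≟ u) then p else τ u) else
    τ p

  u<l : u Fin.< l
  u<l = ℕ.≤-reflexive (sym (adjacent a))

  l≢u : l ≢ u
  l≢u eq = ℕ.<-irrefl (cong toℕ (sym eq)) u<l

  above-l : ∀ {x} → u Fin.< x → x ≢ l → l Fin.< x
  above-l {x} u<x x≢l = ℕ.≤∧≢⇒< (subst (ℕ._≤ toℕ x) (sym (adjacent a)) u<x) (λ eq → x≢l (Fin.toℕ-injective (sym eq)))

  below-u : ∀ {x} → x Fin.< l → x ≢ u → x Fin.< u
  below-u {x} x<l x≢u = ℕ.≤∧≢⇒< (ℕ.≤-pred (subst (toℕ x ℕ.<_) (adjacent a) x<l)) (x≢u ∘ Fin.toℕ-injective)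

  data Position (x : Fin m) : Set where
    below : x Fin.< u → Position x
    at-u  : x ≡ u → Position x
    at-l  : x ≡ l → Position x
    above : l Fin.< x → Position x

  position : ∀ x → Position x
  position x with Fin.<-cmp x u
  ... | tri< x<u _ _ = below x<u
  ... | tri≈ _ x≡u _ = at-u x≡u
  ... | tri> _ _ u<x with x Fin.≟ l
  ...   | yes x≡l = at-l x≡l
  ...   | no x≢l = above (above-l u<x x≢l)

  -- Here τ is the half diagram to the right of the crossing. In `viaᵘ` the strand of p arrives at
  -- u, passes along the inner cap to l and goes on to τ l; in `freeˡ` it leaves from l across the
  -- axis instead, so that p itself becomes horizontal. `viaˡ` and `freeᵘ` are the same with u and l
  -- exchanged.
  data View (p : Fin m) : Set where
    at-u   : p ≡ u → join p ≡ l → View p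
    at-l   : p ≡ l → join p ≡ u → View p
    freeˡ  : p ≢ u → p ≢ l → τ p ≡ u → τ l ≡ l → join p ≡ p → View p
    viaᵘ   : p ≢ u → p ≢ l → τ p ≡ u → τ l ≢ l → join p ≡ τ l → View p
    freeᵘ  : p ≢ u → p ≢ l → τ p ≡ l → τ u ≡ u → join p ≡ p → View p
    viaˡ   : p ≢ u → p ≢ l → τ p ≡ l → τ u ≢ u → join p ≡ τ u → View p
    other  : p ≢ u → p ≢ l → τ p ≢ u → τ p ≢ l → join p ≡ τ p → View p

  join-u : join u ≡ l
  join-u rewrite dec-true (u Fin.≟ u) refl = refl

  join-l : join l ≡ u
  join-l rewrite dec-false (l Fin.≟ u) l≢u | dec-true (l Fin.≟ l) refl = refl

  join-other : ∀ {p} → p ≢ u → p ≢ l → τ p ≢ u → τ p ≢ l → join p ≡ τ p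
  join-other {p} p≢u p≢l τp≢u τp≢l
    rewrite dec-false (p Fin.≟ u) p≢u | dec-false (p Fin.≟ l) p≢l
          | dec-false (τ p Fin.≟ u) τp≢u | dec-false (τ p Fin.≟ l) τp≢l = refl

  join-viaᵘ : ∀ {p} → p ≢ u → p ≢ l → τ p ≡ u → τ l ≢ l → join p ≡ τ l
  join-viaᵘ {p} p≢u p≢l τp≡u τl≢l
    rewrite dec-false (p Fin.≟ u) p≢u | dec-false (p Fin.≟ l) p≢l
          | dec-true (τ p Fin.≟ u) τp≡u | dec-false (τ l Fin.≟ l) τl≢l = refl

  join-freeˡ : ∀ {p} → p ≢ u → p ≢ l → τ p ≡ u → τ l ≡ l → join p ≡ p
  join-freeˡ {p} p≢u p≢l τp≡u τl≡l
    rewrite dec-false (p Fin.≟ u) p≢u | dec-false (p Fin.≟ l) p≢l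
          | dec-true (τ p Fin.≟ u) τp≡u | dec-true (τ l Fin.≟ l) τl≡l = refl

  join-viaˡ : ∀ {p} → p ≢ u → p ≢ l → τ p ≡ l → τ u ≢ u → join p ≡ τ u
  join-viaˡ {p} p≢u p≢l τp≡l τu≢u
    rewrite dec-false (p Fin.≟ u) p≢u | dec-false (p Fin.≟ l) p≢l
          | dec-false (τ p Fin.≟ u) (λ eq → l≢u (trans (sym τp≡l) eq))
          | dec-true (τ p Fin.≟ l) τp≡l | dec-false (τ u Fin.≟ u) τu≢u = refl

  join-freeᵘ : ∀ {p} → p ≢ u → p ≢ l → τ p ≡ l → τ u ≡ u → join p ≡ p
  join-freeᵘ {p} p≢u p≢l τp≡l τu≡u
    rewrite dec-false (p Fin.≟ u) p≢u | dec-false (p Fin.≟ l) p≢l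
          | dec-false (τ p Fin.≟ u) (λ eq → l≢u (trans (sym τp≡l) eq))
          | dec-true (τ p Fin.≟ l) τp≡l | dec-true (τ u Fin.≟ u) τu≡u = refl

  view : ∀ p → View p
  view p with p Fin.≟ u
  ... | yes refl = at-u refl join-u
  ... | no p≢u with p Fin.≟ l
  ... | yes refl = at-l refl join-l
  ... | no p≢l with τ p Fin.≟ u
  ... | yes τp≡u with τ l Fin.≟ l
  ...   | yes τl≡l = freeˡ p≢u p≢l τp≡u τl≡l (join-freeˡ p≢u p≢l τp≡u τl≡l)
  ...   | no  τl≢l = viaᵘ p≢u p≢l τp≡u τl≢l (join-viaᵘ p≢u p≢l τp≡u τl≢l)
  view p | no p≢u | no p≢l | no τp≢u with τ p Fin.≟ l
  ... | yes τp≡l with τ u Fin.≟ u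
  ...   | yes τu≡u = freeᵘ p≢u p≢l τp≡l τu≡u (join-freeᵘ p≢u p≢l τp≡l τu≡u)
  ...   | no  τu≢u = viaˡ p≢u p≢l τp≡l τu≢u (join-viaˡ p≢u p≢l τp≡l τu≢u)
  view p | no p≢u | no p≢l | no τp≢u | no τp≢l = other p≢u p≢l τp≢u τp≢l (join-other p≢u p≢l τp≢u τp≢l)

  module _ (H : HalfTL τ) where
    open HalfTL H

    join-involutive : ∀ p → join (join p) ≡ p
    join-involutive p with view p
    ... | at-u p≡u eq = trans (cong join eq) (trans join-l (sym p≡u))
    ... | at-l p≡l eq = trans (cong join eq) (trans join-u (sym p≡l))
    ... | freeˡ _ _ _ _ eq = trans (cong join eq) eq
    ... | freeᵘ _ _ _ _ eq = trans (cong join eq) eq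
    ... | viaᵘ p≢u p≢l τp≡u τl≢l eq = trans (cong join eq)
      (trans (join-viaˡ (λ τl≡u → p≢l (injective (trans τp≡u (sym τl≡u)))) τl≢l (involutive l)
                (λ τu≡u → p≢u (injective (trans τp≡u (sym τu≡u)))))
             (flip τp≡u))
    ... | viaˡ p≢u p≢l τp≡l τu≢u eq = trans (cong join eq)
      (trans (join-viaᵘ τu≢u (λ τu≡l → p≢u (injective (trans τp≡l (sym τu≡l)))) (involutive u)
                (λ τl≡l → p≢l (injective (trans τp≡l (sym τl≡l)))))
             (flip τp≡l))
    ... | other p≢u p≢l τp≢u τp≢l eq = trans (cong join eq)
      (trans (join-other τp≢u τp≢l (λ e → p≢u (trans (sym (involutive p)) e))
                                   (λ e → p≢l (trans (sym (involutive p)) e)))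
             (involutive p))

    -- A strand of `join` differs from one of τ only by passing between u and l, which does not
    -- leave Q. In the `free` cases this passage would put a fixed point of τ into Q, which `cl`
    -- forbids.
    closed-join : ∀ {Q : Fin m → Set} → Closed τ Q → (Q u → Q l) → (Q l → Q u) → Closed join Q
    closed-join {Q} cl ul lu {q} Qq with view q
    ... | at-u refl eq = subst (λ x → Q x × x ≢ q) (sym eq) (ul Qq , l≢u)
    ... | at-l refl eq = subst (λ x → Q x × x ≢ q) (sym eq) (lu Qq , l≢u ∘ sym)
    ... | freeˡ _ _ τq≡u τl≡l _ = contradiction τl≡l (proj₂ (cl (ul (subst Q τq≡u (proj₁ (cl Qq))))))
    ... | freeᵘ _ _ τq≡l τu≡u _ = contradiction τu≡u (proj₂ (cl (lu (subst Q τq≡l (proj₁ (cl Qq))))))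
    ... | viaᵘ _ _ τq≡u _ eq = subst (λ x → Q x × x ≢ q) (sym eq)
      (proj₁ (cl (ul (subst Q τq≡u (proj₁ (cl Qq))))) , λ τl≡q → l≢u (trans (sym (flip τl≡q)) τq≡u))
    ... | viaˡ _ _ τq≡l _ eq = subst (λ x → Q x × x ≢ q) (sym eq)
      (proj₁ (cl (lu (subst Q τq≡l (proj₁ (cl Qq))))) , λ τu≡q → l≢u (trans (sym τq≡l) (flip τu≡q)))
    ... | other _ _ _ _ eq = subst (λ x → Q x × x ≢ q) (sym eq) (cl Qq)

    closed-join-off : ∀ {Q : Fin m → Set} → Closed τ Q → ¬ Q u → ¬ Q l → Closed join Q
    closed-join-off {Q} cl ¬u ¬l = closed-join {Q = Q} cl (⊥-elim ∘ ¬u) (⊥-elim ∘ ¬l)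

    private
      irr : ∀ {x : Fin m} → ¬ (x Fin.< x)
      irr = ℕ.<-irrefl refl

      asym : ∀ {x y : Fin m} → x Fin.< y → ¬ (y Fin.< x)
      asym = ℕ.<-asym

      tr : ∀ {x y z : Fin m} → x Fin.< y → y Fin.< z → x Fin.< z
      tr = ℕ.<-trans

      module _ (A≢u : τ u ≢ u) (B≢l : τ l ≢ l) (A≢l : τ u ≢ l) where

        A B : Fin m
        A = τ u
        B = τ l

        nest : ∀ p {q} → τ p ≡ q → ∀ {r} → Between p q r → Between p q (τ r) × τ r ≢ r
        nest p refl = nested p

        B≢u : B ≢ u
        B≢u e = A≢l (flip e)

        -- The old arcs end at u and A and at l and B. Nesting forces A < u and l < B, as otherwise
        -- one of the two arcs would contain exactly one end of the other. Hence the interior of the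
        -- new arc consists of u, l and the interiors of the old ones.
        joinᵘ-nested : ∀ {q} → Between A B q → Between A B (join q) × join q ≢ q
        joinᵘ-nested {q} (A<q , q<B) with position A | position B
        ... | at-u e | _ = contradiction e A≢u
        ... | at-l e | _ = contradiction e A≢l
        ... | _ | at-u e = contradiction e B≢u
        ... | _ | at-l e = contradiction e B≢l
        ... | above l<A | _ =
          contradiction (proj₂ (proj₁ (nest u refl {l} (u<l , l<A)))) (asym {A} {B} (tr {A} {q} {B} A<q q<B))
        ... | below A<u | below B<u =
          contradiction (subst (Fin._< u) (involutive l) (proj₂ (proj₁ (nest A (involutive u) {B} (tr {A} {q} {B} A<q q<B , B<u)))))
                        (asym {u} {l} u<l)
        ... | below A<u | above l<B with position q
        ...   | at-u refl = subst (λ x → Between A B x × x ≢ u) (sym join-u) ((tr {A} {u} {l} A<u u<l , l<B) , l≢u)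
        ...   | at-l refl = subst (λ x → Between A B x × x ≢ l) (sym join-l) ((A<u , tr {u} {l} {B} u<l l<B) , l≢u ∘ sym)
        ...   | below q<u =
          let (A<j , j<u) , j≢q = closed-join-off {Q = Between A u} (nest A (involutive u))
                                    (λ (_ , u<u) → irr {u} u<u) (λ (_ , l<u) → asym {u} {l} u<l l<u) (A<q , q<u)
          in (A<j , tr {join q} {l} {B} (tr {join q} {u} {l} j<u u<l) l<B) , j≢q
        ...   | above l<q =
          let (l<j , j<B) , j≢q = closed-join-off {Q = Between l B} (nest l refl)
                                    (λ (l<u , _) → asym {u} {l} u<l l<u) (λ (l<l , _) → irr {l} l<l) (l<q , q<B)
          in (tr {A} {l} {join q} (tr {A} {u} {l} A<u u<l) l<j , j<B) , j≢q

        -- Now one old arc lies inside the other: A and B are both beyond l or both before u. The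
        -- new arc spans the gap between A and B, and an old arc starting in the gap can leave it
        -- only by crossing the inner or the outer of the two.
        joinˡ-nested : ∀ {q} → Between B A q → Between B A (join q) × join q ≢ q
        joinˡ-nested {q} (B<q , q<A) with position A | position B
        ... | at-u e | _ = contradiction e A≢u
        ... | at-l e | _ = contradiction e A≢l
        ... | _ | at-u e = contradiction e B≢u
        ... | _ | at-l e = contradiction e B≢l
        ... | above l<A | below B<u =
          contradiction (proj₂ (proj₁ (nest B (involutive l) {u} (B<u , u<l)))) (asym {l} {A} l<A)
        ... | below A<u | above l<B =
          contradiction (tr {B} {q} {u} B<q (tr {q} {A} {u} q<A A<u)) (asym {u} {B} (tr {u} {l} {B} u<l l<B))
        ... | above l<A | above l<B = closed-join-off {Q = Between B A} cl
              (λ (B<u , _) → asym {B} {u} B<u (tr {u} {l} {B} u<l l<B))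
              (λ (B<l , _) → asym {B} {l} B<l l<B) (B<q , q<A)
          where
          cl : Closed τ (Between B A)
          cl {r} (B<r , r<A) with nest u refl {r} (tr {u} {B} {r} (tr {u} {l} {B} u<l l<B) B<r , r<A)
          ... | (u<τr , τr<A) , τr≢r with Fin.<-cmp B (τ r)
          ...   | tri< B<τr _ _ = (B<τr , τr<A) , τr≢r
          ...   | tri≈ _ B≡τr _ = contradiction (injective B≡τr) (λ { refl → asym {B} {l} B<r l<B })
          ...   | tri> _ _ τr<B = contradiction
                  (subst (Fin._< B) (involutive r) (proj₂ (proj₁ (nest l refl {τ r}
                    (above-l u<τr (λ e → irr {B} (subst (B Fin.<_) (sym (flip e)) B<r)) , τr<B)))))
                  (asym {B} {r} B<r)
        ... | below A<u | below B<u = closed-join-off {Q = Between B A} cl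
              (λ (_ , u<A) → asym {u} {A} u<A A<u)
              (λ (_ , l<A) → asym {l} {A} l<A (tr {A} {u} {l} A<u u<l)) (B<q , q<A)
          where
          cl : Closed τ (Between B A)
          cl {r} (B<r , r<A) with nest B (involutive l) {r} (B<r , tr {r} {u} {l} (tr {r} {A} {u} r<A A<u) u<l)
          ... | (B<τr , τr<l) , τr≢r with Fin.<-cmp (τ r) A
          ...   | tri< τr<A _ _ = (B<τr , τr<A) , τr≢r
          ...   | tri≈ _ τr≡A _ = contradiction (injective τr≡A) (λ { refl → asym {u} {A} r<A A<u })
          ...   | tri> _ _ A<τr = contradiction
                  (subst (A Fin.<_) (involutive r) (proj₁ (proj₁ (nest A (involutive u) {τ r}
                    (A<τr , below-u τr<l (λ e → irr {A} (subst (Fin._< A) (sym (flip e)) r<A)))))))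
                  (asym {r} {A} r<A)

    join-half : HalfTL join
    join-half = record { involutive = join-involutive ; nested = nest′ }
      where
      nest′ : ∀ p → Closed join (Between p (join p))
      nest′ p {q} (p<q , q<jp) with view p
      -- Nothing lies strictly inside the outer cap, its ends being adjacent levels.
      ... | at-u refl eq = contradiction (subst (q Fin.<_) eq q<jp)
              (λ q<l → irr {u} (tr {u} {q} {u} p<q (below-u q<l λ { refl → irr {u} p<q })))
      ... | at-l refl eq = contradiction (tr {l} {q} {u} p<q (subst (q Fin.<_) eq q<jp)) (asym {u} {l} u<l)
      ... | freeˡ _ _ _ _ eq = contradiction (subst (q Fin.<_) eq q<jp) (asym {p} {q} p<q)
      ... | freeᵘ _ _ _ _ eq = contradiction (subst (q Fin.<_) eq q<jp) (asym {p} {q} p<q)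
      ... | viaᵘ p≢u p≢l τp≡u τl≢l eq =
        subst₂ (λ x y → Between x y (join q) × join q ≢ q) (flip τp≡u) (sym eq)
          (joinᵘ-nested (λ e → p≢u (trans (sym (flip τp≡u)) e)) τl≢l (λ e → p≢l (trans (sym (flip τp≡u)) e))
            (subst (Fin._< q) (sym (flip τp≡u)) p<q , subst (q Fin.<_) eq q<jp))
      ... | viaˡ p≢u p≢l τp≡l τu≢u eq =
        subst₂ (λ x y → Between x y (join q) × join q ≢ q) (flip τp≡l) (sym eq)
          (joinˡ-nested τu≢u (λ e → p≢l (trans (sym (flip τp≡l)) e)) (λ e → p≢u (trans (sym (flip τp≡l)) (flip e)))
            (subst (Fin._< q) (sym (flip τp≡l)) p<q , subst (q Fin.<_) eq q<jp))
      -- Neither end of this arc is u or l, and these are adjacent, so its interior contains both or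
      -- neither.
      ... | other p≢u p≢l τp≢u τp≢l eq =
        subst (λ y → Between p y (join q) × join q ≢ q) (sym eq)
          (closed-join {Q = Between p (τ p)} (nested p)
            (λ (p<u , u<τp) → tr {p} {u} {l} p<u u<l , above-l u<τp τp≢l)
            (λ (p<l , l<τp) → below-u p<l p≢u , tr {u} {l} {τ p} u<l l<τp)
            (p<q , subst (q Fin.<_) eq q<jp))

-- Colourings compatible with a half diagram; horizontal edges impose no condition

Compat : ∀ {m} → (Fin m → Fin m) → (Fin m → Bool) → Set
Compat τ σ = ∀ p → τ p ≢ p → σ p ≢ σ (τ p)

compat? : ∀ {m} (τ : Fin m → Fin m) σ → Dec (Compat τ σ)
compat? τ σ = Fin.all? λ p → ¬? (τ p Fin.≟ p) →-dec ¬? (σ p Bool.≟ σ (τ p))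

Compat-cong : ∀ {m} {τ : Fin m → Fin m} {σ σ′} → σ ≗ σ′ → Compat τ σ → Compat τ σ′
Compat-cong {τ = τ} eq C p τp≢p e = C p τp≢p (trans (eq p) (trans e (sym (eq (τ p)))))

bool-≢≢-⊥ : ∀ {x y z : Bool} → x ≢ y → y ≢ z → x ≢ z → ⊥
bool-≢≢-⊥ x≢y y≢z x≢z = x≢z (bool-≢≢ x≢y y≢z)

module JoinCompat {m} (a : Crossing m) {τ : Fin m → Fin m} (H : HalfTL τ) where

  open Join a τ
  open HalfTL H

  -- The inner cap closes a loop if τ joins its ends directly, or if both ends run horizontally
  -- across the axis and meet the mirror image of the cap.
  Closes : Set
  Closes = τ u ≡ l ⊎ (τ u ≡ u × τ l ≡ l)

  module _ {σ σ′ : Fin m → Bool} (off : ∀ {p} → p ≢ u → p ≢ l → σ p ≡ σ′ p) (σ′u≢σ′l : σ′ u ≢ σ′ l) where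

    -- σ colours the levels before the crossing and σ′, which will be `σ` or `exchanged σ`, those
    -- after it. A strand through the inner cap consists of three pieces, p to u, u to l and l to τ
    -- l, and the colour changes on each: an odd number of changes, so its ends differ.
    compat-join⁺ : σ u ≢ σ l → Compat τ σ′ → Compat join σ
    compat-join⁺ σu≢σl C p jp≢p e with view p
    ... | at-u refl eq = σu≢σl (trans e (cong σ eq))
    ... | at-l refl eq = σu≢σl (sym (trans e (cong σ eq)))
    ... | freeˡ _ _ _ _ eq = jp≢p eq
    ... | freeᵘ _ _ _ _ eq = jp≢p eq
    ... | viaᵘ p≢u p≢l τp≡u τl≢l eq = bool-≢≢-⊥
            (C l τl≢l) (λ e′ → C p (λ τp≡p → p≢u (trans (sym τp≡p) τp≡u))
              (trans (sym (off p≢u p≢l)) (trans e (trans (cong σ eq)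
                (trans (off (λ τl≡u → p≢l (injective (trans τp≡u (sym τl≡u)))) τl≢l) (trans e′ (cong σ′ (sym τp≡u))))))))
            (σ′u≢σ′l ∘ sym)
    ... | viaˡ p≢u p≢l τp≡l τu≢u eq = bool-≢≢-⊥
            (C u τu≢u) (λ e′ → C p (λ τp≡p → p≢l (trans (sym τp≡p) τp≡l))
              (trans (sym (off p≢u p≢l)) (trans e (trans (cong σ eq)
                (trans (off τu≢u (λ τu≡l → p≢u (injective (trans τp≡l (sym τu≡l))))) (trans e′ (cong σ′ (sym τp≡l))))))))
            σ′u≢σ′l
    ... | other p≢u p≢l τp≢u τp≢l eq = C p (jp≢p ∘ trans eq)
            (trans (sym (off p≢u p≢l)) (trans e (trans (cong σ eq) (off τp≢u τp≢l))))

    compat-join⁻ : Compat join σ → (τ u ≢ u → σ′ u ≢ σ′ (τ u)) → (τ l ≢ l → σ′ l ≢ σ′ (τ l)) → Compat τ σ′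
    compat-join⁻ C Cu Cl p τp≢p e with view p
    ... | at-u refl _ = Cu τp≢p e
    ... | at-l refl _ = Cl τp≢p e
    ... | freeˡ p≢u _ τp≡u _ _ = Cu (λ τu≡u → p≢u (injective (trans τp≡u (sym τu≡u))))
            (trans (cong σ′ (sym τp≡u)) (trans (sym e) (cong σ′ (sym (flip τp≡u)))))
    ... | viaᵘ p≢u _ τp≡u _ _ = Cu (λ τu≡u → p≢u (injective (trans τp≡u (sym τu≡u))))
            (trans (cong σ′ (sym τp≡u)) (trans (sym e) (cong σ′ (sym (flip τp≡u)))))
    ... | freeᵘ _ p≢l τp≡l _ _ = Cl (λ τl≡l → p≢l (injective (trans τp≡l (sym τl≡l))))
            (trans (cong σ′ (sym τp≡l)) (trans (sym e) (cong σ′ (sym (flip τp≡l)))))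
    ... | viaˡ _ p≢l τp≡l _ _ = Cl (λ τl≡l → p≢l (injective (trans τp≡l (sym τl≡l))))
            (trans (cong σ′ (sym τp≡l)) (trans (sym e) (cong σ′ (sym (flip τp≡l)))))
    ... | other p≢u p≢l τp≢u τp≢l eq = C p (τp≢p ∘ trans (sym eq))
            (trans (off p≢u p≢l) (trans e (trans (sym (off τp≢u τp≢l)) (cong σ (sym eq)))))

    compat-closed : Closes → Compat join σ → Compat τ σ′
    compat-closed (inj₁ τu≡l) C = compat-join⁻ C
      (λ _ e → σ′u≢σ′l (trans e (cong σ′ τu≡l))) (λ _ e → σ′u≢σ′l (sym (trans e (cong σ′ (flip τu≡l)))))
    compat-closed (inj₂ (τu≡u , τl≡l)) C = compat-join⁻ C (contradiction τu≡u) (contradiction τl≡l)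

    -- If the arc at u is properly coloured, so is the one at l: together with the inner cap they
    -- form the arc of `join` from τ u to τ l, whose ends are known to differ.
    compat-via-u : τ u ≢ u → τ u ≢ l → Compat join σ → σ′ u ≢ σ′ (τ u) → Compat τ σ′
    compat-via-u τu≢u τu≢l C ne = compat-join⁻ C (λ _ → ne) λ τl≢l e →
      let τl≢u = λ τl≡u → τu≢l (flip τl≡u) in
      C (τ u) (λ e′ → l≢u (injective (trans (sym (join-viaᵘ τu≢u τu≢l (involutive u) τl≢l)) e′)))
        (trans (off τu≢u τu≢l) (trans (sym (bool-≢≢ (σ′u≢σ′l ∘ sym) ne)) (trans e (trans (sym (off τl≢u τl≢l))
           (cong σ (sym (join-viaᵘ τu≢u τu≢l (involutive u) τl≢l)))))))

    compat-via-l : τ u ≡ u → Compat join σ → σ′ l ≢ σ′ (τ l) → Compat τ σ′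
    compat-via-l τu≡u C ne = compat-join⁻ C (contradiction τu≡u) (λ _ → ne)

  module _ (σ : Fin m → Bool) where

    exchanged : Fin m → Bool
    exchanged = σ ∘ exchange a

    exchanged-u : exchanged u ≡ σ l
    exchanged-u = cong σ (transpose-fst u l)

    exchanged-l : exchanged l ≡ σ u
    exchanged-l = cong σ (transpose-snd u l)

    exchanged-off : ∀ {p} → p ≢ u → p ≢ l → σ p ≡ exchanged p
    exchanged-off p≢u p≢l = cong σ (sym (transpose-other u l p≢u p≢l))

    exchanged-same : σ u ≡ σ l → exchanged ≗ σ
    exchanged-same eq p = cases (p Fin.≟ u) (p Fin.≟ l)
      where
      cases : Dec (p ≡ u) → Dec (p ≡ l) → exchanged p ≡ σ p
      cases (yes p≡u) _         = trans (cong exchanged p≡u) (trans exchanged-u (trans (sym eq) (cong σ (sym p≡u))))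
      cases (no _)    (yes p≡l) = trans (cong exchanged p≡l) (trans exchanged-l (trans eq (cong σ (sym p≡l))))
      cases (no p≢u)  (no p≢l)  = sym (exchanged-off p≢u p≢l)

    not-compat-join : σ u ≡ σ l → ¬ Compat join σ
    not-compat-join eq C = C u (λ e → l≢u (trans (sym join-u) e)) (trans eq (cong σ (sym join-u)))

    module _ (σu≢σl : σ u ≢ σ l) where

      private
        ex≢ : exchanged u ≢ exchanged l
        ex≢ e = σu≢σl (sym (trans (sym exchanged-u) (trans e exchanged-l)))

      compat-joinˢ : Compat τ σ → Compat join σ
      compat-joinˢ = compat-join⁺ (λ _ _ → refl) σu≢σl σu≢σl

      compat-joinᵉ : Compat τ exchanged → Compat join σ
      compat-joinᵉ = compat-join⁺ exchanged-off ex≢ σu≢σl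

      -- A closed loop can be oriented in either direction, independently of the rest of the
      -- picture; this is the origin of the factor 2.
      closed⇒both : Closes → Compat join σ → Compat τ σ × Compat τ exchanged
      closed⇒both cl C = compat-closed (λ _ _ → refl) σu≢σl cl C , compat-closed exchanged-off ex≢ cl C

      -- The colour at the far end of the strand through the inner cap determines the colours of u
      -- and l after the crossing. With `open⇒¬both`, exactly one of the two colourings is
      -- compatible.
      open⇒either : ¬ Closes → Compat join σ → Compat τ σ ⊎ Compat τ exchanged
      open⇒either ¬cl C = cases (τ u Fin.≟ u)
        where
        cases : Dec (τ u ≡ u) → Compat τ σ ⊎ Compat τ exchanged
        cases (no τu≢u) with σ u Bool.≟ σ (τ u)
        ... | no ne = inj₁ (compat-via-u (λ _ _ → refl) σu≢σl τu≢u (¬cl ∘ inj₁) C ne)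
        ... | yes e = inj₂ (compat-via-u exchanged-off ex≢ τu≢u (¬cl ∘ inj₁) C
                        λ e′ → σu≢σl (trans e (trans (exchanged-off τu≢u (¬cl ∘ inj₁)) (trans (sym e′) exchanged-u))))
        cases (yes τu≡u) with σ l Bool.≟ σ (τ l)
        ... | no ne = inj₁ (compat-via-l (λ _ _ → refl) σu≢σl τu≡u C ne)
        ... | yes e = inj₂ (compat-via-l exchanged-off ex≢ τu≡u C
                        λ e′ → σu≢σl (sym (trans e (trans (exchanged-off (λ τl≡u → l≢u (injective (trans τl≡u (sym τu≡u))))
                                                                 (λ τl≡l → ¬cl (inj₂ (τu≡u , τl≡l)))) (trans (sym e′) exchanged-l)))))

      open⇒¬both : ¬ Closes → Compat τ σ → ¬ Compat τ exchanged
      open⇒¬both ¬cl C C′ = cases (τ u Fin.≟ u)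
        where
        cases : ¬ Dec (τ u ≡ u)
        cases (no τu≢u) = σu≢σl (bool-≢≢ (C u τu≢u) λ e →
              C′ u τu≢u (trans exchanged-u (trans (sym e) (exchanged-off τu≢u (¬cl ∘ inj₁)))))
        cases (yes τu≡u) = σu≢σl (sym (bool-≢≢ (C l τl≢l) λ e →
              C′ l τl≢l (trans exchanged-l (trans (sym e) (exchanged-off (λ τl≡u → l≢u (injective (trans τl≡u (sym τu≡u)))) τl≢l)))))
          where
          τl≢l : τ l ≢ l
          τl≢l τl≡l = ¬cl (inj₂ (τu≡u , τl≡l))

closes? : ∀ {m} (a : Crossing m) (τ : Fin m → Fin m) →
          Dec (τ (upper a) ≡ lower a ⊎ (τ (upper a) ≡ upper a × τ (lower a) ≡ lower a))
closes? a τ = (τ (upper a) Fin.≟ lower a) ⊎-dec ((τ (upper a) Fin.≟ upper a) ×-dec (τ (lower a) Fin.≟ lower a))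

-- The half diagram and the number of loops of an uncrossed left half w, when the
-- half diagram on the axis is τ.
shape : ∀ {m} (τ : Fin m → Fin m) (w : LeftHalf m) → Vec Uncrossing (length w) → Fin m → Fin m
shape τ []      []               = τ
shape τ (a ∷ w) (horizontal ∷ c) = shape τ w c
shape τ (a ∷ w) (vertical ∷ c)   = Join.join a (shape τ w c)

loopCount : ∀ {m} (τ : Fin m → Fin m) (w : LeftHalf m) → Vec Uncrossing (length w) → ℕ
loopCount τ []      []               = 0
loopCount τ (a ∷ w) (horizontal ∷ c) = loopCount τ w c
loopCount τ (a ∷ w) (vertical ∷ c)   =
  if does (closes? a (shape τ w c)) then suc (loopCount τ w c) else loopCount τ w c

shape-half : ∀ {m} {τ : Fin m → Fin m} → HalfTL τ → ∀ w c → HalfTL (shape τ w c)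
shape-half H []      []               = H
shape-half H (a ∷ w) (horizontal ∷ c) = shape-half H w c
shape-half H (a ∷ w) (vertical ∷ c)   = Join.join-half a _ (shape-half H w c)

module Xor = Fold (CommutativeRing.+-commutativeMonoid Bool.xor-∧-commutativeRing)

same : Bool → Bool → Bool
same x y = does (x Bool.≟ y)

sameCrossings : ∀ {m} → (Fin m → Bool) → List (Fin m × Fin m) → Bool
sameCrossings σ xs = Xor.⨁ xs (λ (x , y) → same (σ x) (σ y))

-- The sum over the uncrossings of a left half

module _ {n : ℕ} where

  turn : Uncrossing → Fin 2 → Fin 2
  turn horizontal = id
  turn vertical   = opposite

  -- Levels 2k and 2k+1 form block k. An axis crossing uncrossed horizontally leaves two fixed
  -- points, one uncrossed vertically leaves an arc within the block.
  axisShape : Vec Uncrossing n → Fin (n ℕ.* 2) → Fin (n ℕ.* 2)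
  axisShape d p = let k , b = remQuot 2 p in combine k (turn (lookup d k) b)

  axisShape-combine : ∀ d k b → axisShape d (combine k b) ≡ combine k (turn (lookup d k) b)
  axisShape-combine d k b = cong (λ (k , b) → combine k (turn (lookup d k) b)) (Fin.remQuot-combine {n} {2} k b)

  turn-involutive : ∀ x b → turn x (turn x b) ≡ b
  turn-involutive horizontal b = refl
  turn-involutive vertical   b = Fin.opposite-involutive b

  axisShape-half : ∀ d → HalfTL (axisShape d)
  axisShape-half d = record { involutive = involutive ; nested = nested }
    where
    involutive : ∀ p → axisShape d (axisShape d p) ≡ p
    involutive p with k , b , refl ← Fin.combine-surjective {n} {2} p = begin
      axisShape d (axisShape d (combine k b))                ≡⟨ cong (axisShape d) (axisShape-combine d k b) ⟩
      axisShape d (combine k (turn (lookup d k) b))          ≡⟨ axisShape-combine d k _ ⟩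
      combine k (turn (lookup d k) (turn (lookup d k) b))    ≡⟨ cong (combine k) (turn-involutive (lookup d k) b) ⟩
      combine k b                                            ∎
      where open ≡-Reasoning
    within : ∀ k b b′ {q} → ¬ Between (combine {n} {2} k b) (combine k b′) q
    within k b b′ {q} (p<q , q<r) = ℕ.<-irrefl refl (begin-strict
      2 ℕ.* toℕ k ℕ.+ 1             ≤⟨ ℕ.+-monoʳ-≤ (2 ℕ.* toℕ k) (s≤s z≤n) ⟩
      2 ℕ.* toℕ k ℕ.+ suc (toℕ b)   ≡⟨ ℕ.+-suc _ _ ⟩
      suc (2 ℕ.* toℕ k ℕ.+ toℕ b)   ≡⟨ cong suc (Fin.toℕ-combine k b) ⟨
      suc (toℕ (combine k b))     ≤⟨ p<q ⟩
      toℕ q                       <⟨ q<r ⟩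
      toℕ (combine k b′)          ≡⟨ Fin.toℕ-combine k b′ ⟩
      2 ℕ.* toℕ k ℕ.+ toℕ b′        ≤⟨ ℕ.+-monoʳ-≤ (2 ℕ.* toℕ k) (ℕ.≤-pred (Fin.toℕ<n b′)) ⟩
      2 ℕ.* toℕ k ℕ.+ 1             ∎)
      where open ℕ.≤-Reasoning
    nested : ∀ p → Closed (axisShape d) (Between p (axisShape d p))
    nested p {q} btw with k , b , refl ← Fin.combine-surjective {n} {2} p =
      contradiction (subst (λ r → Between (combine k b) r q) (axisShape-combine d k b) btw) (within k b _ {q})

  AxisCompat : Vec Uncrossing n → (Fin n → Set) → Set
  AxisCompat d P = ∀ k → lookup d k ≡ vertical → P k

  compat-axis⁺ : ∀ d σ → Compat (axisShape d) σ → AxisCompat d (λ k → σ (axisUpper n k) ≢ σ (axisLower n k))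
  compat-axis⁺ d σ C k v e = C (axisUpper n k)
      (λ e′ → case Fin.combine-injectiveʳ k _ k _ (trans (sym eq) e′) of λ ())
      (trans e (cong σ (sym eq)))
    where
    eq : axisShape d (axisUpper n k) ≡ axisLower n k
    eq = trans (axisShape-combine d k zero) (cong (λ x → combine k (turn x zero)) v)

  compat-axis⁻ : ∀ d σ → AxisCompat d (λ k → σ (axisUpper n k) ≢ σ (axisLower n k)) → Compat (axisShape d) σ
  compat-axis⁻ d σ C p τp≢p e with Fin.combine-surjective {n} {2} p
  ... | k , b , refl with lookup d k in eq | axisShape-combine d k b
  ...   | horizontal | eq′ = τp≢p eq′
  compat-axis⁻ d σ C p τp≢p e | k , zero     , refl | vertical | eq′ = C k eq (trans e (cong σ eq′))
  compat-axis⁻ d σ C p τp≢p e | k , suc zero , refl | vertical | eq′ = C k eq (sym (trans e (cong σ eq′)))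

module Transfer {c ℓ} (R : CommutativeRing c ℓ) where

  open CommutativeRing R renaming (refl to ≈-refl; sym to ≈-sym; trans to ≈-trans) hiding (zero)
  open import Algebra.Properties.Semiring.Exp semiring using (_^_)
  open import Algebra.Properties.Ring ring using (-1*x≈-x; -‿involutive; -‿distribʳ-*; -0#≈0#)
  open Fold +-commutativeMonoid public
  open import Relation.Binary.Reasoning.Setoid setoid

  ⨁-*ˡ : ∀ {a} {A : Set a} x (xs : List A) g → x * ⨁ xs g ≈ ⨁ xs (λ y → x * g y)
  ⨁-*ˡ x []       g = zeroʳ x
  ⨁-*ˡ x (y ∷ xs) g = ≈-trans (distribˡ x _ _) (+-congˡ (⨁-*ˡ x xs g))

  ⨁-*ʳ : ∀ {a} {A : Set a} x (xs : List A) g → ⨁ xs g * x ≈ ⨁ xs (λ y → g y * x)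
  ⨁-*ʳ x []       g = zeroˡ x
  ⨁-*ʳ x (y ∷ xs) g = ≈-trans (distribʳ x _ _) (+-congˡ (⨁-*ʳ x xs g))

  when-*ˡ : ∀ b x y → x * when b y ≈ when b (x * y)
  when-*ˡ true  x y = ≈-refl
  when-*ˡ false x y = zeroʳ x

  when-*ʳ : ∀ b x y → when b x * y ≈ when b (x * y)
  when-*ʳ true  x y = ≈-refl
  when-*ʳ false x y = zeroˡ y

  sg : Bool → Carrier
  sg true  = - 1#
  sg false = 1#

  sg-xor : ∀ x y → sg (x xor y) ≈ sg x * sg y
  sg-xor false y     = ≈-sym (*-identityˡ _)
  sg-xor true  false = ≈-sym (*-identityʳ _)
  sg-xor true  true  = ≈-sym (≈-trans (-1*x≈-x (- 1#)) (-‿involutive 1#))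

  ^-+ : ∀ x m k → x ^ (m ℕ.+ k) ≈ x ^ m * x ^ k
  ^-+ x zero    k = ≈-sym (*-identityˡ _)
  ^-+ x (suc m) k = ≈-trans (*-congˡ (^-+ x m k)) (≈-sym (*-assoc _ _ _))

  -- The contribution of the paired crossings alone, with the half diagram τ on the axis kept fixed.
  -- Vertical uncrossings of unpaired crossings are weighted separately, in `axisSum`.
  weightedSum : ∀ {m} → (Fin m → Fin m) → (Fin m → Bool) → LeftHalf m → Carrier
  weightedSum τ σ w = ⨁ (vectors uncrossings (length w)) λ c →
    when (does (compat? (shape τ w c) σ)) ((1# + 1#) ^ loopCount τ w c * (- 1#) ^ number horizontal c)

  module _ {m} (a : Crossing m) {τ : Fin m → Fin m} (H : HalfTL τ) (σ : Fin m → Bool) where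

    open JoinCompat a H
    open Join a τ using (join; u; l)

    private
      -x+xx : ∀ x → - x + (x + x) ≈ x
      -x+xx x = ≈-trans (≈-sym (+-assoc _ _ _)) (≈-trans (+-congʳ (-‿inverseˡ x)) (+-identityˡ x))

    -- The two uncrossings of a, weighted by -1 and 1, add up to the strands crossing at a.
    uncrossing-identity : ∀ y → let cl = does (closes? a τ) in
      - when (does (compat? τ σ)) y + when (does (compat? join σ)) (if cl then y + y else y)
      ≈ sg (same (σ u) (σ l)) * when (does (compat? τ (exchanged σ))) y
    uncrossing-identity y with σ u Bool.≟ σ l
    -- The outer cap would join equal colours, so only the horizontal uncrossing survives, with its
    -- sign -1.
    ... | yes e = begin
      - when (does (compat? τ σ)) y + when (does (compat? join σ)) _
        ≈⟨ +-congˡ (when-congˡ _ (dec-false (compat? join σ) (not-compat-join σ e))) ⟩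
      - when (does (compat? τ σ)) y + 0#
        ≈⟨ +-identityʳ _ ⟩
      - when (does (compat? τ σ)) y
        ≈⟨ -‿cong (when-congˡ y (does-⇔ (compat? τ σ) (compat? τ (exchanged σ))
             (Compat-cong (λ p → sym (exchanged-same σ e p))) (Compat-cong (exchanged-same σ e)))) ⟩
      - when (does (compat? τ (exchanged σ))) y
        ≈⟨ -1*x≈-x _ ⟨
      - 1# * when (does (compat? τ (exchanged σ))) y ∎
    ... | no ne = ≈-trans (cases (closes? a τ)) (≈-sym (*-identityˡ _))
      where
      cases : (cl? : Dec Closes) → - when (does (compat? τ σ)) y + when (does (compat? join σ)) (if does cl? then y + y else y)
              ≈ when (does (compat? τ (exchanged σ))) y
      -- Horizontal contributes -1 and vertical 2, because of the loop; the total is 1.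
      cases (yes cl) = begin
        - when (does (compat? τ σ)) y + when (does (compat? join σ)) (y + y)
          ≈⟨ +-cong (-‿cong (when-congˡ y (does-⇔ (compat? τ σ) (compat? τ (exchanged σ))
                       (proj₂ ∘ closed⇒both σ ne cl ∘ compat-joinˢ σ ne) (proj₁ ∘ closed⇒both σ ne cl ∘ compat-joinᵉ σ ne))))
                    (≈-trans (when-congˡ _ (does-⇔ (compat? join σ) (compat? τ (exchanged σ))
                       (proj₂ ∘ closed⇒both σ ne cl) (compat-joinᵉ σ ne)))
                      (when-∙ (does (compat? τ (exchanged σ))) y y)) ⟩
        - when (does (compat? τ (exchanged σ))) y + (when (does (compat? τ (exchanged σ))) y + when (does (compat? τ (exchanged σ))) y)
          ≈⟨ -x+xx _ ⟩
        when (does (compat? τ (exchanged σ))) y ∎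
      -- If σ itself is compatible with τ, the two uncrossings cancel; if the exchanged colouring
      -- is, only the vertical uncrossing is present; if neither is, both vanish.
      cases (no ¬cl) = open-case (compat? τ σ) (compat? τ (exchanged σ))
        where
        open-case : (C? : Dec (Compat τ σ)) (C′? : Dec (Compat τ (exchanged σ))) →
                    - when (does C?) y + when (does (compat? join σ)) y ≈ when (does C′?) y
        open-case (yes C) (yes C′) = contradiction C′ (open⇒¬both σ ne ¬cl C)
        open-case (yes C) (no _) =
          ≈-trans (+-congˡ (when-congˡ y (dec-true (compat? join σ) (compat-joinˢ σ ne C)))) (-‿inverseˡ y)
        open-case (no _) (yes C′) =
          ≈-trans (+-cong -0#≈0# (when-congˡ y (dec-true (compat? join σ) (compat-joinᵉ σ ne C′)))) (+-identityˡ y)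
        open-case (no ¬C) (no ¬C′) =
          ≈-trans (+-cong -0#≈0# (when-congˡ y (dec-false (compat? join σ) ([ ¬C , ¬C′ ]′ ∘ open⇒either σ ne ¬cl)))) (+-identityˡ 0#)

  -- The first crossing is the outermost. For every uncrossing c of the others, `shape τ w c` is a
  -- half diagram, so the local identity applies to each summand separately.
  weightedSum-∷ : ∀ {m} (a : Crossing m) w {τ : Fin m → Fin m} (H : HalfTL τ) (σ : Fin m → Bool) →
    weightedSum τ σ (a ∷ w) ≈ sg (same (σ (upper a)) (σ (lower a))) * weightedSum τ (σ ∘ exchange a) w
  weightedSum-∷ a w {τ} H σ = begin
    weightedSum τ σ (a ∷ w)
      ≈⟨ ⨁-product _∷_ uncrossings cs _ ⟩
    ⨁ cs _ + (⨁ cs _ + 0#)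
      ≈⟨ +-congˡ (+-identityʳ _) ⟩
    ⨁ cs _ + ⨁ cs _
      ≈⟨ ⨁-∙ cs _ _ ⟨
    ⨁ cs _
      ≈⟨ ⨁-cong cs step ⟩
    ⨁ cs _
      ≈⟨ ⨁-*ˡ _ cs _ ⟨
    sg (same (σ (upper a)) (σ (lower a))) * weightedSum τ (σ ∘ exchange a) w ∎
    where
    cs = vectors uncrossings (length w)
    step : ∀ c → let τ′ = shape τ w c ; P = (1# + 1#) ^ loopCount τ w c ; h = (- 1#) ^ number horizontal c in
      when (does (compat? τ′ σ)) (P * (- 1# * h))
        + when (does (compat? (Join.join a τ′) σ)) ((1# + 1#) ^ loopCount τ (a ∷ w) (vertical ∷ c) * h)
      ≈ sg (same (σ (upper a)) (σ (lower a))) * when (does (compat? τ′ (σ ∘ exchange a))) (P * h)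
    step c = ≈-trans (+-cong left-part (when-congʳ (does (compat? (Join.join a τ′) σ)) (right-part (does (closes? a τ′)))))
                     (uncrossing-identity a (shape-half H w c) σ (P * h))
      where
      τ′ = shape τ w c
      P = (1# + 1#) ^ loopCount τ w c
      h = (- 1#) ^ number horizontal c
      left-part : when (does (compat? τ′ σ)) (P * (- 1# * h)) ≈ - when (does (compat? τ′ σ)) (P * h)
      left-part with does (compat? τ′ σ)
      ... | true  = ≈-trans (*-congˡ (-1*x≈-x h)) (≈-sym (-‿distribʳ-* P h))
      ... | false = ≈-sym -0#≈0#
      right-part : ∀ b → (1# + 1#) ^ (if b then suc (loopCount τ w c) else loopCount τ w c) * h ≈ (if b then P * h + P * h else P * h)
      right-part true = ≈-trans (*-congʳ (≈-trans (distribʳ P 1# 1#) (+-cong (*-identityˡ P) (*-identityˡ P)))) (distribʳ h P P)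
      right-part false = ≈-refl

  -- Iterating the previous step removes all uncrossings: the boundary colours are carried to the
  -- axis along the strands as they really cross, and each crossing leaves only its sign.
  weightedSum-strands : ∀ {m} (w : LeftHalf m) {τ : Fin m → Fin m} (H : HalfTL τ) (σ : Fin m → Bool) (s : Fin m → Fin m) →
    weightedSum τ (σ ∘ s) w ≈ when (does (compat? τ (σ ∘ strandsFrom s w))) (sg (sameCrossings σ (crossedFrom s w)))
  weightedSum-strands [] {τ} H σ s =
    ≈-trans (+-identityʳ _) (when-congʳ (does (compat? τ (σ ∘ s))) (*-identityˡ 1#))
  weightedSum-strands (a ∷ w) {τ} H σ s = begin
    weightedSum τ (σ ∘ s) (a ∷ w)
      ≈⟨ weightedSum-∷ a w H (σ ∘ s) ⟩
    sg x * weightedSum τ (σ ∘ s ∘ exchange a) w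
      ≈⟨ *-congˡ (weightedSum-strands w H σ (s ∘ exchange a)) ⟩
    sg x * when b (sg y)
      ≈⟨ when-*ˡ b (sg x) (sg y) ⟩
    when b (sg x * sg y)
      ≈⟨ when-congʳ b (sg-xor x y) ⟨
    when b (sg (x xor y)) ∎
    where
    x = same (σ (s (upper a))) (σ (s (lower a)))
    y = sameCrossings σ (crossedFrom (s ∘ exchange a) w)
    b = does (compat? τ (σ ∘ strandsFrom (s ∘ exchange a) w))

  axisCompat? : ∀ {n} (d : Vec Uncrossing n) {P : Fin n → Set} → (∀ k → Dec (P k)) → Dec (AxisCompat d P)
  axisCompat? d P? = Fin.all? λ k → (lookup d k ≟ᵁ vertical) →-dec P? k

  -- P k will say that the two colours meeting at the k-th axis crossing differ. Then both
  -- uncrossings are compatible and their weights 1 and -1 cancel; otherwise only the horizontal one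
  -- remains, with weight 1.
  axisSum : ∀ n {P : Fin n → Set} (P? : ∀ k → Dec (P k)) →
    ⨁ (vectors uncrossings n) (λ d → when (does (axisCompat? d P?)) ((- 1#) ^ number vertical d))
    ≈ when (does (Fin.all? (λ k → ¬? (P? k)))) 1#
  axisSum zero    P? = +-identityʳ 1#
  axisSum (suc n) {P} P? = begin
    _ ≈⟨ ⨁-product _∷_ uncrossings ds _ ⟩
    ⨁ ds (λ d → when (does (axisCompat? (horizontal ∷ d) P?)) ((- 1#) ^ number vertical d))
      + (⨁ ds (λ d → when (does (axisCompat? (vertical ∷ d) P?)) (- 1# * (- 1#) ^ number vertical d)) + 0#)
      ≈⟨ +-cong (⨁-cong ds λ d → when-congˡ _ (does-⇔ (axisCompat? (horizontal ∷ d) P?) (axisCompat? d (P? ∘ suc))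
             (λ C → C ∘ suc) (λ { C zero () ; C (suc k) → C k }))) (+-identityʳ _) ⟩
    T + ⨁ ds (λ d → when (does (axisCompat? (vertical ∷ d) P?)) (- 1# * (- 1#) ^ number vertical d))
      ≈⟨ cases (P? zero) ⟩
    when (does (Fin.all? (λ k → ¬? (P? k)))) 1# ∎
    where
    ds = vectors uncrossings n
    T = ⨁ ds (λ d → when (does (axisCompat? d (P? ∘ suc))) ((- 1#) ^ number vertical d))
    cases : Dec (P zero) → T + ⨁ ds (λ d → when (does (axisCompat? (vertical ∷ d) P?)) (- 1# * (- 1#) ^ number vertical d))
      ≈ when (does (Fin.all? (λ k → ¬? (P? k)))) 1#
    cases (yes p) = begin
      T + ⨁ ds _ ≈⟨ +-congˡ (⨁-cong ds λ d → ≈-trans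
                      (when-congˡ _ (does-⇔ (axisCompat? (vertical ∷ d) P?) (axisCompat? d (P? ∘ suc))
                         (λ C → C ∘ suc) (λ { C zero _ → p ; C (suc k) → C k })))
                      (≈-sym (when-*ˡ (does (axisCompat? d (P? ∘ suc))) _ _))) ⟩
      T + ⨁ ds _ ≈⟨ +-congˡ (⨁-*ˡ (- 1#) ds _) ⟨
      T + - 1# * T ≈⟨ +-congˡ (-1*x≈-x T) ⟩
      T + - T      ≈⟨ -‿inverseʳ T ⟩
      0#           ≈⟨ when-congˡ 1# (dec-false (Fin.all? (λ k → ¬? (P? k))) (λ ¬P → ¬P zero p)) ⟨
      when (does (Fin.all? (λ k → ¬? (P? k)))) 1# ∎
    cases (no ¬p) = begin
      T + ⨁ ds _ ≈⟨ +-congˡ (⨁-ε ds λ {d} _ → when-congˡ _ (dec-false (axisCompat? (vertical ∷ d) P?) λ C → ¬p (C zero refl))) ⟩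
      T + 0#     ≈⟨ +-identityʳ T ⟩
      T          ≈⟨ axisSum n (P? ∘ suc) ⟩
      when (does (Fin.all? (λ k → ¬? (P? (suc k))))) 1#
        ≈⟨ when-congˡ 1# (does-⇔ (Fin.all? (λ k → ¬? (P? (suc k)))) (Fin.all? (λ k → ¬? (P? k)))
             (λ { ¬P zero → ¬p ; ¬P (suc k) → ¬P k }) (λ ¬P → ¬P ∘ suc)) ⟩
      when (does (Fin.all? (λ k → ¬? (P? k)))) 1# ∎

  -- For fixed d the sum over the paired crossings is known, and its sign does not depend on d; what
  -- remains is the sum over the axis crossings.
  resolutionSum : ∀ n (w : LeftHalf (n ℕ.* 2)) (σ : Fin (n ℕ.* 2) → Bool) → let s = strandsFrom id w in
    ⨁ (resolutions n w) (λ (c , d) → when (does (compat? (shape (axisShape d) w c) σ))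
      ((1# + 1#) ^ loopCount (axisShape d) w c * (- 1#) ^ (number vertical d ℕ.+ number horizontal c)))
    ≈ when (does (Fin.all? λ k → σ (s (axisUpper n k)) Bool.≟ σ (s (axisLower n k)))) (sg (sameCrossings σ (crossedFrom id w)))
  resolutionSum n w σ = begin
    ⨁ (resolutions n w) _
      ≈⟨ ⨁-product _,_ cs ds _ ⟩
    ⨁ cs (λ c → ⨁ ds λ d → when (B c d) (L c d * (- 1#) ^ (number vertical d ℕ.+ number horizontal c)))
      ≈⟨ ⨁-swap cs ds _ ⟩
    ⨁ ds (λ d → ⨁ cs λ c → when (B c d) (L c d * (- 1#) ^ (number vertical d ℕ.+ number horizontal c)))
      ≈⟨ ⨁-cong ds (λ d → ⨁-cong cs (λ c → ≈-trans (when-congʳ (B c d) (rearrange c d)) (≈-sym (when-*ˡ (B c d) (V d) _)))) ⟩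
    ⨁ ds (λ d → ⨁ cs λ c → V d * when (B c d) (L c d * (- 1#) ^ number horizontal c))
      ≈⟨ ⨁-cong ds (λ d → ⨁-*ˡ (V d) cs _) ⟨
    ⨁ ds (λ d → V d * weightedSum (axisShape d) σ w)
      ≈⟨ ⨁-cong ds (λ d → *-congˡ (weightedSum-strands w (axisShape-half d) σ id)) ⟩
    ⨁ ds (λ d → V d * when (does (compat? (axisShape d) σ′)) X)
      ≈⟨ ⨁-cong ds (λ d → ≈-trans (when-*ˡ (does (compat? (axisShape d) σ′)) _ _) (≈-trans
            (when-congˡ _ (does-⇔ (compat? (axisShape d) σ′) (axisCompat? d differ?) (compat-axis⁺ d σ′) (compat-axis⁻ d σ′)))
            (≈-sym (when-*ʳ (does (axisCompat? d differ?)) _ _)))) ⟩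
    ⨁ ds (λ d → when (does (axisCompat? d differ?)) (V d) * X)
      ≈⟨ ⨁-*ʳ X ds _ ⟨
    ⨁ ds (λ d → when (does (axisCompat? d differ?)) (V d)) * X
      ≈⟨ *-congʳ (axisSum n differ?) ⟩
    when (does (Fin.all? (λ k → ¬? (differ? k)))) 1# * X
      ≈⟨ when-*ʳ (does (Fin.all? (λ k → ¬? (differ? k)))) _ _ ⟩
    when (does (Fin.all? (λ k → ¬? (differ? k)))) (1# * X)
      ≈⟨ when-congʳ (does (Fin.all? (λ k → ¬? (differ? k)))) (*-identityˡ X) ⟩
    when (does (Fin.all? (λ k → ¬? (differ? k)))) X
      ≈⟨ when-congˡ X (does-⇔ (Fin.all? (λ k → ¬? (differ? k))) (Fin.all? (λ k → σ′ (axisUpper n k) Bool.≟ σ′ (axisLower n k)))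
           (λ nd k → decidable-stable (σ′ (axisUpper n k) Bool.≟ σ′ (axisLower n k)) (nd k)) (λ eq k ne → ne (eq k))) ⟩
    when _ X ∎
    where
    open import Relation.Nullary.Decidable using (decidable-stable)
    cs = vectors uncrossings (length w)
    ds = vectors uncrossings n
    σ′ = σ ∘ strandsFrom id w
    X = sg (sameCrossings σ (crossedFrom id w))
    V : Vec Uncrossing n → Carrier
    V d = (- 1#) ^ number vertical d
    L : Vec Uncrossing (length w) → Vec Uncrossing n → Carrier
    L c d = (1# + 1#) ^ loopCount (axisShape d) w c
    B : Vec Uncrossing (length w) → Vec Uncrossing n → Bool
    B c d = does (compat? (shape (axisShape d) w c) σ)
    differ? : ∀ k → Dec (σ′ (axisUpper n k) ≢ σ′ (axisLower n k))
    differ? k = ¬? (σ′ (axisUpper n k) Bool.≟ σ′ (axisLower n k))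
    rearrange : ∀ c d → L c d * (- 1#) ^ (number vertical d ℕ.+ number horizontal c) ≈ V d * (L c d * (- 1#) ^ number horizontal c)
    rearrange c d = ≈-trans (*-congˡ (^-+ (- 1#) (number vertical d) (number horizontal c)))
      (≈-trans (≈-sym (*-assoc _ _ _)) (≈-trans (*-congʳ (*-comm _ _)) (*-assoc _ _ _)))

-- Connected components

module Count = Fold ℕ.+-0-commutativeMonoid

length-⨁ : ∀ {a} {A : Set a} (xs : List A) → length xs ≡ Count.⨁ xs (λ _ → 1)
length-⨁ []       = refl
length-⨁ (x ∷ xs) = cong suc (length-⨁ xs)

module ComponentsProperties {a} {V : Set a} (_≟_ : DecidableEquality V) where

  open Components _≟_
  open import Data.List.Membership.DecPropositional _≟_ using () renaming (_∈?_ to _∈ˡ?_)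
  open import Data.List.Membership.Propositional using (find; lose)

  DisjointLists : Rel (List V) a
  DisjointLists C D = ∀ {v} → v ∈ˡ C → ¬ (v ∈ˡ D)

  overlap⇒≡ : ∀ {cs} → AllPairs DisjointLists cs → ∀ {C D v} → C ∈ˡ cs → D ∈ˡ cs → v ∈ˡ C → v ∈ˡ D → C ≡ D
  overlap⇒≡ (dis ∷ _) (here refl) (here refl) _ _ = refl
  overlap⇒≡ (dis ∷ _) (here refl) (there D∈) v∈C v∈D = contradiction v∈D (All.lookup dis D∈ v∈C)
  overlap⇒≡ (dis ∷ _) (there C∈) (here refl) v∈C v∈D = contradiction v∈C (All.lookup dis C∈ v∈D)
  overlap⇒≡ (_ ∷ ap) (there C∈) (there D∈) v∈C v∈D = overlap⇒≡ ap C∈ D∈ v∈C v∈D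

  touches? : ∀ p q → Decidable (λ C → p ∈ˡ C ⊎ q ∈ˡ C)
  touches? p q C = (p ∈ˡ? C) ⊎-dec (q ∈ˡ? C)

  merge′ : V × V → List (List V) → List (List V)
  merge′ (p , q) cs =
    concat (filter (touches? p q) cs) ∷ filter (λ C → ¬? (touches? p q C)) cs

  merge-≡ : ∀ e cs → merge e cs ≡ merge′ e cs
  merge-≡ (p , q) cs rewrite List.partition-defn (touches? p q) cs = refl

  module _ {p q : V} {cs : List (List V)} where

    merge′-contains : ∀ {v C} → C ∈ˡ cs → v ∈ˡ C → Any (v ∈ˡ_) (merge′ (p , q) cs)
    merge′-contains {v} {C} C∈ v∈C with touches? p q C
    ... | yes t = here (∈-concat⁺′ v∈C (∈-filter⁺ (touches? p q) C∈ t))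
    ... | no ¬t = there (lose (∈-filter⁺ (λ C → ¬? (touches? p q C)) C∈ ¬t) v∈C)

    merge′-together : ∀ {v w} → Together v w cs → Together v w (merge′ (p , q) cs)
    merge′-together tog with find tog
    ... | C , C∈ , v∈C , w∈C with touches? p q C
    ...   | yes t = let C∈′ = ∈-filter⁺ (touches? p q) C∈ t in
                    here (∈-concat⁺′ v∈C C∈′ , ∈-concat⁺′ w∈C C∈′)
    ...   | no ¬t = there (lose (∈-filter⁺ (λ C → ¬? (touches? p q C)) C∈ ¬t) (v∈C , w∈C))

    merge′-links : ∀ {C D} → C ∈ˡ cs → p ∈ˡ C → D ∈ˡ cs → q ∈ˡ D → Together p q (merge′ (p , q) cs)
    merge′-links C∈ p∈C D∈ q∈D =
      here (∈-concat⁺′ p∈C (∈-filter⁺ (touches? p q) C∈ (inj₁ p∈C)) ,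
            ∈-concat⁺′ q∈D (∈-filter⁺ (touches? p q) D∈ (inj₂ q∈D)))

    merge′-disjoint : AllPairs DisjointLists cs → AllPairs DisjointLists (merge′ (p , q) cs)
    merge′-disjoint dis =
      All.tabulate (λ {D} D∈ {v} v∈ v∈D →
        let C , v∈C , C∈ = ∈-concat⁻′ (filter (touches? p q) cs) v∈
            C∈cs , t = ∈-filter⁻ (touches? p q) {xs = cs} C∈
            D∈cs , ¬t = ∈-filter⁻ (λ C → ¬? (touches? p q C)) {xs = cs} D∈
        in ¬t (subst (λ C → p ∈ˡ C ⊎ q ∈ˡ C) (overlap⇒≡ dis C∈cs D∈cs v∈C v∈D) t))
      ∷ AllPairs-filter
      where
      AllPairs-filter : AllPairs DisjointLists (filter (λ C → ¬? (touches? p q C)) cs)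
      AllPairs-filter = AllPairs.filter⁺ (λ C → ¬? (touches? p q C)) dis
        where import Data.List.Relation.Unary.AllPairs.Properties as AllPairs

    merge′-constant : ∀ {k : V → Bool} → k p ≡ k q → All (λ C → ∀ {v w} → v ∈ˡ C → w ∈ˡ C → k v ≡ k w) cs →
                      All (λ C → ∀ {v w} → v ∈ˡ C → w ∈ˡ C → k v ≡ k w) (merge′ (p , q) cs)
    merge′-constant {k} kp≡kq const =
      (λ v∈ w∈ → trans (value v∈) (sym (value w∈))) ∷ All.filter⁺ (λ C → ¬? (touches? p q C)) const
      where
      value : ∀ {v} → v ∈ˡ concat (filter (touches? p q) cs) → k v ≡ k p
      value v∈ with ∈-concat⁻′ (filter (touches? p q) cs) v∈
      ... | C , v∈C , C∈ with ∈-filter⁻ (touches? p q) {xs = cs} C∈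
      ...   | C∈cs , inj₁ p∈C = All.lookup const C∈cs v∈C p∈C
      ...   | C∈cs , inj₂ q∈C = trans (All.lookup const C∈cs v∈C q∈C) (sym kp≡kq)

  module _ (vertices : List V) where

    components-cover : ∀ links {v} → v ∈ˡ vertices → Any (v ∈ˡ_) (components vertices links)
    components-cover [] v∈ = Any.map⁺ (Any.map here v∈)
    components-cover (e ∷ links) v∈ =
      let C , C∈ , v∈C = find (components-cover links v∈)
      in subst (Any _) (sym (merge-≡ e (components vertices links))) (merge′-contains {cs = components vertices links} C∈ v∈C)

    components-linked : ∀ links → All (λ (p , q) → p ∈ˡ vertices × q ∈ˡ vertices) links →
                        ∀ {p q} → (p , q) ∈ˡ links → Together p q (components vertices links)
    components-linked (e ∷ links) ((p∈ , q∈) ∷ _) (here refl) =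
      let C , C∈ , p∈C = find (components-cover links p∈)
          D , D∈ , q∈D = find (components-cover links q∈)
      in subst (Together _ _) (sym (merge-≡ e (components vertices links))) (merge′-links {cs = components vertices links} C∈ p∈C D∈ q∈D)
    components-linked (e ∷ links) (_ ∷ ∈vs) (there e∈) =
      subst (Together _ _) (sym (merge-≡ e (components vertices links))) (merge′-together (components-linked links ∈vs e∈))

    components-disjoint : Unique vertices → ∀ links → AllPairs DisjointLists (components vertices links)
    components-disjoint u [] = singletons u
      where
      singletons : ∀ {vs} → Unique vs → AllPairs DisjointLists (map [_] vs)
      singletons []       = []
      singletons (≢ ∷ u) = All.map⁺ (All.map (λ { x≢y (here refl) (here refl) → x≢y refl }) ≢) ∷ singletons u
    components-disjoint u (e ∷ links) =
      subst (AllPairs _) (sym (merge-≡ e (components vertices links))) (merge′-disjoint (components-disjoint u links))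

    components-constant : ∀ links {k : V → Bool} → All (λ (p , q) → k p ≡ k q) links →
                          All (λ C → ∀ {v w} → v ∈ˡ C → w ∈ˡ C → k v ≡ k w) (components vertices links)
    components-constant [] _ = All.map⁺ (All.tabulate λ { _ (here refl) (here refl) → refl })
    components-constant (e ∷ links) (eq ∷ eqs) =
      subst (All _) (sym (merge-≡ e (components vertices links))) (merge′-constant eq (components-constant links eqs))

    components-nonempty : ∀ links → All (λ (p , _) → p ∈ˡ vertices) links →
                          All (λ C → ∃ λ v → v ∈ˡ C × v ∈ˡ vertices) (components vertices links)
    components-nonempty [] _ = All.map⁺ (All.tabulate λ v∈ → _ , here refl , v∈)
    components-nonempty ((p , q) ∷ links) (p∈ ∷ ps∈) =
      subst (All _) (sym (merge-≡ (p , q) (components vertices links)))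
        ( (let C , C∈ , p∈C = find (components-cover links p∈)
           in p , ∈-concat⁺′ p∈C (∈-filter⁺ (touches? p q) C∈ (inj₁ p∈C)) , p∈)
        ∷ All.filter⁺ (λ C → ¬? (touches? p q C)) (components-nonempty links ps∈))

    module _ (unique : Unique vertices) (links : List (V × V))
             (∈vertices : All (λ (p , q) → p ∈ˡ vertices × q ∈ˡ vertices) links) where

      infix 4 _~_
      -- Vertices not in the list lie in no component, so `Together` alone is not reflexive; with
      -- equality added it is an equivalence relation on all of V.
      _~_ : Rel V a
      p ~ q = p ≡ q ⊎ Together p q (components vertices links)

      ~-link : ∀ {p q} → (p , q) ∈ˡ links → p ~ q
      ~-link = inj₂ ∘ components-linked links ∈vertices

      ~-isEquivalence : IsEquivalence _~_
      ~-isEquivalence = record { refl = inj₁ refl ; sym = ~-sym ; trans = ~-trans }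
        where
        ~-sym : ∀ {p q} → p ~ q → q ~ p
        ~-sym (inj₁ refl) = inj₁ refl
        ~-sym (inj₂ tog)  = inj₂ (Any.map swap tog)
        ~-trans : ∀ {p q r} → p ~ q → q ~ r → p ~ r
        ~-trans (inj₁ refl) q~r = q~r
        ~-trans p~q (inj₁ refl) = p~q
        ~-trans (inj₂ p~q) (inj₂ q~r) with find p~q | find q~r
        ... | C , C∈ , p∈C , q∈C | D , D∈ , q∈D , r∈D
          with refl ← overlap⇒≡ (components-disjoint unique links) C∈ D∈ q∈C q∈D = inj₂ (lose C∈ (p∈C , r∈D))

      ~⇒together : ∀ {p q} → p ∈ˡ vertices → p ~ q → Together p q (components vertices links)
      ~⇒together p∈ (inj₁ refl) = Any.map (λ p∈C → p∈C , p∈C) (components-cover links p∈)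
      ~⇒together p∈ (inj₂ tog)  = tog

      -- This bounds the components from above: two vertices are shown to be unconnected by a
      -- Boolean function which is constant on the links and separates them.
      ~-constant : ∀ {k : V → Bool} → All (λ (p , q) → k p ≡ k q) links → ∀ {p q} → p ~ q → k p ≡ k q
      ~-constant eqs (inj₁ refl) = refl
      ~-constant eqs (inj₂ tog) =
        let C , C∈ , p∈C , q∈C = find tog in All.lookup (components-constant links eqs) C∈ p∈C q∈C

      -- Double counting of the pairs of a closed component and a representative in it.
      length-closed : ∀ {b p} {B : Pred V b} {IsClosed : Pred (List V) p} (closed? : Decidable IsClosed) (reps : List V) →
        (∀ {C v} → IsClosed C → v ∈ˡ C → ¬ B v) →
        (∀ {C} → (∀ {v} → v ∈ˡ C → ¬ B v) → IsClosed C) →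
        All (_∈ˡ vertices) reps →
        (∀ {r v} → r ∈ˡ reps → v ~ r → ¬ B v) →
        Unique reps →
        (∀ {r r′} → r ∈ˡ reps → r′ ∈ˡ reps → r ~ r′ → r ≡ r′) →
        (∀ {v} → v ∈ˡ vertices → (∃ λ q → B q × v ~ q) ⊎ (∃ λ r → r ∈ˡ reps × v ~ r)) →
        length (filter closed? (components vertices links)) ≡ length reps
      length-closed {B = B} {IsClosed} closed? reps closed⇒ ⇒closed reps∈ reps-off ureps reps-apart reach = begin
        length (filter closed? cs)
          ≡⟨ length-⨁ (filter closed? cs) ⟩
        Count.⨁ (filter closed? cs) (λ _ → 1)
          ≡⟨ Count.⨁-cong∈ (filter closed? cs) (λ C∈ → let C∈cs , cl = ∈-filter⁻ closed? {xs = cs} C∈ in one-rep C∈cs cl) ⟨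
        Count.⨁ (filter closed? cs) (λ C → Count.⨁ reps (λ r → occurs r C))
          ≡⟨ Count.⨁-swap (filter closed? cs) reps _ ⟩
        Count.⨁ reps (λ r → Count.⨁ (filter closed? cs) (λ C → occurs r C))
          ≡⟨ Count.⨁-cong∈ reps one-component ⟩
        Count.⨁ reps (λ _ → 1)
          ≡⟨ length-⨁ reps ⟨
        length reps ∎
        where
        open ≡-Reasoning
        cs = components vertices links
        occurs : V → List V → ℕ
        occurs r C = Count.when (does (r ∈ˡ? C)) 1
        disjoint = components-disjoint unique links
        unique-cs : Unique cs
        unique-cs = go disjoint (components-nonempty links (All.map proj₁ ∈vertices))
          where
          go : ∀ {cs} → AllPairs DisjointLists cs → All (λ C → ∃ λ v → v ∈ˡ C × v ∈ˡ vertices) cs → Unique cs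
          go [] [] = []
          go (dis ∷ ap) ((v , v∈ , _) ∷ ne) = All.map (λ { d refl → d v∈ v∈ }) dis ∷ go ap ne
        one-rep : ∀ {C} → C ∈ˡ cs → IsClosed C → Count.⨁ reps (λ r → occurs r C) ≡ 1
        one-rep {C} C∈ cl with All.lookup (components-nonempty links (All.map proj₁ ∈vertices)) C∈
        ... | v , v∈C , v∈ = trans (Count.⨁-single ureps (proj₁ (proj₂ rep)) other)
                                   (Count.when-congˡ 1 (dec-true (_ ∈ˡ? C) (proj₂ (proj₂ rep))))
          where
          in-C : ∀ {q} → v ~ q → q ∈ˡ C
          in-C (inj₁ refl) = v∈C
          in-C (inj₂ tog) = let D , D∈ , v∈D , q∈D = find tog in
            subst (_ ∈ˡ_) (overlap⇒≡ disjoint D∈ C∈ v∈D v∈C) q∈D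
          rep : ∃ λ r → r ∈ˡ reps × r ∈ˡ C
          -- A closed component avoids B, so what is reached from its vertex v can only be a
          -- representative.
          rep with reach v∈
          ... | inj₁ (q , Bq , v~q) = contradiction Bq (closed⇒ cl (in-C v~q))
          ... | inj₂ (r , r∈ , v~r) = r , r∈ , in-C v~r
          other : ∀ {r} → r ∈ˡ reps → r ≢ proj₁ rep → occurs r C ≡ 0
          other {r} r∈ r≢ = Count.when-congˡ 1 (dec-false (r ∈ˡ? C)
            λ r∈C → r≢ (reps-apart r∈ (proj₁ (proj₂ rep)) (inj₂ (lose C∈ (r∈C , proj₂ (proj₂ rep))))))
        one-component : ∀ {r} → r ∈ˡ reps → Count.⨁ (filter closed? cs) (λ C → occurs r C) ≡ 1
        one-component {r} r∈ with find (components-cover links (All.lookup reps∈ r∈))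
        ... | C , C∈ , r∈C = trans (Count.⨁-single (Unique.filter⁺ closed? unique-cs)
                (∈-filter⁺ closed? C∈ (⇒closed λ v∈C → reps-off r∈ (inj₂ (lose C∈ (v∈C , r∈C))))) other)
              (Count.when-congˡ 1 (dec-true (r ∈ˡ? C) r∈C))
          where
          other : ∀ {D} → D ∈ˡ filter closed? cs → D ≢ C → occurs r D ≡ 0
          other {D} D∈ D≢C = Count.when-congˡ 1 (dec-false (r ∈ˡ? D)
            λ r∈D → D≢C (overlap⇒≡ disjoint (proj₁ (∈-filter⁻ closed? {xs = cs} D∈)) C∈ r∈D r∈C))

-- Components of an uncrossed picture

-- A slot on each closed loop, next to the uncrossing which closes it.
loopReps : ∀ {m} (τ : Fin m → Fin m) → ℕ → (w : LeftHalf m) → Vec Uncrossing (length w) → List (ℕ × Fin m)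
loopReps τ t []      []               = []
loopReps τ t (a ∷ w) (horizontal ∷ c) = loopReps τ (suc t) w c
loopReps τ t (a ∷ w) (vertical ∷ c)   =
  if does (closes? a (shape τ w c)) then (suc t , upper a) ∷ loopReps τ (suc t) w c else loopReps τ (suc t) w c

length-loopReps : ∀ {m} (τ : Fin m → Fin m) t w c → length (loopReps τ t w c) ≡ loopCount τ w c
length-loopReps τ t []      []               = refl
length-loopReps τ t (a ∷ w) (horizontal ∷ c) = length-loopReps τ (suc t) w c
length-loopReps τ t (a ∷ w) (vertical ∷ c) with does (closes? a (shape τ w c))
... | true  = cong suc (length-loopReps τ (suc t) w c)
... | false = length-loopReps τ (suc t) w c

Within : ℕ → ℕ → ℕ → Set
Within lo hi t = lo ≤ t × t ≤ hi

within-suc : ∀ {lo k t} → Within (suc lo) (suc lo ℕ.+ k) t → Within lo (lo ℕ.+ suc k) t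
within-suc {lo} {k} {t} (l , h) = ℕ.<⇒≤ l , subst (t ≤_) (sym (ℕ.+-suc lo k)) h

loopReps-columns : ∀ {m} (τ : Fin m → Fin m) t w c →
  All (λ (t′ , _) → Within (suc t) (t ℕ.+ length w) t′) (loopReps τ t w c)
loopReps-columns τ t []      []               = []
loopReps-columns τ t (a ∷ w) (horizontal ∷ c) =
  All.map (λ {h} → λ (l , r) → ℕ.<⇒≤ l , subst (proj₁ h ≤_) (sym (ℕ.+-suc t _)) r) (loopReps-columns τ (suc t) w c)
loopReps-columns τ t (a ∷ w) (vertical ∷ c) with does (closes? a (shape τ w c)) | loopReps-columns τ (suc t) w c
... | true  | ih = (ℕ.≤-refl , subst (suc t ≤_) (sym (ℕ.+-suc t _)) (ℕ.m≤m+n (suc t) _))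
                   ∷ All.map (λ {h} → λ (l , r) → ℕ.<⇒≤ l , subst (proj₁ h ≤_) (sym (ℕ.+-suc t _)) r) ih
... | false | ih = All.map (λ {h} → λ (l , r) → ℕ.<⇒≤ l , subst (proj₁ h ≤_) (sym (ℕ.+-suc t _)) r) ih

loopReps-unique : ∀ {m} (τ : Fin m → Fin m) t w c → Unique (loopReps τ t w c)
loopReps-unique τ t []      []               = []
loopReps-unique τ t (a ∷ w) (horizontal ∷ c) = loopReps-unique τ (suc t) w c
loopReps-unique τ t (a ∷ w) (vertical ∷ c) with does (closes? a (shape τ w c))
... | true  = All.map (λ { (l , _) refl → ℕ.<-irrefl refl l }) (loopReps-columns τ (suc t) w c) ∷ loopReps-unique τ (suc t) w c
... | false = loopReps-unique τ (suc t) w c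

module _ {m} {s : Side} {t : ℕ} {a : Crossing m} {p} {P : Pred (Strand m) p} where

  private
    off? : Decidable (λ x → x ≢ upper a × x ≢ lower a)
    off? x = ¬? (x Fin.≟ upper a) ×-dec ¬? (x Fin.≟ lower a)

  horizontal⁺ : (∀ x → P ((s , t , x) , (s , suc t , x))) → All P (uncross horizontal s t a)
  horizontal⁺ h = All.map⁺ (All.tabulate λ {x} _ → h x)

  horizontal⁻ : All P (uncross horizontal s t a) → ∀ x → P ((s , t , x) , (s , suc t , x))
  horizontal⁻ all x = All.lookup all (∈-map⁺ _ (∈-allFin x))

  vertical⁺ : P ((s , t , upper a) , (s , t , lower a)) → P ((s , suc t , upper a) , (s , suc t , lower a)) →
              (∀ x → x ≢ upper a → x ≢ lower a → P ((s , t , x) , (s , suc t , x))) → All P (uncross vertical s t a)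
  vertical⁺ outer inner h = outer ∷ inner ∷ All.map⁺ (All.tabulate λ {x} x∈ →
    let _ , x≢u , x≢l = ∈-filter⁻ off? {xs = allFin m} x∈ in h x x≢u x≢l)

  vertical⁻ : All P (uncross vertical s t a) → ∀ x → x ≢ upper a → x ≢ lower a → P ((s , t , x) , (s , suc t , x))
  vertical⁻ (_ ∷ _ ∷ all) x x≢u x≢l = All.lookup all (∈-map⁺ _ (∈-filter⁺ off? (∈-allFin x) (x≢u , x≢l)))

uncrossHalf-columns : ∀ {m} s t (w : LeftHalf m) c →
  All (λ ((_ , t₁ , _) , (_ , t₂ , _)) → Within t (t ℕ.+ length w) t₁ × Within t (t ℕ.+ length w) t₂) (uncrossHalf s t w c)
uncrossHalf-columns s t []      []      = []
uncrossHalf-columns s t (a ∷ w) (u ∷ c) =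
  All.++⁺ (here-columns u) (All.map (λ (x , y) → within-suc x , within-suc y) (uncrossHalf-columns s (suc t) w c))
  where
  outer : Within t (t ℕ.+ suc (length w)) t
  outer = ℕ.≤-refl , ℕ.m≤m+n t _
  inner : Within t (t ℕ.+ suc (length w)) (suc t)
  inner = ℕ.n≤1+n t , subst (suc t ≤_) (sym (ℕ.+-suc t _)) (ℕ.m≤m+n (suc t) _)
  InRange : Strand _ → Set
  InRange ((_ , t₁ , _) , (_ , t₂ , _)) = Within t (t ℕ.+ suc (length w)) t₁ × Within t (t ℕ.+ suc (length w)) t₂
  here-columns : ∀ u → All InRange (uncross u s t a)
  here-columns horizontal = horizontal⁺ {s = s} {t} {a} {P = InRange} λ _ → outer , inner
  here-columns vertical   = vertical⁺ {s = s} {t} {a} {P = InRange} (outer , outer) (inner , inner) λ _ _ _ → outer , inner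

-- Colourings of the uncrossed left half which are constant on its strands; the
-- mirror image of a slot of colour k has colour ι k.
module Colouring {m : ℕ} {K : Set} (ι : K → K) where

  ConstantOn : (ℕ → Fin m → K) → Strand m → Set
  ConstantOn k ((_ , t₁ , p₁) , (_ , t₂ , p₂)) = k t₁ p₁ ≡ k t₂ p₂

  Constant : (ℕ → Fin m → K) → List (Strand m) → Set
  Constant k = All (ConstantOn k)

  -- A fixed point of τ is an edge from a slot to its mirror image, so its colour has to be
  -- invariant under ι.
  record Admissible (τ : Fin m → Fin m) (b : Fin m → K) : Set where
    field
      along : ∀ p → b (τ p) ≡ b p
      fixed : ∀ p → τ p ≡ p → ι (b p) ≡ b p
  open Admissible

  module Inner (a : Crossing m) {τ : Fin m → Fin m} (H : HalfTL τ) {b : Fin m → K}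
               (adm : Admissible (Join.join a τ) b) (r : K) (ιr : ι r ≡ r) where

    open Join a τ
    open HalfTL H

    -- The colour of the inner cap: free to be r on a closed loop, and otherwise that of the strand
    -- through the cap, read off at τ u, or at τ l when u is horizontal.
    v : K
    v = if does (closes? a τ) then r else if does (τ u Fin.≟ u) then b (τ l) else b (τ u)

    inner : Fin m → K
    inner p = if does ((p Fin.≟ u) ⊎-dec (p Fin.≟ l)) then v else b p

    inner-on : ∀ {p} → p ≡ u ⊎ p ≡ l → inner p ≡ v
    inner-on {p} on rewrite dec-true ((p Fin.≟ u) ⊎-dec (p Fin.≟ l)) on = refl

    inner-off : ∀ {p} → p ≢ u → p ≢ l → inner p ≡ b p
    inner-off {p} p≢u p≢l rewrite dec-false ((p Fin.≟ u) ⊎-dec (p Fin.≟ l)) [ p≢u , p≢l ]′ = refl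

    v-closed : JoinCompat.Closes a H → v ≡ r
    v-closed cl rewrite dec-true (closes? a τ) cl = refl

    v-u : τ u ≢ u → τ u ≢ l → v ≡ b (τ u)
    v-u τu≢u τu≢l rewrite dec-false (closes? a τ) [ τu≢l , τu≢u ∘ proj₁ ]′ | dec-false (τ u Fin.≟ u) τu≢u = refl

    v-free : τ u ≡ u → τ l ≢ l → v ≡ b (τ l)
    v-free τu≡u τl≢l
      rewrite dec-false (closes? a τ) [ (λ e → l≢u (trans (sym e) τu≡u)) , τl≢l ∘ proj₂ ]′
            | dec-true (τ u Fin.≟ u) τu≡u = refl

    v-l : τ l ≢ l → τ l ≢ u → v ≡ b (τ l)
    v-l τl≢l τl≢u = cases (τ u Fin.≟ u)
      where
      cases : Dec (τ u ≡ u) → v ≡ b (τ l)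
      cases (yes τu≡u) = v-free τu≡u τl≢l
      cases (no τu≢u) = trans (v-u τu≢u (τl≢u ∘ flip))
                         (trans (sym (along adm (τ u)))
                                (cong b (join-viaᵘ τu≢u (τl≢u ∘ flip) (involutive u) τl≢l)))

    ι-inner-u : τ u ≡ u → ι v ≡ v
    ι-inner-u τu≡u = cases (τ l Fin.≟ l)
      where
      cases : Dec (τ l ≡ l) → ι v ≡ v
      cases (yes τl≡l) = subst (λ x → ι x ≡ x) (sym (v-closed (inj₂ (τu≡u , τl≡l)))) ιr
      cases (no τl≢l)  = subst (λ x → ι x ≡ x) (sym (v-l τl≢l τl≢u))
        (fixed adm (τ l) (join-freeᵘ τl≢u τl≢l (involutive l) τu≡u))
        where
        τl≢u : τ l ≢ u
        τl≢u e = l≢u (injective (trans e (sym τu≡u)))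

    ι-inner-l : τ l ≡ l → ι v ≡ v
    ι-inner-l τl≡l = cases (τ u Fin.≟ u)
      where
      cases : Dec (τ u ≡ u) → ι v ≡ v
      cases (yes τu≡u) = ι-inner-u τu≡u
      cases (no τu≢u)  = subst (λ x → ι x ≡ x) (sym (v-u τu≢u τu≢l))
        (fixed adm (τ u) (join-freeˡ τu≢u τu≢l (involutive u) τl≡l))
        where
        τu≢l : τ u ≢ l
        τu≢l e = l≢u (injective (trans τl≡l (sym e)))

    along-u : ∀ {p} → p ≢ u → p ≢ l → τ p ≡ u → inner (τ p) ≡ inner p
    along-u p≢u p≢l τp≡u = trans (inner-on (inj₁ τp≡u))
      (trans (v-u (λ e → p≢u (trans (sym (flip τp≡u)) e)) (λ e → p≢l (trans (sym (flip τp≡u)) e)))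
      (trans (cong b (flip τp≡u)) (sym (inner-off p≢u p≢l))))

    along-l : ∀ {p} → p ≢ u → p ≢ l → τ p ≡ l → inner (τ p) ≡ inner p
    along-l p≢u p≢l τp≡l = trans (inner-on (inj₂ τp≡l))
      (trans (v-l (λ e → p≢l (trans (sym (flip τp≡l)) e)) (λ e → p≢u (trans (sym (flip τp≡l)) e)))
      (trans (cong b (flip τp≡l)) (sym (inner-off p≢u p≢l))))

    inner-admissible : Admissible τ inner
    along inner-admissible p with view p
    ... | at-u refl _ = trans (cases (τ u Fin.≟ u) (τ u Fin.≟ l)) (sym (inner-on (inj₁ refl)))
      where
      cases : Dec (τ u ≡ u) → Dec (τ u ≡ l) → inner (τ u) ≡ v
      cases (yes τu≡u) _ = inner-on (inj₁ τu≡u)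
      cases (no _) (yes τu≡l) = inner-on (inj₂ τu≡l)
      cases (no τu≢u) (no τu≢l) = trans (inner-off τu≢u τu≢l) (sym (v-u τu≢u τu≢l))
    ... | at-l refl _ = trans (cases (τ l Fin.≟ u) (τ l Fin.≟ l)) (sym (inner-on (inj₂ refl)))
      where
      cases : Dec (τ l ≡ u) → Dec (τ l ≡ l) → inner (τ l) ≡ v
      cases (yes τl≡u) _ = inner-on (inj₁ τl≡u)
      cases (no _) (yes τl≡l) = inner-on (inj₂ τl≡l)
      cases (no τl≢u) (no τl≢l) = trans (inner-off τl≢u τl≢l) (sym (v-l τl≢l τl≢u))
    ... | freeˡ p≢u p≢l τp≡u _ _ = along-u p≢u p≢l τp≡u
    ... | viaᵘ p≢u p≢l τp≡u _ _ = along-u p≢u p≢l τp≡u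
    ... | freeᵘ p≢u p≢l τp≡l _ _ = along-l p≢u p≢l τp≡l
    ... | viaˡ p≢u p≢l τp≡l _ _ = along-l p≢u p≢l τp≡l
    ... | other p≢u p≢l τp≢u τp≢l eq = trans (inner-off τp≢u τp≢l)
        (trans (cong b (sym eq)) (trans (along adm p) (sym (inner-off p≢u p≢l))))
    fixed inner-admissible p τp≡p with view p
    ... | at-u refl _ = subst (λ x → ι x ≡ x) (sym (inner-on (inj₁ refl))) (ι-inner-u τp≡p)
    ... | at-l refl _ = subst (λ x → ι x ≡ x) (sym (inner-on (inj₂ refl))) (ι-inner-l τp≡p)
    ... | freeˡ p≢u _ τp≡u _ _ = contradiction (trans (sym τp≡p) τp≡u) p≢u
    ... | viaᵘ p≢u _ τp≡u _ _ = contradiction (trans (sym τp≡p) τp≡u) p≢u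
    ... | freeᵘ _ p≢l τp≡l _ _ = contradiction (trans (sym τp≡p) τp≡l) p≢l
    ... | viaˡ _ p≢l τp≡l _ _ = contradiction (trans (sym τp≡p) τp≡l) p≢l
    ... | other p≢u p≢l _ _ eq = subst (λ x → ι x ≡ x) (sym (inner-off p≢u p≢l)) (fixed adm p (trans eq τp≡p))

  record Extension (τ : Fin m → Fin m) t w c (b : Fin m → K) (r : ℕ × Fin m → K) : Set where
    field
      colour   : ℕ → Fin m → K
      boundary : ∀ p → colour t p ≡ b p
      constant : ∀ s → Constant colour (uncrossHalf s t w c)
      axis     : Admissible τ (colour (t ℕ.+ length w))
      on-reps  : All (λ h → colour (proj₁ h) (proj₂ h) ≡ r h) (loopReps τ t w c)
  open Extension

  admissible-cong : ∀ {τ b b′} → b ≗ b′ → Admissible τ b → Admissible τ b′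
  along (admissible-cong {τ} eq adm) p = trans (sym (eq (τ p))) (trans (along adm p) (eq p))
  fixed (admissible-cong {τ} eq adm) p e = subst (λ x → ι x ≡ x) (eq p) (fixed adm p e)

  module _ {τ : Fin m → Fin m} (H : HalfTL τ) (r : ℕ × Fin m → K) (ιr : ∀ h → ι (r h) ≡ r h) where

    prepend : ℕ → (Fin m → K) → (ℕ → Fin m → K) → ℕ → Fin m → K
    prepend t b k t′ p = if does (t′ ℕ.≟ t) then b p else k t′ p

    prepend-≡ : ∀ t b k p → prepend t b k t p ≡ b p
    prepend-≡ t b k p rewrite dec-true (t ℕ.≟ t) refl = refl

    prepend-> : ∀ t b k {t′} p → t ℕ.< t′ → prepend t b k t′ p ≡ k t′ p
    prepend-> t b k {t′} p t<t′ rewrite dec-false (t′ ℕ.≟ t) (ℕ.>⇒≢ t<t′) = refl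

    module _ (a : Crossing m) (w : LeftHalf m) (c : Vec Uncrossing (length w)) {t : ℕ} {b : Fin m → K} where

      prepend-constant : ∀ {b′} (ext : Extension τ (suc t) w c b′ r) s →
                         Constant (prepend t b (colour ext)) (uncrossHalf s (suc t) w c)
      prepend-constant ext s = All.zipWith
        (λ (eq , (l₁ , _) , (l₂ , _)) → trans (prepend-> t b (colour ext) _ l₁) (trans eq (sym (prepend-> t b (colour ext) _ l₂))))
        (constant ext s , uncrossHalf-columns s (suc t) w c)

      prepend-axis : ∀ {b′} (ext : Extension τ (suc t) w c b′ r) →
                     Admissible τ (prepend t b (colour ext) (t ℕ.+ suc (length w)))
      prepend-axis ext = admissible-cong (λ p → trans (cong (λ t′ → colour ext t′ p) (sym (ℕ.+-suc t _)))
          (sym (prepend-> t b (colour ext) p (subst (t ℕ.<_) (sym (ℕ.+-suc t _)) (s≤s (ℕ.m≤m+n t _))))))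
        (axis ext)

      prepend-reps : ∀ {b′} (ext : Extension τ (suc t) w c b′ r) →
                     All (λ h → prepend t b (colour ext) (proj₁ h) (proj₂ h) ≡ r h) (loopReps τ (suc t) w c)
      prepend-reps ext = All.zipWith
        (λ (eq , l , _) → trans (prepend-> t b (colour ext) _ (ℕ.<-trans ℕ.≤-refl l)) eq)
        (on-reps ext , loopReps-columns τ (suc t) w c)

    -- The colouring is built column by column from the boundary towards the axis. Each inner cap
    -- inherits its colour unless it closes a loop, and then the prescribed value r is used; this
    -- freedom later separates the loops from the boundary and from each other.
    extend : ∀ t w c {b} → Admissible (shape τ w c) b → Extension τ t w c b r
    extend t [] [] {b} adm = record
      { colour = λ _ → b ; boundary = λ _ → refl ; constant = λ _ → [] ; axis = adm ; on-reps = [] }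
    extend t (a ∷ w) (horizontal ∷ c) {b} adm = record
      { colour = k ; boundary = prepend-≡ t b (colour ext)
      ; constant = λ s → All.++⁺ (horizontal⁺ {s = s} {t} {a} {P = ConstantOn k} λ p → trans (prepend-≡ t b (colour ext) p)
            (trans (sym (boundary ext p)) (sym (prepend-> t b (colour ext) p ℕ.≤-refl)))) (prepend-constant a w c ext s)
      ; axis = prepend-axis a w c ext
      ; on-reps = prepend-reps a w c ext }
      where
      ext = extend (suc t) w c adm
      k = prepend t b (colour ext)
    extend t (a ∷ w) (vertical ∷ c) {b} adm = record
      { colour = k ; boundary = prepend-≡ t b (colour ext)
      ; constant = λ s → All.++⁺ (vertical⁺ {s = s} {t} {a} {P = ConstantOn k}
            (trans (prepend-≡ t b (colour ext) u) (trans (sym (along adm u)) (trans (cong b join-u) (sym (prepend-≡ t b (colour ext) l)))))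
            (trans (next u) (trans (inner-on (inj₁ refl)) (sym (trans (next l) (inner-on (inj₂ refl))))))
            (λ p p≢u p≢l → trans (prepend-≡ t b (colour ext) p) (sym (trans (next p) (inner-off p≢u p≢l)))))
          (prepend-constant a w c ext s)
      ; axis = prepend-axis a w c ext
      ; on-reps = reps }
      where
      open Join a (shape τ w c)
      open Inner a (shape-half H w c) adm (r (suc t , upper a)) (ιr (suc t , upper a))
      ext = extend (suc t) w c inner-admissible
      k = prepend t b (colour ext)
      next : ∀ p → k (suc t) p ≡ inner p
      next p = trans (prepend-> t b (colour ext) p ℕ.≤-refl) (boundary ext p)
      reps : All (λ h → k (proj₁ h) (proj₂ h) ≡ r h) (loopReps τ t (a ∷ w) (vertical ∷ c))
      reps = cases (closes? a (shape τ w c))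
        where
        cases : (cl? : Dec (JoinCompat.Closes a (shape-half H w c))) →
                All (λ h → k (proj₁ h) (proj₂ h) ≡ r h)
                    (if does cl? then (suc t , upper a) ∷ loopReps τ (suc t) w c else loopReps τ (suc t) w c)
        cases (yes cl) = trans (next u) (trans (inner-on (inj₁ refl)) (v-closed cl)) ∷ prepend-reps a w c ext
        cases (no _)   = prepend-reps a w c ext

-- Connections forced by the strands of an uncrossed picture

module Connected {m} {ℓ} {_~_ : Rel (Slot m) ℓ} (equiv : IsEquivalence _~_) where

  open IsEquivalence equiv renaming (refl to ~-refl; sym to ~-sym; trans to ~-trans; reflexive to ~-reflexive)

  Linked : List (Strand m) → Set ℓ
  Linked = All λ (p , q) → p ~ q

  -- The equivalence relation is left arbitrary because two are needed: the components of the
  -- strands alone for the shape, and those with mirror images identified for the loops.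
  record Joins (τ : Fin m → Fin m) (t : ℕ) : Set ℓ where
    field
      arcs  : ∀ s p → (s , t , p) ~ (s , t , τ p)
      fixed : ∀ p → τ p ≡ p → (left , t , p) ~ (right , t , p)
  open Joins

  module _ {τ : Fin m → Fin m} (H : HalfTL τ) where

    module Step (a : Crossing m) w c {t}
                (joins : Joins (shape τ w c) (suc t))
                (outer : ∀ s → (s , t , upper a) ~ (s , t , lower a))
                (inner : ∀ s → (s , suc t , upper a) ~ (s , suc t , lower a))
                (through : ∀ s p → p ≢ upper a → p ≢ lower a → (s , t , p) ~ (s , suc t , p)) where

      open Join a (shape τ w c)
      open HalfTL (shape-half H w c)

      private
        τ′ = shape τ w c

      to : ∀ s {p q} → p ≢ u → p ≢ l → τ′ p ≡ q → (s , t , p) ~ (s , suc t , q)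
      to s {p} p≢u p≢l refl = ~-trans (through s p p≢u p≢l) (arcs joins s p)

      joined : Joins join t
      arcs joined s p with view p
      ... | at-u refl eq = subst (λ q → _ ~ (s , t , q)) (sym eq) (outer s)
      ... | at-l refl eq = subst (λ q → _ ~ (s , t , q)) (sym eq) (~-sym (outer s))
      ... | freeˡ _ _ _ _ eq = subst (λ q → _ ~ (s , t , q)) (sym eq) ~-refl
      ... | freeᵘ _ _ _ _ eq = subst (λ q → _ ~ (s , t , q)) (sym eq) ~-refl
      ... | viaᵘ p≢u p≢l τp≡u τl≢l eq = subst (λ q → _ ~ (s , t , q)) (sym eq)
              (~-trans (to s p≢u p≢l τp≡u) (~-trans (inner s)
                (~-sym (to s (λ e → p≢l (injective (trans τp≡u (sym e)))) τl≢l (involutive l)))))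
      ... | viaˡ p≢u p≢l τp≡l τu≢u eq = subst (λ q → _ ~ (s , t , q)) (sym eq)
              (~-trans (to s p≢u p≢l τp≡l) (~-trans (~-sym (inner s))
                (~-sym (to s τu≢u (λ e → p≢u (injective (trans τp≡l (sym e)))) (involutive u)))))
      ... | other p≢u p≢l τp≢u τp≢l eq = subst (λ q → _ ~ (s , t , q)) (sym eq)
              (~-trans (to s p≢u p≢l refl) (~-sym (through s (τ′ p) τp≢u τp≢l)))
      fixed joined p jp≡p with view p
      ... | at-u refl eq = contradiction (trans (sym eq) jp≡p) l≢u
      ... | at-l refl eq = contradiction (sym (trans (sym eq) jp≡p)) l≢u
      ... | freeˡ p≢u p≢l τp≡u τl≡l _ = ~-trans (to left p≢u p≢l τp≡u) (~-trans (inner left)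
              (~-trans (fixed joins l τl≡l) (~-trans (~-sym (inner right)) (~-sym (to right p≢u p≢l τp≡u)))))
      ... | freeᵘ p≢u p≢l τp≡l τu≡u _ = ~-trans (to left p≢u p≢l τp≡l) (~-trans (~-sym (inner left))
              (~-trans (fixed joins u τu≡u) (~-trans (inner right) (~-sym (to right p≢u p≢l τp≡l)))))
      ... | viaᵘ _ _ τp≡u _ eq = contradiction (trans (sym τp≡u) (flip (trans (sym eq) jp≡p))) (l≢u ∘ sym)
      ... | viaˡ _ _ τp≡l _ eq = contradiction (trans (sym τp≡l) (flip (trans (sym eq) jp≡p))) l≢u
      ... | other p≢u p≢l _ _ eq = ~-trans (through left p p≢u p≢l)
              (~-trans (fixed joins p (trans (sym eq) jp≡p)) (~-sym (through right p p≢u p≢l)))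

      -- Away from the crossing a slot continues straight to the previous column. From the inner cap
      -- one leaves along τ′ from one of its ends; some end leads elsewhere precisely because no
      -- loop is closed.
      reach : ∀ q → ¬ JoinCompat.Closes a (shape-half H w c) → ∃ λ q′ → (left , suc t , q) ~ (left , t , q′)
      reach q ¬cl with view q
      ... | at-u refl _ = cases (τ′ u Fin.≟ u)
        where
        cases : Dec (τ′ u ≡ u) → ∃ λ q′ → (left , suc t , u) ~ (left , t , q′)
        cases (no τu≢u) = τ′ u , ~-sym (to left τu≢u (¬cl ∘ inj₁) (involutive u))
        cases (yes τu≡u) = τ′ l , ~-trans (inner left)
          (~-sym (to left (λ e → l≢u (injective (trans e (sym τu≡u)))) (λ e → ¬cl (inj₂ (τu≡u , e))) (involutive l)))
      ... | at-l refl _ = cases (τ′ l Fin.≟ l)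
        where
        cases : Dec (τ′ l ≡ l) → ∃ λ q′ → (left , suc t , l) ~ (left , t , q′)
        cases (no τl≢l) = τ′ l , ~-sym (to left (¬cl ∘ inj₁ ∘ flip) τl≢l (involutive l))
        cases (yes τl≡l) = τ′ u , ~-trans (~-sym (inner left))
          (~-sym (to left (λ e → ¬cl (inj₂ (e , τl≡l))) (¬cl ∘ inj₁) (involutive u)))
      ... | freeˡ p≢u p≢l _ _ _ = q , ~-sym (through left q p≢u p≢l)
      ... | freeᵘ p≢u p≢l _ _ _ = q , ~-sym (through left q p≢u p≢l)
      ... | viaᵘ p≢u p≢l _ _ _ = q , ~-sym (through left q p≢u p≢l)
      ... | viaˡ p≢u p≢l _ _ _ = q , ~-sym (through left q p≢u p≢l)
      ... | other p≢u p≢l _ _ _ = q , ~-sym (through left q p≢u p≢l)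

      reach-closed : ∀ q → JoinCompat.Closes a (shape-half H w c) →
                     (∃ λ q′ → (left , suc t , q) ~ (left , t , q′)) ⊎ (left , suc t , q) ~ (left , suc t , u)
      reach-closed q cl with q Fin.≟ u | q Fin.≟ l
      ... | yes refl | _        = inj₂ ~-refl
      ... | no _     | yes refl = inj₂ (~-sym (inner left))
      ... | no q≢u   | no q≢l   = inj₁ (q , ~-sym (through left q q≢u q≢l))

    joins : ∀ t w c → Joins τ (t ℕ.+ length w) → (∀ s → Linked (uncrossHalf s t w c)) → Joins (shape τ w c) t
    joins t [] [] ax _ = subst (Joins τ) (ℕ.+-identityʳ t) ax
    joins t (a ∷ w) (horizontal ∷ c) ax links = record
      { arcs = λ s p → ~-trans (step s p) (~-trans (arcs J s p) (~-sym (step s _)))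
      ; fixed = λ p e → ~-trans (step left p) (~-trans (fixed J p e) (~-sym (step right p))) }
      where
      J = joins (suc t) w c (subst (Joins τ) (ℕ.+-suc t _) ax) (λ s → All.++⁻ʳ (uncross horizontal s t a) (links s))
      step : ∀ s p → (s , t , p) ~ (s , suc t , p)
      step s = horizontal⁻ {s = s} {t} {a} (All.++⁻ˡ (uncross horizontal s t a) (links s))
    joins t (a ∷ w) (vertical ∷ c) ax links = Step.joined a w c J
      (λ s → All.head (links s)) (λ s → All.head (All.tail (links s)))
      (λ s → vertical⁻ {s = s} {t} {a} (All.++⁻ˡ (uncross vertical s t a) (links s)))
      where
      J = joins (suc t) w c (subst (Joins τ) (ℕ.+-suc t _) ax) (λ s → All.++⁻ʳ (uncross vertical s t a) (links s))

    -- On the way back from column t′ to column t a strand can be stopped only at a crossing whose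
    -- inner cap closes a loop, and there it has met the representative of this loop.
    reaches : ∀ t w c → Joins τ (t ℕ.+ length w) → (∀ s → Linked (uncrossHalf s t w c)) →
      ∀ {t′} p → Within t (t ℕ.+ length w) t′ →
      (∃ λ q → (left , t′ , p) ~ (left , t , q)) ⊎ (∃ λ h → h ∈ˡ loopReps τ t w c × (left , t′ , p) ~ (left , h))
    reaches t [] [] _ _ {t′} p (l , h) = inj₁ (p , ~-reflexive (cong (λ t → left , t , p)
      (ℕ.≤-antisym (subst (t′ ≤_) (ℕ.+-identityʳ t) h) l)))
    reaches t (a ∷ w) (u ∷ c) ax links {t′} p (l , h) with ℕ.m≤n⇒m<n∨m≡n l
    ... | inj₂ refl = inj₁ (p , ~-refl)
    reaches t (a ∷ w) (u ∷ c) ax links {t′} p (l , h) | inj₁ t<t′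
      with reaches (suc t) w c (subst (Joins τ) (ℕ.+-suc t _) ax) (λ s → All.++⁻ʳ (uncross u s t a) (links s)) p
             (t<t′ , subst (t′ ≤_) (ℕ.+-suc t _) h)
    reaches t (a ∷ w) (horizontal ∷ c) ax links p _ | inj₁ _ | inj₂ r = inj₂ r
    reaches t (a ∷ w) (horizontal ∷ c) ax links p _ | inj₁ _ | inj₁ (q , p~q) =
      inj₁ (q , ~-trans p~q (~-sym (horizontal⁻ {s = left} {t} {a} (All.++⁻ˡ (uncross horizontal left t a) (links left)) q)))
    reaches t (a ∷ w) (vertical ∷ c) ax links p _ | inj₁ _ | inj₂ (h , h∈ , p~h) = inj₂ (h , weaken , p~h)
      where
      weaken : h ∈ˡ loopReps τ t (a ∷ w) (vertical ∷ c)
      weaken with does (closes? a (shape τ w c))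
      ... | true  = there h∈
      ... | false = h∈
    reaches t (a ∷ w) (vertical ∷ c) ax links {t′} p _ | inj₁ _ | inj₁ (q , p~q) = cases (closes? a (shape τ w c))
      where
      module St = Step a w c (joins (suc t) w c (subst (Joins τ) (ℕ.+-suc t _) ax) (λ s → All.++⁻ʳ (uncross vertical s t a) (links s)))
        (λ s → All.head (links s)) (λ s → All.head (All.tail (links s)))
        (λ s → vertical⁻ {s = s} {t} {a} (All.++⁻ˡ (uncross vertical s t a) (links s)))
      cases : (cl? : Dec (JoinCompat.Closes a (shape-half H w c))) →
        (∃ λ q → (left , t′ , p) ~ (left , t , q)) ⊎
        (∃ λ h → h ∈ˡ (if does cl? then (suc t , upper a) ∷ loopReps τ (suc t) w c else loopReps τ (suc t) w c)
                 × (left , t′ , p) ~ (left , h))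
      cases (no ¬cl) = let q′ , q~q′ = St.reach q ¬cl in inj₁ (q′ , ~-trans p~q q~q′)
      cases (yes cl) with St.reach-closed q cl
      ... | inj₁ (q′ , q~q′) = inj₁ (q′ , ~-trans p~q q~q′)
      ... | inj₂ q~u = inj₂ (_ , here refl , ~-trans p~q q~u)

-- Symmetric TL-diagrams and half diagrams

module Points (n : ℕ) where

  N : ℕ
  N = n ℕ.* 2

  point : Side → Fin N → Point n
  point left  = leftPoint n
  point right = rightPoint n

  rightPoint-↑ʳ : ∀ i → rightPoint n i ≡ N ↑ʳ opposite i
  rightPoint-↑ʳ i = Fin.toℕ-injective (begin
    toℕ (opposite (i ↑ˡ N))       ≡⟨ Fin.opposite-prop (i ↑ˡ N) ⟩
    N ℕ.+ N ℕ.∸ suc (toℕ (i ↑ˡ N)) ≡⟨ cong (λ x → N ℕ.+ N ℕ.∸ suc x) (Fin.toℕ-↑ˡ i N) ⟩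
    N ℕ.+ N ℕ.∸ suc (toℕ i)       ≡⟨ ℕ.+-∸-assoc N (Fin.toℕ<n i) ⟩
    N ℕ.+ (N ℕ.∸ suc (toℕ i))     ≡⟨ cong (N ℕ.+_) (Fin.opposite-prop i) ⟨
    N ℕ.+ toℕ (opposite i)        ≡⟨ Fin.toℕ-↑ʳ N (opposite i) ⟨
    toℕ (N ↑ʳ opposite i)         ∎)
    where open ≡-Reasoning

  side-left : ∀ i → side n (leftPoint n i) ≡ inj₁ i
  side-left i = cong [ inj₁ , inj₂ ∘ opposite ]′ (Fin.splitAt-↑ˡ N i N)

  side-right : ∀ i → side n (rightPoint n i) ≡ inj₂ i
  side-right i = trans (cong (side n) (rightPoint-↑ʳ i))
    (trans (cong [ inj₁ , inj₂ ∘ opposite ]′ (Fin.splitAt-↑ʳ N N (opposite i))) (cong inj₂ (Fin.opposite-involutive i)))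

  data PointView : Point n → Set where
    at : ∀ s i → PointView (point s i)

  pointView : ∀ p → PointView p
  pointView p with splitAt N p in eq
  ... | inj₁ i = subst PointView (Fin.splitAt⁻¹-↑ˡ eq) (at left i)
  ... | inj₂ j = subst PointView
          (trans (rightPoint-↑ʳ (opposite j)) (trans (cong (N ↑ʳ_) (Fin.opposite-involutive j)) (Fin.splitAt⁻¹-↑ʳ eq)))
          (at right (opposite j))

  mirror-point : ∀ s i → mirror n (point s i) ≡ point (otherSide s) i
  mirror-point left  i = refl
  mirror-point right i = Fin.opposite-involutive _

  slotOf-point : ∀ s i → slotOf n (point s i) ≡ (s , 0 , i)
  slotOf-point left  i = cong [ (λ i → left , 0 , i) , (λ i → right , 0 , i) ]′ (side-left i)
  slotOf-point right i = cong [ (λ i → left , 0 , i) , (λ i → right , 0 , i) ]′ (side-right i)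

  point-injective : ∀ {s s′ i j} → point s i ≡ point s′ j → (s , i) ≡ (s′ , j)
  point-injective {s} {s′} {i} {j} eq =
    cong (λ (s , _ , i) → s , i) (trans (sym (slotOf-point s i)) (trans (cong (slotOf n) eq) (slotOf-point s′ j)))

  point-injective₂ : ∀ {s i j} → point s i ≡ point s j → i ≡ j
  point-injective₂ {s} eq = cong proj₂ (point-injective {s} {s} eq)

  left≢right : ∀ {i j} → leftPoint n i ≢ rightPoint n j
  left≢right {i} {j} eq with () ← cong proj₁ (point-injective {left} {right} {i} {j} eq)

  left-mono : ∀ {i j} → i Fin.< j → leftPoint n i Fin.< leftPoint n j
  left-mono {i} {j} = subst₂ ℕ._<_ (sym (Fin.toℕ-↑ˡ i N)) (sym (Fin.toℕ-↑ˡ j N))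

  left-cancel : ∀ {i j} → leftPoint n i Fin.< leftPoint n j → i Fin.< j
  left-cancel {i} {j} = subst₂ ℕ._<_ (Fin.toℕ-↑ˡ i N) (Fin.toℕ-↑ˡ j N)

  left<right : ∀ {i j} → leftPoint n i Fin.< rightPoint n j
  left<right {i} {j} = subst₂ ℕ._<_ (sym (Fin.toℕ-↑ˡ i N)) (sym (trans (cong toℕ (rightPoint-↑ʳ j)) (Fin.toℕ-↑ʳ N (opposite j))))
    (ℕ.<-≤-trans (Fin.toℕ<n i) (ℕ.m≤m+n N _))

  right-cancel : ∀ {i j} → rightPoint n i Fin.< rightPoint n j → j Fin.< i
  right-cancel {i} {j} lt with Fin.<-cmp j i
  ... | tri< j<i _ _ = j<i
  ... | tri≈ _ refl _ = contradiction lt (ℕ.<-irrefl refl)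
  ... | tri> _ _ i<j = contradiction lt (ℕ.<-asym (right-anti i<j))
    where
    right-anti : i Fin.< j → rightPoint n j Fin.< rightPoint n i
    right-anti i<j = subst₂ ℕ._<_ (sym (value j)) (sym (value i))
      (ℕ.∸-monoʳ-< (s≤s i<j) (subst (ℕ._≤ N ℕ.+ N) (cong suc (Fin.toℕ-↑ˡ j N)) (Fin.toℕ<n (j ↑ˡ N))))
      where
      value : ∀ k → toℕ (rightPoint n k) ≡ N ℕ.+ N ℕ.∸ suc (toℕ k)
      value k = trans (Fin.opposite-prop (k ↑ˡ N)) (cong (λ x → N ℕ.+ N ℕ.∸ suc x) (Fin.toℕ-↑ˡ k N))

  right-mono : ∀ {i j} → j Fin.< i → rightPoint n i Fin.< rightPoint n j
  right-mono {i} {j} j<i with Fin.<-cmp (rightPoint n i) (rightPoint n j)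
  ... | tri< lt _ _ = lt
  ... | tri≈ _ eq _ = contradiction j<i (ℕ.<-irrefl (cong toℕ (sym (point-injective₂ {right} eq))))
  ... | tri> _ _ gt = contradiction j<i (ℕ.<-asym (right-cancel {j} {i} gt))

  ¬right<left : ∀ {i j} → ¬ (rightPoint n j Fin.< leftPoint n i)
  ¬right<left {i} {j} = ℕ.<-asym (left<right {i} {j})

  module _ (τ : Fin N → Fin N) where

    partner : Side → Fin N → Point n
    partner s i = if does (τ i Fin.≟ i) then point (otherSide s) i else point s (τ i)

    double : Diagram n
    double = tabulate ([ partner left , partner right ]′ ∘ side n)

    lookup-double : ∀ s i → lookup double (point s i) ≡ partner s i
    lookup-double s i = trans (Vec.lookup∘tabulate _ (point s i)) (cases s)
      where
      cases : ∀ s → [ partner left , partner right ]′ (side n (point s i)) ≡ partner s i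
      cases left  = cong [ partner left , partner right ]′ (side-left i)
      cases right = cong [ partner left , partner right ]′ (side-right i)

    double-fixed : ∀ s {i} → τ i ≡ i → lookup double (point s i) ≡ point (otherSide s) i
    double-fixed s {i} eq =
      trans (lookup-double s i) (cong (if_then point (otherSide s) i else point s (τ i)) (dec-true (τ i Fin.≟ i) eq))

    double-arc : ∀ s {i} → τ i ≢ i → lookup double (point s i) ≡ point s (τ i)
    double-arc s {i} ne =
      trans (lookup-double s i) (cong (if_then point (otherSide s) i else point s (τ i)) (dec-false (τ i Fin.≟ i) ne))

    otherSide-involutive : ∀ s → otherSide (otherSide s) ≡ s
    otherSide-involutive left  = refl
    otherSide-involutive right = refl

    otherSide≢ : ∀ s → otherSide s ≢ s
    otherSide≢ left  ()
    otherSide≢ right ()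

    module _ (H : HalfTL τ) where
      open HalfTL H

      double-matching : IsMatching double
      double-matching p with pointView p
      ... | at s i with τ i Fin.≟ i
      ...   | yes e = subst (λ q → q ≢ point s i × lookup double q ≡ point s i) (sym (double-fixed s e))
                ((λ e′ → otherSide≢ s (cong proj₁ (point-injective {otherSide s} {s} e′))) ,
                 trans (double-fixed (otherSide s) e) (cong (λ s → point s i) (otherSide-involutive s)))
      ...   | no ne = subst (λ q → q ≢ point s i × lookup double q ≡ point s i) (sym (double-arc s ne))
                ((λ e′ → ne (point-injective₂ {s} e′)) ,
                 trans (double-arc s (λ e → ne (injective e))) (cong (point s) (involutive i)))

      double-symmetric : ∀ p → lookup double (mirror n p) ≡ mirror n (lookup double p)
      double-symmetric p with pointView p
      ... | at s i with τ i Fin.≟ i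
      ...   | yes e = trans (cong (lookup double) (mirror-point s i)) (trans (double-fixed (otherSide s) e)
                (sym (trans (cong (mirror n) (double-fixed s e)) (mirror-point (otherSide s) i))))
      ...   | no ne = trans (cong (lookup double) (mirror-point s i)) (trans (double-arc (otherSide s) ne)
                (sym (trans (cong (mirror n) (double-arc s ne)) (mirror-point s (τ i)))))

      private
        uncrossed : ∀ {s i s′ j p′ q′} → lookup double (point s i) ≡ p′ → lookup double (point s′ j) ≡ q′ →
          ¬ (point s i Fin.< point s′ j × point s′ j Fin.< p′ × p′ Fin.< q′) → ¬ Cross double (point s i , point s′ j)
        uncrossed refl refl = id

      -- In the linear order the left points increase and the right points decrease with the level.
      -- A crossing of two arcs on one side contradicts nesting, one of an arc with a horizontal
      -- edge puts a fixed point under the arc, and horizontal edges are nested in each other.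
      double-noncrossing : ∀ p q → ¬ Cross double (p , q)
      double-noncrossing p q with pointView p | pointView q
      ... | at s i | at s′ j with τ i Fin.≟ i | τ j Fin.≟ j
      double-noncrossing _ _ | at left i | at left j | yes ei | yes ej =
        uncrossed {left} {i} {left} {j} (double-fixed left ei) (double-fixed left ej)
          λ (p<q , _ , lt) → ℕ.<-asym (left-cancel {i} {j} p<q) (right-cancel {i} {j} lt)
      double-noncrossing _ _ | at left i | at left j | yes ei | no nj =
        uncrossed {left} {i} {left} {j} (double-fixed left ei) (double-arc left nj)
          λ (_ , _ , lt) → ¬right<left {τ j} {i} lt
      double-noncrossing _ _ | at left i | at right j | yes ei | yes ej =
        uncrossed {left} {i} {right} {j} (double-fixed left ei) (double-fixed right ej)
          λ (_ , _ , lt) → ¬right<left {j} {i} lt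
      double-noncrossing _ _ | at left i | at right j | yes ei | no nj =
        uncrossed {left} {i} {right} {j} (double-fixed left ei) (double-arc right nj)
          λ (_ , lt₁ , lt₂) → proj₂ (nested (τ j) {i} (right-cancel {i} {τ j} lt₂ ,
            subst (i Fin.<_) (sym (involutive j)) (right-cancel {j} {i} lt₁))) ei
      double-noncrossing _ _ | at right i | at left j | _ | _ = λ (lt , _) → ¬right<left {j} {i} lt
      double-noncrossing _ _ | at right i | at right j | yes ei | _ =
        uncrossed {right} {i} {right} {j} (double-fixed right ei) refl λ (_ , lt , _) → ¬right<left {i} {j} lt
      double-noncrossing _ _ | at left i | at left j | no ni | yes ej =
        uncrossed {left} {i} {left} {j} (double-arc left ni) (double-fixed left ej)
          λ (lt₁ , lt₂ , _) → proj₂ (nested i {j} (left-cancel {i} {j} lt₁ , left-cancel {j} {τ i} lt₂)) ej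
      double-noncrossing _ _ | at left i | at left j | no ni | no nj =
        uncrossed {left} {i} {left} {j} (double-arc left ni) (double-arc left nj)
          λ (lt₁ , lt₂ , lt₃) → ℕ.<-asym (left-cancel {τ i} {τ j} lt₃)
            (proj₂ (proj₁ (nested i {j} (left-cancel {i} {j} lt₁ , left-cancel {j} {τ i} lt₂))))
      double-noncrossing _ _ | at left i | at right j | no ni | _ =
        uncrossed {left} {i} {right} {j} (double-arc left ni) refl λ (_ , lt , _) → ¬right<left {τ i} {j} lt
      double-noncrossing _ _ | at right i | at right j | no ni | yes ej =
        uncrossed {right} {i} {right} {j} (double-arc right ni) (double-fixed right ej)
          λ (_ , _ , lt) → ¬right<left {j} {τ i} lt
      double-noncrossing _ _ | at right i | at right j | no ni | no nj =
        uncrossed {right} {i} {right} {j} (double-arc right ni) (double-arc right nj)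
          λ (lt₁ , lt₂ , lt₃) → ℕ.<-asym (right-cancel {τ i} {τ j} lt₃)
            (proj₁ (proj₁ (nested (τ i) {j} (right-cancel {j} {τ i} lt₂ ,
              subst (j Fin.<_) (sym (involutive i)) (right-cancel {i} {j} lt₁)))))

      double-TL : IsSymmetricTL n double
      double-TL = symmetricTL double-matching double-noncrossing double-symmetric

    module _ (I : Subset N) where

      black-point : ∀ s i → black n I (point s i) ≡ (case s of λ { left → lookup I i ; right → not (lookup I i) })
      black-point left  i = cong [ lookup I , not ∘ lookup I ]′ (side-left i)
      black-point right i = cong [ lookup I , not ∘ lookup I ]′ (side-right i)

      -- Only the arcs matter: i and i′ have opposite colours for every I, so horizontal edges are
      -- always compatible, and right arcs repeat the condition of the left ones.
      double-compatible⁺ : Compatible n I double → Compat τ (lookup I)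
      double-compatible⁺ C i ne e = C (leftPoint n i)
        (trans (black-point left i) (trans e (sym (trans (cong (black n I) (double-arc left ne)) (black-point left (τ i))))))

      double-compatible⁻ : Compat τ (lookup I) → Compatible n I double
      double-compatible⁻ C p e with pointView p
      ... | at s i with τ i Fin.≟ i
      double-compatible⁻ C p e | at left i | yes f = Bool.not-¬ refl
        (trans (sym (black-point left i)) (trans e (trans (cong (black n I) (double-fixed left f)) (black-point right i))))
      double-compatible⁻ C p e | at right i | yes f = Bool.not-¬ refl
        (sym (trans (sym (black-point right i)) (trans e (trans (cong (black n I) (double-fixed right f)) (black-point left i)))))
      double-compatible⁻ C p e | at left i | no ne = C i ne
        (trans (sym (black-point left i)) (trans e (trans (cong (black n I) (double-arc left ne)) (black-point left (τ i)))))
      double-compatible⁻ C p e | at right i | no ne = C i ne (Bool.not-injective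
        (trans (sym (black-point right i)) (trans e (trans (cong (black n I) (double-arc right ne)) (black-point right (τ i))))))

  -- A partner on the right side is recorded as a fixed point; that it can only be i′ is shown by
  -- `edgeᴰ`.
  halfOf : Diagram n → Fin N → Fin N
  halfOf D i = [ id , (λ _ → i) ]′ (side n (lookup D (leftPoint n i)))

  module HalfOf (D : Diagram n) (TL : IsSymmetricTL n D) where
    open IsSymmetricTL TL

    h : Fin N → Fin N
    h = halfOf D

    private
      cross : ∀ {p q p′ q′} → lookup D p ≡ p′ → lookup D q ≡ q′ → p Fin.< q → q Fin.< p′ → p′ Fin.< q′ → ⊥
      cross {p} {q} refl refl p<q q<p′ p′<q′ = noncrossing p q (p<q , q<p′ , p′<q′)

      back : ∀ {p q} → lookup D p ≡ q → lookup D q ≡ p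
      back {p} refl = proj₂ (matching p)

      mirrored : ∀ {p q} → lookup D p ≡ q → lookup D (mirror n p) ≡ mirror n q
      mirrored {p} refl = symmetric p

    data Edgeᴰ (i : Fin N) : Set where
      across : lookup D (leftPoint n i) ≡ rightPoint n i → h i ≡ i → Edgeᴰ i
      along  : lookup D (leftPoint n i) ≡ leftPoint n (h i) → h i ≢ i → Edgeᴰ i

    h-left : ∀ {i j} → lookup D (leftPoint n i) ≡ leftPoint n j → h i ≡ j
    h-left {i} {j} eq = cong [ id , (λ _ → i) ]′ (trans (cong (side n) eq) (side-left j))

    -- An edge from i to j′ with i ≢ j would cross its own mirror image, the edge from j to i′.
    edgeᴰ : ∀ i → Edgeᴰ i
    edgeᴰ i = cases (pointView (lookup D (leftPoint n i))) refl
      where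
      cases : ∀ {q} → PointView q → lookup D (leftPoint n i) ≡ q → Edgeᴰ i
      cases (at left j) eq = along (trans eq (cong (leftPoint n) (sym (h-left eq))))
        (λ e → proj₁ (matching (leftPoint n i)) (trans eq (cong (leftPoint n) (trans (sym (h-left eq)) e))))
      cases (at right j) eq with Fin.<-cmp i j
      ... | tri< i<j _ _ = ⊥-elim (cross eq (trans (cong (lookup D) (sym (mirror-point right j))) (mirrored (back eq)))
              (left-mono {i} {j} i<j) (left<right {j} {j}) (right-mono {j} {i} i<j))
      ... | tri> _ _ j<i = ⊥-elim (cross (trans (cong (lookup D) (sym (mirror-point right j))) (mirrored (back eq))) eq
              (left-mono {j} {i} j<i) (left<right {i} {i}) (right-mono {i} {j} j<i))
      ... | tri≈ _ refl _ = across eq (cong [ id , (λ _ → i) ]′ (trans (cong (side n) eq) (side-right i)))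

    h-involutive : ∀ i → h (h i) ≡ i
    h-involutive i with edgeᴰ i
    ... | across _ e = trans (cong h e) e
    ... | along e _  = h-left (back e)

    h-nested : ∀ p → Closed h (Between p (h p))
    h-nested p {q} (p<q , q<hp) with edgeᴰ p | edgeᴰ q
    ... | across _ e | _ = contradiction (subst (q Fin.<_) e q<hp) (ℕ.<-asym p<q)
    ... | along ep _ | across eq _ = ⊥-elim (cross ep eq (left-mono {p} {q} p<q) (left-mono {q} {h p} q<hp) (left<right {h p} {q}))
    ... | along ep _ | along eq ne = (lower-bound , upper-bound) , ne
      where
      lower-bound : p Fin.< h q
      lower-bound with Fin.<-cmp p (h q)
      ... | tri< lt _ _ = lt
      ... | tri≈ _ p≡hq _ = contradiction q<hp (ℕ.<-irrefl (cong toℕ (trans (sym (h-involutive q)) (cong h (sym p≡hq)))))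
      ... | tri> _ _ hq<p = ⊥-elim (cross (back eq) ep (left-mono {h q} {p} hq<p) (left-mono {p} {q} p<q) (left-mono {q} {h p} q<hp))
      upper-bound : h q Fin.< h p
      upper-bound with Fin.<-cmp (h q) (h p)
      ... | tri< lt _ _ = lt
      ... | tri≈ _ hq≡hp _ = contradiction p<q (ℕ.<-irrefl (cong toℕ
              (trans (sym (h-involutive p)) (trans (cong h (sym hq≡hp)) (h-involutive q)))))
      ... | tri> _ _ hp<hq = ⊥-elim (cross ep eq (left-mono {p} {q} p<q) (left-mono {q} {h p} q<hp) (left-mono {h p} {h q} hp<hq))

    half : HalfTL h
    half = record { involutive = h-involutive ; nested = h-nested }

    double-halfOf : double h ≡ D
    double-halfOf = lookup-ext λ p → cases (pointView p)
      where
      cases : ∀ {p} → PointView p → lookup (double h) p ≡ lookup D p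
      cases (at s i) with edgeᴰ i
      cases (at left  i) | across e f = trans (double-fixed h left f) (sym e)
      cases (at left  i) | along e ne = trans (double-arc h left ne) (sym e)
      cases (at right i) | across e f = trans (double-fixed h right f) (sym (back e))
      cases (at right i) | along e ne = trans (double-arc h right ne) (sym (mirrored e))

  halfOf-double : ∀ τ → halfOf (double τ) ≗ τ
  halfOf-double τ i = cases (τ i Fin.≟ i)
    where
    cases : Dec (τ i ≡ i) → halfOf (double τ) i ≡ τ i
    cases (yes e) = trans (cong [ id , (λ _ → i) ]′ (trans (cong (side n) (double-fixed τ left e)) (side-right i))) (sym e)
    cases (no ne) = cong [ id , (λ _ → i) ]′ (trans (cong (side n) (double-arc τ left ne)) (side-left (τ i)))

  double-cong : ∀ {τ τ′} → τ ≗ τ′ → double τ ≡ double τ′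
  double-cong {τ} {τ′} eq = lookup-ext λ p → cases (pointView p)
    where
    cases : ∀ {p} → PointView p → lookup (double τ) p ≡ lookup (double τ′) p
    cases (at s i) with τ i Fin.≟ i
    ... | yes e = trans (double-fixed τ s e) (sym (double-fixed τ′ s (trans (sym (eq i)) e)))
    ... | no ne = trans (double-arc τ s ne) (trans (cong (point s) (eq i)) (sym (double-arc τ′ s (ne ∘ trans (eq i)))))

  ∈-𝒯⁺ : ∀ {D} → IsSymmetricTL n D → D ∈ˡ 𝒯 n
  ∈-𝒯⁺ {D} = ∈-filter⁺ (isSymmetricTL? n) (∈-pairings D)

  ∈-𝒯⁻ : ∀ {D} → D ∈ˡ 𝒯 n → IsSymmetricTL n D
  ∈-𝒯⁻ D∈ = proj₂ (∈-filter⁻ (isSymmetricTL? n) {xs = vectors (allFin _) _} D∈)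

  𝒯-unique : Unique (𝒯 n)
  𝒯-unique = Unique.filter⁺ (isSymmetricTL? n) (vectors-unique (Unique.allFin⁺ _) _)

uncrossHalf-sides : ∀ {m} s t (w : LeftHalf m) c → All (λ ((s₁ , _) , (s₂ , _)) → s₁ ≡ s × s₂ ≡ s) (uncrossHalf s t w c)
uncrossHalf-sides s t []      []      = []
uncrossHalf-sides s t (a ∷ w) (u ∷ c) = All.++⁺ (sides u) (uncrossHalf-sides s (suc t) w c)
  where
  OnSide : Strand _ → Set
  OnSide ((s₁ , _) , (s₂ , _)) = s₁ ≡ s × s₂ ≡ s
  sides : ∀ u → All OnSide (uncross u s t a)
  sides horizontal = horizontal⁺ {s = s} {t} {a} {P = OnSide} λ _ → refl , refl
  sides vertical   = vertical⁺ {s = s} {t} {a} {P = OnSide} (refl , refl) (refl , refl) λ _ _ _ → refl , refl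

∈-sides : ∀ s → s ∈ˡ left ∷ right ∷ []
∈-sides left  = here refl
∈-sides right = there (here refl)

-- Endpoints and loops of an uncrossed picture

module Picture (n : ℕ) (w : LeftHalf (n ℕ.* 2)) (c : Vec Uncrossing (length w)) (d : Vec Uncrossing n) where

  open Points n
  open HalfTL

  private
    T = length w

  pictureShape : Fin N → Fin N
  pictureShape = shape (axisShape d) w c

  pictureShape-half : HalfTL pictureShape
  pictureShape-half = shape-half (axisShape-half d) w c

  private
    τ = pictureShape
    sl = slots n w
    st = strands n w (c , d)
    axisStrands = concatMap (λ k → uncrossAxis n T (lookup d k) k) (allFin n)

  slots-unique : Unique sl
  slots-unique = Unique.cartesianProduct⁺ (((λ ()) ∷ []) ∷ ([] ∷ []))
    (Unique.cartesianProduct⁺ (Unique.upTo⁺ (suc T)) (Unique.allFin⁺ _))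

  ∈-slots : ∀ {s t p} → t ≤ T → (s , t , p) ∈ˡ sl
  ∈-slots {s} {t} {p} t≤T = ∈-cartesianProduct⁺ (∈-sides s) (∈-cartesianProduct⁺ (∈-upTo⁺ (s≤s t≤T)) (∈-allFin p))

  ∈-slots⁻ : ∀ {s t p} → (s , t , p) ∈ˡ sl → t ≤ T
  ∈-slots⁻ v∈ = ℕ.≤-pred (∈-upTo⁻ (proj₁ (∈-cartesianProduct⁻ (upTo (suc T)) (allFin _)
    (proj₂ (∈-cartesianProduct⁻ (left ∷ right ∷ []) _ v∈)))))

  axis⁺ : ∀ {p} {P : Pred (Strand N) p} → (∀ k → All P (uncrossAxis n T (lookup d k) k)) → All P axisStrands
  axis⁺ h = All.concat⁺ (All.map⁺ {xs = allFin n} (All.tabulate λ {k} _ → h k))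

  axis⁻ : ∀ {p} {P : Pred (Strand N) p} → All P axisStrands → ∀ k → All P (uncrossAxis n T (lookup d k) k)
  axis⁻ all k = All.lookup (All.map⁻ (All.concat⁻ {xss = map (λ k → uncrossAxis n T (lookup d k) k) (allFin n)} all)) (∈-allFin k)

  strands-in : All (λ (p , q) → p ∈ˡ sl × q ∈ˡ sl) st
  strands-in = All.++⁺ (half-in left) (All.++⁺ (axis⁺ axis-in) (half-in right))
    where
    half-in : ∀ s → All (λ (p , q) → p ∈ˡ sl × q ∈ˡ sl) (uncrossHalf s 0 w c)
    half-in s = All.map (λ ((_ , h₁) , (_ , h₂)) → ∈-slots h₁ , ∈-slots h₂) (uncrossHalf-columns s 0 w c)
    axis-in : ∀ k → All (λ (p , q) → p ∈ˡ sl × q ∈ˡ sl) (uncrossAxis n T (lookup d k) k)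
    axis-in k with lookup d k
    ... | horizontal = (∈-slots ℕ.≤-refl , ∈-slots ℕ.≤-refl) ∷ (∈-slots ℕ.≤-refl , ∈-slots ℕ.≤-refl) ∷ []
    ... | vertical   = (∈-slots ℕ.≤-refl , ∈-slots ℕ.≤-refl) ∷ (∈-slots ℕ.≤-refl , ∈-slots ℕ.≤-refl) ∷ []

  module _ {ℓ} {_~_ : Rel (Slot N) ℓ} (equiv : IsEquivalence _~_) (linked : All (λ (p , q) → p ~ q) st) where

    open Connected equiv public
    open IsEquivalence equiv renaming (refl to ~-refl; sym to ~-sym; trans to ~-trans) using ()

    half-linked : ∀ s → Linked (uncrossHalf s 0 w c)
    half-linked left  = All.++⁻ˡ (uncrossHalf left 0 w c) linked
    half-linked right = All.++⁻ʳ axisStrands (All.++⁻ʳ (uncrossHalf left 0 w c) linked)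

    axis-linked : ∀ k → Linked (uncrossAxis n T (lookup d k) k)
    axis-linked = axis⁻ (All.++⁻ˡ axisStrands (All.++⁻ʳ (uncrossHalf left 0 w c) linked))

    axis-joins : Joins (axisShape d) T
    axis-joins = record { arcs = arcs ; fixed = fixed }
      where
      arcs : ∀ s p → (s , T , p) ~ (s , T , axisShape d p)
      arcs s p with Fin.combine-surjective {n} {2} p
      ... | k , b , refl rewrite axisShape-combine d k b with lookup d k | axis-linked k
      ...   | horizontal | _ = ~-refl
      arcs left  p | k , zero     , refl | vertical | l ∷ _ = l
      arcs left  p | k , suc zero , refl | vertical | l ∷ _ = ~-sym l
      arcs right p | k , zero     , refl | vertical | _ ∷ l ∷ _ = l
      arcs right p | k , suc zero , refl | vertical | _ ∷ l ∷ _ = ~-sym l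
      fixed : ∀ p → axisShape d p ≡ p → (left , T , p) ~ (right , T , p)
      fixed p e with Fin.combine-surjective {n} {2} p
      ... | k , b , refl with lookup d k | axis-linked k | trans (sym (axisShape-combine d k b)) e
      fixed p e | k , zero     , refl | horizontal | l ∷ _     | _ = l
      fixed p e | k , suc zero , refl | horizontal | _ ∷ l ∷ _ | _ = l
      fixed p e | k , zero     , refl | vertical   | _ | e′ = case Fin.combine-injectiveʳ k _ k _ e′ of λ ()
      fixed p e | k , suc zero , refl | vertical   | _ | e′ = case Fin.combine-injectiveʳ k _ k _ e′ of λ ()

    boundary-joins : Joins τ 0
    boundary-joins = joins (axisShape-half d) 0 w c axis-joins half-linked

    boundary-reached : ∀ {t} p → t ≤ T →
      (∃ λ q → (left , t , p) ~ (left , 0 , q)) ⊎ (∃ λ h → h ∈ˡ loopReps (axisShape d) 0 w c × (left , t , p) ~ (left , h))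
    boundary-reached p t≤T = reaches (axisShape-half d) 0 w c axis-joins half-linked p (z≤n , t≤T)

  module SlotColour {K : Set} (ι : K → K) (g : K → Bool) {b : Fin N → K} {r : ℕ × Fin N → K}
                    (adm : Colouring.Admissible {N} ι τ b) (ιr : ∀ h → ι (r h) ≡ r h) where

    open Colouring {N} {K} ι
    open Admissible

    ext : Extension (axisShape d) 0 w c b r
    ext = extend (axisShape-half d) r ιr 0 w c adm
    open Extension ext

    -- Two instances are used. Pairs of Booleans with `swap` and `proj₁` give the two sides
    -- independent colours, as needed for the shape; Booleans with identities give mirror images the
    -- same colour, as needed for counting loops.
    κ : Slot N → Bool
    κ (left  , t , p) = g (colour t p)
    κ (right , t , p) = g (ι (colour t p))

    κ-side : ∀ s {t₁ p₁ t₂ p₂} → colour t₁ p₁ ≡ colour t₂ p₂ → κ (s , t₁ , p₁) ≡ κ (s , t₂ , p₂)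
    κ-side left  eq = cong g eq
    κ-side right eq = cong (g ∘ ι) eq

    κ-strands : All (λ (p , q) → κ p ≡ κ q) st
    κ-strands = All.++⁺ (half left) (All.++⁺ (axis⁺ on-axis) (half right))
      where
      half : ∀ s → All (λ (p , q) → κ p ≡ κ q) (uncrossHalf s 0 w c)
      half s = All.zipWith (λ { (eq , refl , refl) → κ-side s eq }) (constant s , uncrossHalf-sides s 0 w c)
      on-axis : ∀ k → All (λ (p , q) → κ p ≡ κ q) (uncrossAxis n T (lookup d k) k)
      on-axis k with lookup d k | axisShape-combine d k
      ... | horizontal | eq = cong g (sym (fixed axis (axisUpper n k) (eq zero)))
                            ∷ cong g (sym (fixed axis (axisLower n k) (eq (suc zero)))) ∷ []
      ... | vertical | eq = κ-side left level ∷ κ-side right level ∷ []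
        where
        level : colour T (axisUpper n k) ≡ colour T (axisLower n k)
        level = trans (sym (along axis (axisUpper n k))) (cong (colour T) (eq zero))

  private
    module CP = ComponentsProperties (_≟ˢˡ_ {N})

  hasShape⁺ : HasShape n w (c , d) (double τ)
  hasShape⁺ p with pointView p
  ... | at s i = subst₂ (λ v v′ → Components.Together _≟ˢˡ_ v v′ (Components.components _≟ˢˡ_ sl st))
          (sym (slotOf-point s i)) refl (CP.~⇒together sl slots-unique st strands-in (∈-slots z≤n) (joined s (τ i Fin.≟ i)))
    where
    J = boundary-joins (CP.~-isEquivalence sl slots-unique st strands-in)
                       (All.tabulate (CP.~-link sl slots-unique st strands-in))
    open Connected.Joins J
    ~-sym = IsEquivalence.sym (CP.~-isEquivalence sl slots-unique st strands-in)
    joined : ∀ s → Dec (τ i ≡ i) → CP._~_ sl slots-unique st strands-in (s , 0 , i) (slotOf n (lookup (double τ) (point s i)))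
    joined left (yes e) = subst (CP._~_ sl slots-unique st strands-in _)
      (sym (trans (cong (slotOf n) (double-fixed τ left e)) (slotOf-point right i))) (fixed i e)
    joined right (yes e) = subst (CP._~_ sl slots-unique st strands-in _)
      (sym (trans (cong (slotOf n) (double-fixed τ right e)) (slotOf-point left i))) (~-sym (fixed i e))
    joined s (no ne) = subst (CP._~_ sl slots-unique st strands-in _)
      (sym (trans (cong (slotOf n) (double-arc τ s ne)) (slotOf-point s (τ i)))) (arcs s i)

  -- For each left endpoint i some colouring constant on the strands is true at the ends of the
  -- strand of i and at no other endpoint, so the partner of i in D must be its other end.
  hasShape⁻ : ∀ {D} → IsSymmetricTL n D → HasShape n w (c , d) D → D ≡ double τ
  hasShape⁻ {D} TL has = trans (sym double-halfOf) (double-cong agree)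
    where
    open HalfOf D TL
    agree : halfOf D ≗ τ
    agree i = cases (edgeᴰ i)
      where
      module H = HalfTL pictureShape-half
      on : Fin N → Bool
      on j = does ((j Fin.≟ i) ⊎-dec (j Fin.≟ τ i))
      -- The first component marks the left endpoints on the strand of i, the second the right ones:
      -- the second is true only at i itself, and only if this strand is horizontal.
      b : Fin N → Bool × Bool
      b j = on j , does ((τ i Fin.≟ i) ×-dec (j Fin.≟ i))
      open Colouring {N} {Bool × Bool} swap using (Admissible)
      adm : Admissible τ b
      adm = record
        { along = λ j → cong₂ _,_
            (does-⇔ ((τ j Fin.≟ i) ⊎-dec (τ j Fin.≟ τ i)) ((j Fin.≟ i) ⊎-dec (j Fin.≟ τ i))
              [ inj₂ ∘ sym ∘ H.flip , inj₁ ∘ H.injective ]′ [ inj₂ ∘ cong τ , inj₁ ∘ H.flip ∘ sym ]′)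
            (does-⇔ ((τ i Fin.≟ i) ×-dec (τ j Fin.≟ i)) ((τ i Fin.≟ i) ×-dec (j Fin.≟ i))
              (λ (e , e′) → e , H.injective (trans e′ (sym e))) (λ (e , e′) → e , trans (cong τ e′) e))
        ; fixed = λ j e → let
            eq = does-⇔ ((τ i Fin.≟ i) ×-dec (j Fin.≟ i)) ((j Fin.≟ i) ⊎-dec (j Fin.≟ τ i))
                   (inj₁ ∘ proj₂)
                   [ (λ j≡i → trans (cong τ (sym j≡i)) (trans e j≡i) , j≡i)
                   , (λ j≡τi → let j≡i = trans (sym e) (H.flip (sym j≡τi)) in trans (sym j≡τi) j≡i , j≡i) ]′
            in cong₂ _,_ eq (sym eq) }
      open SlotColour {Bool × Bool} swap proj₁ {b} {λ _ → false , false} adm (λ _ → refl)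
      open Colouring.Extension ext
      same-colour : κ (left , 0 , i) ≡ κ (slotOf n (lookup D (leftPoint n i)))
      same-colour = subst (λ v → κ v ≡ κ (slotOf n (lookup D (leftPoint n i)))) (slotOf-point left i)
        (CP.~-constant sl slots-unique st strands-in κ-strands (inj₂ (has (leftPoint n i))))
      start : κ (left , 0 , i) ≡ true
      start = trans (cong proj₁ (boundary i)) (dec-true ((i Fin.≟ i) ⊎-dec (i Fin.≟ τ i)) (inj₁ refl))
      cases : Edgeᴰ i → halfOf D i ≡ τ i
      cases (across e f) = trans f (sym (proj₁ (does-true ((τ i Fin.≟ i) ×-dec (i Fin.≟ i))
        (trans (sym (cong proj₂ (boundary i)))
          (trans (sym (cong κ (trans (cong (slotOf n) e) (slotOf-point right i)))) (trans (sym same-colour) start))))))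
      cases (along e ne) with does-true ((halfOf D i Fin.≟ i) ⊎-dec (halfOf D i Fin.≟ τ i))
        (trans (sym (cong proj₁ (boundary (halfOf D i))))
          (trans (sym (cong κ (trans (cong (slotOf n) e) (slotOf-point left (halfOf D i))))) (trans (sym same-colour) start)))
      ... | inj₁ eq = contradiction eq ne
      ... | inj₂ eq = eq

  -- `loopReps` represents each closed component once. Colouring the loops true and the boundary
  -- false keeps the representatives off the boundary; colouring one loop true and everything else
  -- on the boundary or on other loops false keeps them apart; and each slot is connected to the
  -- boundary or to a representative.
  loops-loopCount : loops n w (c , d) ≡ loopCount (axisShape d) w c
  loops-loopCount = trans
    (CP.length-closed sl slots-unique links links-in {B = λ (_ , t , _) → t ≡ 0} (isClosed? n) reps
      (λ cl v∈ → All.lookup cl v∈) (λ off → All.tabulate off)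
      (All.map⁺ (All.map (λ (_ , h) → ∈-slots h) (loopReps-columns (axisShape d) 0 w c)))
      off-boundary
      (Unique.map⁺ (cong proj₂) (loopReps-unique (axisShape d) 0 w c))
      apart reach)
    (trans (List.length-map onLeft (loopReps (axisShape d) 0 w c)) (length-loopReps (axisShape d) 0 w c))
    where
    mirrors = map (λ p → p , mirrorSlot p) sl
    links = st ++ mirrors
    onLeft : ℕ × Fin N → Slot N
    onLeft h = left , h
    reps : List (Slot N)
    reps = map onLeft (loopReps (axisShape d) 0 w c)
    links-in : All (λ (p , q) → p ∈ˡ sl × q ∈ˡ sl) links
    links-in = All.++⁺ strands-in (All.map⁺ (All.tabulate λ {v} v∈ → v∈ , ∈-slots (∈-slots⁻ v∈)))
    _~_ = CP._~_ sl slots-unique links links-in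
    equiv = CP.~-isEquivalence sl slots-unique links links-in
    open IsEquivalence equiv renaming (sym to ~-sym; trans to ~-trans; refl to ~-refl) using ()
    linked : All (λ (p , q) → p ~ q) links
    linked = All.tabulate (CP.~-link sl slots-unique links links-in)
    mirrored : ∀ {v} → v ∈ˡ sl → v ~ mirrorSlot v
    mirrored v∈ = All.lookup (All.map⁻ (All.++⁻ʳ st linked)) v∈

    module Colour {b : Fin N → Bool} {r : ℕ × Fin N → Bool} (adm : Colouring.Admissible id τ b) where
      open SlotColour {Bool} id id {b} {r} adm (λ _ → refl) public
      open Colouring.Extension ext public
      κ-~ : ∀ {p q} → p ~ q → κ p ≡ κ q
      κ-~ = CP.~-constant sl slots-unique links links-in
        (All.++⁺ κ-strands (All.map⁺ (All.tabulate λ { {left , _} _ → refl ; {right , _} _ → refl })))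

    constant-admissible : ∀ x → Colouring.Admissible id τ (λ _ → x)
    constant-admissible x = record { along = λ _ → refl ; fixed = λ _ _ → refl }

    off-boundary : ∀ {v v′} → v ∈ˡ reps → v′ ~ v → proj₁ (proj₂ v′) ≢ 0
    off-boundary {v} {s , _ , p} v∈ v~ refl = clash (∈-map⁻ onLeft v∈)
      where
      open Colour {λ _ → false} {λ _ → true} (constant-admissible false)
      at-boundary : ∀ s → κ (s , 0 , p) ≡ false
      at-boundary left  = boundary p
      at-boundary right = boundary p
      clash : ¬ (∃ λ h → h ∈ˡ loopReps (axisShape d) 0 w c × v ≡ (left , h))
      clash (h , h∈ , refl) with () ← trans (sym (at-boundary s)) (trans (κ-~ v~) (All.lookup on-reps h∈))

    apart : ∀ {v v′} → v ∈ˡ reps → v′ ∈ˡ reps → v ~ v′ → v ≡ v′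
    apart {v} {v′} v∈ v′∈ v~v′ = equal (∈-map⁻ onLeft v∈) (∈-map⁻ onLeft v′∈)
      where
      import Data.Product.Properties as Product
      _≟ʰ_ : DecidableEquality (ℕ × Fin N)
      _≟ʰ_ = Product.≡-dec ℕ._≟_ Fin._≟_
      Represents : Slot N → Set
      Represents v = ∃ λ h → h ∈ˡ loopReps (axisShape d) 0 w c × v ≡ (left , h)
      equal : Represents v → Represents v′ → v ≡ v′
      equal (h , h∈ , refl) (h′ , h′∈ , refl) = cong onLeft (does-true (h ≟ʰ h′)
          (trans (sym (All.lookup on-reps h∈)) (trans (κ-~ v~v′) (trans (All.lookup on-reps h′∈) (dec-true (h′ ≟ʰ h′) refl)))))
        where open Colour {λ _ → false} {λ x → does (x ≟ʰ h′)} (constant-admissible false)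

    reach : ∀ {v} → v ∈ˡ sl → (∃ λ q → proj₁ (proj₂ q) ≡ 0 × v ~ q) ⊎ (∃ λ r → r ∈ˡ reps × v ~ r)
    reach {s , t , p} v∈ with boundary-reached equiv (All.++⁻ˡ st linked) p (∈-slots⁻ v∈)
    ... | inj₁ (q , p~q) = inj₁ (_ , refl , ~-trans (to-left s) p~q)
      where
      to-left : ∀ s → (s , t , p) ~ (left , t , p)
      to-left left  = ~-refl
      to-left right = mirrored (∈-slots (∈-slots⁻ v∈))
    ... | inj₂ (h , h∈ , p~h) = inj₂ (_ , ∈-map⁺ onLeft h∈ , ~-trans (to-left s) p~h)
      where
      to-left : ∀ s → (s , t , p) ~ (left , t , p)
      to-left left  = ~-refl
      to-left right = mirrored (∈-slots (∈-slots⁻ v∈))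

-- Parities

par : ℕ → Bool
par zero    = false
par (suc k) = not (par k)

2∣⇒par : ∀ {k} → 2 ∣ k → par k ≡ false
2∣⇒par (ℕ.divides q refl) = double q
  where
  double : ∀ q → par (q ℕ.* 2) ≡ false
  double zero    = refl
  double (suc q) = trans (Bool.not-involutive _) (double q)

par⇒2∣ : ∀ k → par k ≡ false → 2 ∣ k
par⇒2∣ zero          _  = ℕ.divides 0 refl
par⇒2∣ (suc (suc k)) eq = ℕ.∣m∣n⇒∣m+n ℕ.∣-refl (par⇒2∣ k (trans (sym (Bool.not-involutive _)) eq))

par-length-filter : ∀ {a p} {A : Set a} {P : Pred A p} (P? : Decidable P) xs →
                    par (length (filter P? xs)) ≡ Xor.⨁ xs (does ∘ P?)
par-length-filter P? [] = refl
par-length-filter P? (x ∷ xs) with does (P? x)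
... | true  = cong not (par-length-filter P? xs)
... | false = par-length-filter P? xs

allFin-suc : ∀ m → allFin (suc m) ≡ zero ∷ map suc (allFin m)
allFin-suc m = cong (zero ∷_) (sym (List.map-tabulate id suc))

par-∣∣ : ∀ {m} (I : Subset m) → par ∣ I ∣ ≡ Xor.⨁ (allFin m) (lookup I)
par-∣∣ []                  = refl
par-∣∣ {suc m} (b ∷ I) = trans (head b) (sym (trans (cong (λ xs → Xor.⨁ xs (lookup (b ∷ I))) (allFin-suc m))
                           (cong (b xor_) (Xor.⨁-map suc (allFin m) (lookup (b ∷ I))))))
  where
  head : ∀ b → par ∣ b ∷ I ∣ ≡ b xor Xor.⨁ (allFin m) (lookup I)
  head true  = cong not (par-∣∣ I)
  head false = par-∣∣ I

module Cycles {c ℓ} (M : CommutativeMonoid c ℓ) where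

  open Fold M
  open CommutativeMonoid M renaming (refl to ≈-refl; sym to ≈-sym; trans to ≈-trans)
  open import Relation.Binary.Reasoning.Setoid setoid

  -- The terms with π i < i are reindexed by π, which moves them to the smaller element of their
  -- 2-cycle; there are no others, π being free of fixed points.
  cycles : ∀ {m} (π : Fin m → Fin m) → (∀ i → π (π i) ≡ i) → (∀ i → π i ≢ i) → ∀ g →
           ⨁ (allFin m) g ≈ ⨁ (allFin m) (λ i → when (does (i Fin.<? π i)) (g i ∙ g (π i)))
  cycles {m} π inv free g = begin
    ⨁ xs g
      ≈⟨ ⨁-cong xs split ⟩
    ⨁ xs (λ i → when (does (i Fin.<? π i)) (g i) ∙ when (does (π i Fin.<? i)) (g i))
      ≈⟨ ⨁-∙ xs _ _ ⟩
    ⨁ xs (λ i → when (does (i Fin.<? π i)) (g i)) ∙ ⨁ xs (λ i → when (does (π i Fin.<? i)) (g i))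
      ≈⟨ ∙-congˡ (⨁-↭ xs↭ _) ⟩
    ⨁ xs (λ i → when (does (i Fin.<? π i)) (g i)) ∙ ⨁ (map π xs) (λ i → when (does (π i Fin.<? i)) (g i))
      ≈⟨ ∙-congˡ (≈-trans (⨁-map π xs _) (⨁-cong xs λ i → when-congˡ (g (π i)) (cong (λ k → does (k Fin.<? π i)) (inv i)))) ⟩
    ⨁ xs (λ i → when (does (i Fin.<? π i)) (g i)) ∙ ⨁ xs (λ i → when (does (i Fin.<? π i)) (g (π i)))
      ≈⟨ ⨁-∙ xs _ _ ⟨
    ⨁ xs (λ i → when (does (i Fin.<? π i)) (g i) ∙ when (does (i Fin.<? π i)) (g (π i)))
      ≈⟨ ⨁-cong xs (λ i → when-∙ (does (i Fin.<? π i)) (g i) (g (π i))) ⟨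
    ⨁ xs (λ i → when (does (i Fin.<? π i)) (g i ∙ g (π i))) ∎
    where
    xs = allFin m
    split : ∀ i → g i ≈ when (does (i Fin.<? π i)) (g i) ∙ when (does (π i Fin.<? i)) (g i)
    split i with Fin.<-cmp i (π i)
    ... | tri< lt _ ¬gt rewrite dec-true (i Fin.<? π i) lt | dec-false (π i Fin.<? i) ¬gt = ≈-sym (identityʳ _)
    ... | tri≈ _ eq _ = contradiction (sym eq) (free i)
    ... | tri> ¬lt _ gt rewrite dec-false (i Fin.<? π i) ¬lt | dec-true (π i Fin.<? i) gt = ≈-sym (identityˡ _)
    π-injective : ∀ {i j} → π i ≡ π j → i ≡ j
    π-injective {i} {j} eq = trans (sym (inv i)) (trans (cong π eq) (inv j))
    xs↭ : xs ↭ map π xs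
    xs↭ = unique-↭ (Unique.allFin⁺ m) (Unique.map⁺ π-injective (Unique.allFin⁺ m))
      (λ {i} _ → subst (_∈ˡ map π xs) (inv i) (∈-map⁺ π (∈-allFin (π i)))) (λ {i} _ → ∈-allFin i)

-- The diagrams D_max

-- The measure μ serves to find both the next fixed point after a level, with μ = `toℕ`, and the
-- last one before it, with μ decreasing in the level.
minimal : ∀ {m p} {Q : Pred (Fin m) p} (Q? : Decidable Q) (μ : Fin m → ℕ) → ∃ Q → ∃ λ q → Q q × (∀ r → Q r → ¬ (μ r ℕ.< μ q))
minimal {Q = Q} Q? μ (q , Qq) = descend (μ q) q Qq ℕ.≤-refl
  where
  descend : ∀ k q → Q q → μ q ≤ k → ∃ λ q → Q q × (∀ r → Q r → ¬ (μ r ℕ.< μ q))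
  descend k q Qq μ≤ with Fin.any? (λ r → Q? r ×-dec (μ r ℕ.<? μ q))
  ... | no none = q , Qq , λ r Qr lt → none (r , Qr , lt)
  descend zero    q Qq μ≤ | yes (r , Qr , lt) = contradiction (ℕ.≤-trans lt μ≤) (λ ())
  descend (suc k) q Qq μ≤ | yes (r , Qr , lt) = descend k r Qr (ℕ.≤-pred (ℕ.≤-trans lt μ≤))

-- The vertices are numbered from 0, so the upper end of an odd edge has an even number.
OddArc : ∀ {m} → (Fin m → Fin m) → Fin m → Set
OddArc δ p = (par (toℕ p) ≡ false × p Fin.< δ p) ⊎ (par (toℕ (δ p)) ≡ false × δ p Fin.< p)

-- The counterpart of `ErasedFrom` for half diagrams. Being reflexive, transitive and antisymmetric
-- up to pointwise equality, it reduces inclusions between sets S(D) to comparisons of diagrams.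
Erased : ∀ {m} → (Fin m → Fin m) → (Fin m → Fin m) → Set
Erased δ ε = ∀ p → ε p ≡ δ p ⊎ (ε p ≡ p × OddArc δ p)

Erased-refl : ∀ {m} (δ : Fin m → Fin m) → Erased δ δ
Erased-refl δ p = inj₁ refl

Erased-trans : ∀ {m} {δ ε γ : Fin m → Fin m} → Erased δ ε → Erased ε γ → Erased δ γ
Erased-trans {δ = δ} {ε} δε εγ p with εγ p | δε p
... | inj₁ eq       | inj₁ eq′        = inj₁ (trans eq eq′)
... | inj₁ eq       | inj₂ (eq′ , od) = inj₂ (trans eq eq′ , od)
... | inj₂ (eq , _) | inj₂ (_ , od)   = inj₂ (eq , od)
... | inj₂ (eq , od) | inj₁ eq′       = inj₂ (eq , subst (λ q → (par (toℕ p) ≡ false × p Fin.< q) ⊎ (par (toℕ q) ≡ false × q Fin.< p)) eq′ od)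

Erased-antisym : ∀ {m} {δ ε : Fin m → Fin m} → Erased δ ε → Erased ε δ → δ ≗ ε
Erased-antisym δε εδ p with δε p | εδ p
... | inj₁ eq | _ = sym eq
... | inj₂ _  | inj₁ eq = eq
... | inj₂ (eq , _) | inj₂ (eq′ , _) = trans eq′ (sym eq)

Erased-compat : ∀ {m} {δ ε : Fin m → Fin m} {σ} → Erased δ ε → Compat δ σ → Compat ε σ
Erased-compat {σ = σ} δε C p ne e with δε p
... | inj₁ eq = C p (ne ∘ trans eq) (trans e (cong σ eq))
... | inj₂ (eq , _) = ne eq

module Maximal {m} (par-m : par m ≡ false) {ε : Fin m → Fin m} (H : HalfTL ε) where

  open HalfTL H

  private
    par-suc : ∀ x y → par (suc x) ≡ par y → par x ≢ par y
    par-suc x y eq e = Bool.not-¬ (sym e) (sym eq)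

  Range : ℕ → ℕ → Fin m → Set
  Range a b p = a ≤ toℕ p × toℕ p ℕ.< b

  -- Levels matched among themselves are even in number. The arc starting at the first level a cuts
  -- the range into its interior and the part after it, both closed again; k bounds the length and
  -- makes the recursion structural.
  closed-range-par : ∀ k {a b} → b ≤ a ℕ.+ k → a ≤ b → b ≤ m → Closed ε (Range a b) → par a ≡ par b
  closed-range-par k {a} {b} b≤a+k a≤b b≤m cl with ℕ.m≤n⇒m<n∨m≡n a≤b
  ... | inj₂ refl = refl
  closed-range-par zero    {a} {b} b≤a+k a≤b b≤m cl | inj₁ a<b =
    contradiction (subst (b ≤_) (ℕ.+-identityʳ a) b≤a+k) (ℕ.<⇒≱ a<b)
  closed-range-par (suc k) {a} {b} b≤a+k a≤b b≤m cl | inj₁ a<b = begin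
    par a                ≡⟨ Bool.not-involutive (par a) ⟨
    not (par (suc a))    ≡⟨ cong not (closed-range-par k (ℕ.≤-trans (ℕ.<⇒≤ q<b) b≤) p<q (ℕ.<⇒≤ (Fin.toℕ<n q)) left-closed) ⟩
    not (par (toℕ q))    ≡⟨⟩
    par (suc (toℕ q))    ≡⟨ closed-range-par k (ℕ.≤-trans b≤ (ℕ.+-monoˡ-≤ k (ℕ.<⇒≤ (s≤s p<q)))) q<b b≤m right-closed ⟩
    par b                ∎
    where
    open ≡-Reasoning
    p q : Fin m
    p = fromℕ< (ℕ.<-≤-trans a<b b≤m)
    q = ε p
    p≡a : toℕ p ≡ a
    p≡a = Fin.toℕ-fromℕ< _
    p-closed : Range a b q × q ≢ p
    p-closed = cl {p} (ℕ.≤-reflexive (sym p≡a) , subst (ℕ._< b) (sym p≡a) a<b)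
    q<b : toℕ q ℕ.< b
    q<b = proj₂ (proj₁ p-closed)
    p<q : a ℕ.< toℕ q
    p<q = ℕ.≤∧≢⇒< (proj₁ (proj₁ p-closed)) (λ e → proj₂ p-closed (Fin.toℕ-injective (sym (trans p≡a e))))
    b≤ : b ≤ suc a ℕ.+ k
    b≤ = subst (b ≤_) (ℕ.+-suc a k) b≤a+k
    left-closed : Closed ε (Range (suc a) (toℕ q))
    left-closed {r} (l , h) =
      let (l′ , h′) , ne = nested p {r} (subst (ℕ._< toℕ r) (sym p≡a) l , h)
      in (subst (ℕ._< toℕ (ε r)) p≡a l′ , h′) , ne
    right-closed : Closed ε (Range (suc (toℕ q)) b)
    right-closed {r} (q<r , r<b) with cl {r} (ℕ.<⇒≤ (ℕ.<-trans p<q q<r) , r<b)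
    ... | (a≤εr , εr<b) , ne with Fin.<-cmp q (ε r)
    ...   | tri< lt _ _ = (lt , εr<b) , ne
    ...   | tri≈ _ eq _ = contradiction q<r (ℕ.<⇒≯ (subst (ℕ._< toℕ q) (trans (sym p≡a) (cong toℕ (injective eq))) p<q))
    ...   | tri> _ _ εr<q with ℕ.m≤n⇒m<n∨m≡n a≤εr
    ...     | inj₂ a≡εr = contradiction (cong toℕ (flip (Fin.toℕ-injective (trans (sym a≡εr) (sym p≡a))))) (ℕ.<⇒≢ q<r)
    ...     | inj₁ a<εr = contradiction
                (subst (Fin._< q) (involutive r) (proj₂ (proj₁ (nested p {ε r} (subst (ℕ._< toℕ (ε r)) (sym p≡a) a<εr , εr<q)))))
                (ℕ.<-asym q<r)

  record Next (p q : Fin m) : Set where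
    field
      p<q   : p Fin.< q
      fixˡ  : ε p ≡ p
      fixʳ  : ε q ≡ q
      empty : ∀ r → Between p q r → ε r ≢ r

  fixed-uncovered : ∀ {p x} → ε p ≡ p → x Fin.< p → ¬ (p Fin.< ε x)
  fixed-uncovered {p} {x} e x<p p<εx = proj₂ (nested x {p} (x<p , p<εx)) e

  above-fixed : ∀ {p r} → ε p ≡ p → p Fin.< r → p Fin.< ε r
  above-fixed {p} {r} e p<r with Fin.<-cmp p (ε r)
  ... | tri< lt _ _ = lt
  ... | tri≈ _ eq _ = contradiction p<r (ℕ.<-irrefl (cong toℕ (trans (trans (sym e) (cong ε eq)) (involutive r))))
  ... | tri> _ _ gt = contradiction (subst (p Fin.<_) (sym (involutive r)) p<r) (fixed-uncovered {p} {ε r} e gt)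

  below-fixed : ∀ {q r} → ε q ≡ q → r Fin.< q → ε r Fin.< q
  below-fixed {q} {r} e r<q with Fin.<-cmp (ε r) q
  ... | tri< lt _ _ = lt
  ... | tri≈ _ eq _ = contradiction r<q (ℕ.<-irrefl (cong toℕ (trans (sym (flip eq)) e)))
  ... | tri> _ _ gt = contradiction gt (fixed-uncovered {q} {r} e r<q)

  next-closed : ∀ {p q} → Next p q → Closed ε (Between p q)
  next-closed {p} {q} nx {r} (p<r , r<q) = (above-fixed {p} {r} fixˡ p<r , below-fixed {q} {r} fixʳ r<q) , empty r (p<r , r<q)
    where open Next nx

  -- The levels between two consecutive fixed points are matched among themselves.
  next-par : ∀ {p q} → Next p q → par (toℕ p) ≢ par (toℕ q)
  next-par {p} {q} nx = par-suc (toℕ p) (toℕ q) (closed-range-par (toℕ q) {suc (toℕ p)} {toℕ q} (ℕ.m≤n+m (toℕ q) (suc (toℕ p))) (Next.p<q nx)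
    (ℕ.<⇒≤ (Fin.toℕ<n q)) (λ {r} → next-closed nx {r}))

  -- The parities of the successive fixed points alternate, beginning with an even level, so the
  -- pairs starting at an even level are the first and second fixed point, the third and fourth, and
  -- so on; no counting of fixed points is required.
  Link : Fin m → Fin m → Set
  Link p q = par (toℕ p) ≡ false × Next p q

  Adjacent : Fin m → Fin m → Set
  Adjacent p q = Link p q ⊎ Link q p

  next-unique : ∀ {p q q′} → Next p q → Next p q′ → q ≡ q′
  next-unique {p} {q} {q′} nx nx′ with Fin.<-cmp q q′
  ... | tri< lt _ _ = contradiction (Next.fixʳ nx) (Next.empty nx′ q (Next.p<q nx , lt))
  ... | tri≈ _ eq _ = eq
  ... | tri> _ _ gt = contradiction (Next.fixʳ nx′) (Next.empty nx q′ (Next.p<q nx′ , gt))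

  previous-unique : ∀ {p p′ q} → Next p q → Next p′ q → p ≡ p′
  previous-unique {p} {p′} {q} nx nx′ with Fin.<-cmp p p′
  ... | tri< lt _ _ = contradiction (Next.fixˡ nx′) (Next.empty nx p′ (lt , Next.p<q nx′))
  ... | tri≈ _ eq _ = eq
  ... | tri> _ _ gt = contradiction (Next.fixˡ nx) (Next.empty nx′ p (gt , Next.p<q nx))

  adjacent-unique : ∀ {p q q′} → Adjacent p q → Adjacent p q′ → q ≡ q′
  adjacent-unique (inj₁ (_ , nx)) (inj₁ (_ , nx′)) = next-unique nx nx′
  adjacent-unique (inj₂ (_ , nx)) (inj₂ (_ , nx′)) = previous-unique nx nx′
  adjacent-unique (inj₁ (e , _)) (inj₂ (e′ , nx)) = contradiction (trans e′ (sym e)) (next-par nx)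
  adjacent-unique (inj₂ (e′ , nx)) (inj₁ (e , _)) = contradiction (trans e′ (sym e)) (next-par nx)

  -- If p were the last fixed point, the levels after it would be matched among themselves; as m is
  -- even, p would then be odd.
  next-exists : ∀ p → ε p ≡ p → par (toℕ p) ≡ false → ∃ (Next p)
  next-exists p e ev with Fin.any? (λ q → (p Fin.<? q) ×-dec (ε q Fin.≟ q))
  ... | no none = contradiction (trans ev (sym par-m)) (par-suc (toℕ p) m (closed-range-par m {suc (toℕ p)} {m} (ℕ.m≤n+m m (suc (toℕ p))) (Fin.toℕ<n p) ℕ.≤-refl
          (λ {r} (p<r , _) → (above-fixed {p} {r} e p<r , Fin.toℕ<n (ε r)) , λ e′ → none (r , p<r , e′))))
  ... | yes some with minimal (λ q → (p Fin.<? q) ×-dec (ε q Fin.≟ q)) toℕ some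
  ...   | q , (p<q , e′) , least = q , record
            { p<q = p<q ; fixˡ = e ; fixʳ = e′ ; empty = λ r (p<r , r<q) er → least r (p<r , er) r<q }

  -- If p were the first fixed point, the levels before it would be matched among themselves and p
  -- would be even.
  previous-exists : ∀ p → ε p ≡ p → par (toℕ p) ≡ true → ∃ λ q → Next q p
  previous-exists p e od with Fin.any? (λ q → (q Fin.<? p) ×-dec (ε q Fin.≟ q))
  ... | no none = case trans (closed-range-par (toℕ p) {0} ℕ.≤-refl z≤n (ℕ.<⇒≤ (Fin.toℕ<n p))
          (λ {r} (_ , r<p) → (z≤n , below-fixed {p} {r} e r<p) , λ e′ → none (r , r<p , e′))) od of λ ()
  ... | yes some with minimal (λ q → (q Fin.<? p) ×-dec (ε q Fin.≟ q)) (λ q → m ℕ.∸ toℕ q) some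
  ...   | q , (q<p , e′) , greatest = q , record
            { p<q = q<p ; fixˡ = e′ ; fixʳ = e
            ; empty = λ r (q<r , r<p) er → greatest r (r<p , er) (ℕ.∸-monoʳ-< q<r (ℕ.<⇒≤ (Fin.toℕ<n r))) }

  adjacent-exists : ∀ p → ε p ≡ p → ∃ (Adjacent p)
  adjacent-exists p e = cases (par (toℕ p)) refl
    where
    cases : ∀ b → par (toℕ p) ≡ b → ∃ (Adjacent p)
    cases false eq = let q , nx = next-exists p e eq in q , inj₁ (eq , nx)
    cases true  eq = let q , nx = previous-exists p e eq
                     in q , inj₂ (Bool.¬-not (λ e′ → next-par nx (trans e′ (sym eq))) , nx)

  -- All horizontal edges are paired off here, regardless of colour; `maximum` then keeps the pairs
  -- with different colours.
  full : Fin m → Fin m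
  full p with ε p Fin.≟ p
  ... | yes e = proj₁ (adjacent-exists p e)
  ... | no _  = ε p

  full-adjacent : ∀ {p} → ε p ≡ p → Adjacent p (full p)
  full-adjacent {p} e with ε p Fin.≟ p
  ... | yes e′ = proj₂ (adjacent-exists p e′)
  ... | no ne  = contradiction e ne

  full-arc : ∀ {p} → ε p ≢ p → full p ≡ ε p
  full-arc {p} ne with ε p Fin.≟ p
  ... | yes e = contradiction e ne
  ... | no _  = refl

  adjacent-fixed : ∀ {p q} → Adjacent p q → ε q ≡ q
  adjacent-fixed (inj₁ (_ , nx)) = Next.fixʳ nx
  adjacent-fixed (inj₂ (_ , nx)) = Next.fixˡ nx

  full-involutive : ∀ p → full (full p) ≡ p
  full-involutive p = cases (ε p Fin.≟ p)
    where
    cases : Dec (ε p ≡ p) → full (full p) ≡ p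
    cases (yes e) = adjacent-unique (full-adjacent (adjacent-fixed (full-adjacent e))) (Sum.swap (full-adjacent e))
    cases (no ne) = trans (cong full (full-arc ne)) (trans (full-arc (ne ∘ injective)) (involutive p))

  full-free : ∀ p → full p ≢ p
  full-free p = cases (ε p Fin.≟ p)
    where
    cases : Dec (ε p ≡ p) → full p ≢ p
    cases (no ne) e = ne (trans (sym (full-arc ne)) e)
    cases (yes e) with full-adjacent e
    ... | inj₁ (_ , nx) = λ e′ → ℕ.<-irrefl (cong toℕ (sym e′)) (Next.p<q nx)
    ... | inj₂ (_ , nx) = λ e′ → ℕ.<-irrefl (cong toℕ e′) (Next.p<q nx)

  module _ {σ : Fin m → Bool} (C : Compat ε σ) where

    -- The half of the diagram D_max determined by ε.
    maximum : Fin m → Fin m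
    maximum p = if same (σ p) (σ (full p)) then p else full p

    maximum-same : ∀ {p} → σ p ≡ σ (full p) → maximum p ≡ p
    maximum-same {p} e = cong (if_then p else full p) (dec-true (σ p Bool.≟ σ (full p)) e)

    maximum-differ : ∀ {p} → σ p ≢ σ (full p) → maximum p ≡ full p
    maximum-differ {p} ne = cong (if_then p else full p) (dec-false (σ p Bool.≟ σ (full p)) ne)

    maximum-arc : ∀ {p} → ε p ≢ p → maximum p ≡ ε p
    maximum-arc {p} ne = trans (maximum-differ (λ e → C p ne (trans e (cong σ (full-arc ne))))) (full-arc ne)

    maximum-compat : Compat maximum σ
    maximum-compat p ne e with σ p Bool.≟ σ (full p)
    ... | yes _ = ne refl
    ... | no d  = d e

    maximum-adjacent : ∀ {p} → ε p ≡ p → maximum p ≢ p → Adjacent p (maximum p)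
    maximum-adjacent {p} e ne with σ p Bool.≟ σ (full p)
    ... | yes _ = contradiction refl ne
    ... | no _  = full-adjacent e

    -- No fixed point of ε lies inside an arc of `maximum`: either it is an arc of ε, or its ends
    -- are consecutive fixed points. Inside it `maximum` therefore agrees with ε.
    maximum-half : HalfTL maximum
    maximum-half = record { involutive = inv ; nested = nest }
      where
      inv : ∀ p → maximum (maximum p) ≡ p
      inv p = cases (σ p Bool.≟ σ (full p))
        where
        cases : Dec (σ p ≡ σ (full p)) → maximum (maximum p) ≡ p
        cases (yes e) = trans (cong maximum (maximum-same e)) (maximum-same e)
        cases (no ne) = trans (cong maximum (maximum-differ ne))
          (trans (maximum-differ (λ e → ne (sym (trans e (cong σ (full-involutive p)))))) (full-involutive p))
      nest : ∀ p → Closed maximum (Between p (maximum p))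
      nest p {q} (p<q , q<Mp) = cases (ε p Fin.≟ p)
        where
        move : ∀ {y} → maximum p ≡ y → Between p y (ε q) × ε q ≢ q → Between p (maximum p) (maximum q) × maximum q ≢ q
        move eq (btw , ne) = subst₂ (λ y z → Between p y z × z ≢ q) (sym eq) (sym (maximum-arc ne)) (btw , ne)
        cases : Dec (ε p ≡ p) → Between p (maximum p) (maximum q) × maximum q ≢ q
        cases (no ne) = move (maximum-arc ne) (nested p {q} (p<q , subst (q Fin.<_) (maximum-arc ne) q<Mp))
        cases (yes e) with maximum-adjacent {p} e (λ e′ → ℕ.<-irrefl (cong toℕ (sym e′)) (ℕ.<-trans p<q q<Mp))
        ... | inj₁ (_ , nx) = move refl (next-closed nx {q} (p<q , q<Mp))
        ... | inj₂ (_ , nx) = contradiction (Next.p<q nx) (ℕ.<-asym (ℕ.<-trans p<q q<Mp))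

    adjacent-odd : ∀ {p} → Adjacent p (maximum p) → OddArc maximum p
    adjacent-odd (inj₁ (e , nx)) = inj₁ (e , Next.p<q nx)
    adjacent-odd (inj₂ (e , nx)) = inj₂ (e , Next.p<q nx)

    erased-maximum : Erased maximum ε
    erased-maximum p = cases (ε p Fin.≟ p) (maximum p Fin.≟ p)
      where
      cases : Dec (ε p ≡ p) → Dec (maximum p ≡ p) → ε p ≡ maximum p ⊎ (ε p ≡ p × OddArc maximum p)
      cases (no ne) _       = inj₁ (sym (maximum-arc ne))
      cases (yes e) (yes f) = inj₁ (trans e (sym f))
      cases (yes e) (no ne) = inj₂ (e , adjacent-odd (maximum-adjacent e ne))

    module _ {φ : Fin m → Fin m} (Hφ : HalfTL φ) (Cφ : Compat φ σ) (er : Erased φ ε) where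

      private module Φ = HalfTL Hφ

      fixed-partner : ∀ {p} → ε p ≡ p → ε (φ p) ≡ φ p
      fixed-partner {p} e with er (φ p)
      ... | inj₂ (e′ , _) = e′
      ... | inj₁ e′ = cong-φ (trans (sym e) (flip (trans e′ (Φ.involutive p))))
        where
        cong-φ : p ≡ φ p → ε (φ p) ≡ φ p
        cong-φ eq = trans (cong ε (sym eq)) (trans e eq)

      -- An odd arc of φ that is erased in ε joins consecutive fixed points of ε. Otherwise let k be
      -- the first fixed point of ε inside it. Lying under an arc, k is not fixed by φ, so its arc
      -- was erased and is odd. If k is the upper end, then k is even like i, although i and k are
      -- consecutive fixed points; if k is the lower end, its partner is an earlier fixed point.
      arc-link : ∀ {i j} → φ i ≡ j → i Fin.< j → par (toℕ i) ≡ false → ε i ≡ i → Link i j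
      arc-link {i} {j} refl i<j ev ei = ev , record
        { p<q = i<j ; fixˡ = ei ; fixʳ = fixed-partner ei
        ; empty = λ r btw er → absurd (minimal (λ k → ((i Fin.<? k) ×-dec (k Fin.<? j)) ×-dec (ε k Fin.≟ k)) toℕ (r , btw , er)) }
        where
        absurd : ¬ (∃ λ k → (Between i j k × ε k ≡ k) × (∀ r → Between i j r × ε r ≡ r → ¬ (toℕ r ℕ.< toℕ k)))
        absurd (k , ((i<k , k<j) , ek) , least) with er k
        ... | inj₁ e = proj₂ (Φ.nested i {k} (i<k , k<j)) (trans (sym e) ek)
        ... | inj₂ (_ , inj₁ (even-k , _)) = next-par nx (trans ev (sym even-k))
          where
          nx : Next i k
          nx = record { p<q = i<k ; fixˡ = ei ; fixʳ = ek ; empty = λ r (i<r , r<k) f → least r ((i<r , ℕ.<-trans r<k k<j) , f) r<k }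
        ... | inj₂ (_ , inj₂ (_ , φk<k)) =
          least (φ k) (proj₁ (Φ.nested i {k} (i<k , k<j)) , fixed-partner ek) φk<k

      -- By `arc-link` each arc of φ erased in ε is an arc of `full`. Its ends differ in colour
      -- because φ is compatible, so `maximum` contains it too.
      maximum-greatest : Erased maximum φ
      maximum-greatest p = cases (ε p Fin.≟ p) (φ p Fin.≟ p) (er p)
        where
        cases : Dec (ε p ≡ p) → Dec (φ p ≡ p) → ε p ≡ φ p ⊎ (ε p ≡ p × OddArc φ p) →
                φ p ≡ maximum p ⊎ (φ p ≡ p × OddArc maximum p)
        cases (no ne) _ (inj₁ e)       = inj₁ (trans (sym e) (sym (maximum-arc ne)))
        cases (no ne) _ (inj₂ (e , _)) = contradiction e ne
        cases (yes e) (yes f) _ =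
          [ (λ e′ → inj₁ (trans f (trans (sym e) e′))) , (λ (_ , od) → inj₂ (f , od)) ]′ (erased-maximum p)
        cases (yes e) (no nf) (inj₁ e′) = contradiction (trans (sym e′) e) nf
        cases (yes e) (no nf) (inj₂ (_ , od)) =
          inj₁ (sym (trans (maximum-differ (λ e′ → Cφ p nf (trans e′ (cong σ full≡φ)))) full≡φ))
          where
          adj : OddArc φ p → Adjacent p (φ p)
          adj (inj₁ (ev , lt)) = inj₁ (arc-link refl lt ev e)
          adj (inj₂ (ev , lt)) = inj₂ (arc-link (Φ.involutive p) lt ev (fixed-partner e))
          full≡φ : full p ≡ φ p
          full≡φ = adjacent-unique (full-adjacent e) (adj od)

    -- Each arc of `full` contributes the `xor` of the colours of its ends, which is true exactly if
    -- `maximum` keeps the arc; `full` has no fixed points, so every level is counted. For σ given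
    -- by I this makes the order of D_max congruent to |I| modulo 2, hence even.
    maximum-arcs-par : Xor.⨁ (allFin m) (λ p → does (p Fin.<? maximum p)) ≡ Xor.⨁ (allFin m) σ
    maximum-arcs-par = sym (trans
      (Cycles.cycles (CommutativeRing.+-commutativeMonoid Bool.xor-∧-commutativeRing) full full-involutive full-free σ)
      (Xor.⨁-cong (allFin m) arc))
      where
      arc : ∀ p → (if does (p Fin.<? full p) then σ p xor σ (full p) else false) ≡ does (p Fin.<? maximum p)
      arc p = cases (σ p Bool.≟ σ (full p))
        where
        xor-same : ∀ {x y : Bool} → x ≡ y → x xor y ≡ false
        xor-same {false} refl = refl
        xor-same {true}  refl = refl
        xor-differ : ∀ {x y : Bool} → x ≢ y → x xor y ≡ true
        xor-differ {false} {false} ne = contradiction refl ne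
        xor-differ {false} {true}  ne = refl
        xor-differ {true}  {false} ne = refl
        xor-differ {true}  {true}  ne = contradiction refl ne
        if-const : ∀ b → (if b then false else false) ≡ false
        if-const false = refl
        if-const true  = refl
        if-id : ∀ b → (if b then true else false) ≡ b
        if-id false = refl
        if-id true  = refl
        cases : Dec (σ p ≡ σ (full p)) → (if does (p Fin.<? full p) then σ p xor σ (full p) else false) ≡ does (p Fin.<? maximum p)
        cases (yes e) = trans (cong (if does (p Fin.<? full p) then_else false) (xor-same e))
          (trans (if-const (does (p Fin.<? full p))) (sym (dec-false (p Fin.<? maximum p) λ lt → ℕ.<-irrefl (cong toℕ (sym (maximum-same e))) lt)))
        cases (no ne) = trans (cong (if does (p Fin.<? full p) then_else false) (xor-differ ne))
          (trans (if-id (does (p Fin.<? full p))) (cong (λ q → does (p Fin.<? q)) (sym (maximum-differ ne))))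

-- The function g is left to unification: what `erase` tabulates is a local function that cannot be
-- named outside.
lookup-tabulated : ∀ {a} {A : Set a} {m} {v : Vec A m} {g} → v ≡ tabulate g → ∀ i → lookup v i ≡ g i
lookup-tabulated {g = g} refl i = Vec.lookup∘tabulate g i

-- Erasure of odd edges and the partition of the compatible diagrams

module Erasure (n : ℕ) where

  open Points n

  erase-on : ∀ D X {p} → OnEdgeFrom n D X p → lookup (erase n D X) p ≡ mirror n p
  erase-on D X {p} on with onEdgeFrom? n D X p | lookup-tabulated {v = erase n D X} refl p
  ... | yes _  | eq = eq
  ... | no off | _  = contradiction on off

  erase-off : ∀ D X {p} → ¬ OnEdgeFrom n D X p → lookup (erase n D X) p ≡ lookup D p
  erase-off D X {p} off with onEdgeFrom? n D X p | lookup-tabulated {v = erase n D X} refl p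
  ... | yes on | _  = contradiction on off
  ... | no _   | eq = eq

  private
    same-index : ∀ {s s′ i j} → point s i ≡ point s′ j → i ≡ j
    same-index {s} {s′} eq = cong proj₂ (point-injective {s} {s′} eq)

  double-left : ∀ {δ} → HalfTL δ → ∀ {i j} → lookup (double δ) (leftPoint n i) ≡ leftPoint n j → δ i ≡ j
  double-left {δ} H {i} eq = trans (sym (halfOf-double δ i)) (HalfOf.h-left (double δ) (double-TL δ H) eq)

  module _ {δ : Fin N → Fin N} (Hδ : HalfTL δ) where

    private module Δ = HalfTL Hδ

    erased⁻ : ∀ {E} → ErasedFrom n (double δ) E → Erased δ (halfOf E)
    erased⁻ (X , odd , refl) p with onEdgeFrom? n (double δ) X (leftPoint n p)
    ... | no off = inj₁ (trans (cong ([ id , (λ _ → p) ]′ ∘ side n) (erase-off (double δ) X off)) (halfOf-double δ p))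
    ... | yes on = inj₂ (trans (cong ([ id , (λ _ → p) ]′ ∘ side n) (erase-on (double δ) X on))
                               (cong [ id , (λ _ → p) ]′ (side-right p)) , odd-arc on)
      where
      odd-arc : OnEdgeFrom n (double δ) X (leftPoint n p) → OddArc δ p
      odd-arc (i , i∈X , which) with odd i i∈X
      ... | ev , j , i<j , eq with double-left Hδ eq
      odd-arc (i , i∈X , inj₁ (inj₁ e)) | ev , _ , i<j , eq | refl with refl ← same-index {left} {left} e = inj₁ (2∣⇒par ev , i<j)
      odd-arc (i , i∈X , inj₁ (inj₂ e)) | ev , _ , i<j , eq | refl with refl ← same-index {left} {left} (trans e eq) =
        inj₂ (subst (λ k → par (toℕ k) ≡ false × k Fin.< δ i) (sym (Δ.involutive i)) (2∣⇒par ev , i<j))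
      odd-arc (i , i∈X , inj₂ (inj₁ e)) | ev , _ , i<j , eq | refl = contradiction e left≢right
      odd-arc (i , i∈X , inj₂ (inj₂ e)) | ev , _ , i<j , eq | refl =
        contradiction (trans e (double-arc δ right (λ f → ℕ.<-irrefl (cong toℕ (sym f)) i<j))) left≢right

    -- The set X to be erased consists of the upper ends of those odd arcs of δ which are fixed
    -- points of ε. Since ε is an involution, the lower end of such an arc is fixed as well.
    erased⁺ : ∀ {ε} → HalfTL ε → Erased δ ε → ErasedFrom n (double δ) (double ε)
    erased⁺ {ε} Hε er = X , X-odd , lookup-ext (λ p → agree (pointView p))
      where
      module Ε = HalfTL Hε
      Removed : Fin N → Set
      Removed i = ε i ≡ i × par (toℕ i) ≡ false × i Fin.< δ i
      removed? : Decidable Removed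
      removed? i = (ε i Fin.≟ i) ×-dec ((par (toℕ i) Bool.≟ false) ×-dec (i Fin.<? δ i))
      X : Subset N
      X = tabulate (does ∘ removed?)
      ∈X⁻ : ∀ {i} → i ∈ X → Removed i
      ∈X⁻ {i} i∈ = does-true (removed? i) (trans (sym (Vec.lookup∘tabulate _ i)) (Vec.[]=⇒lookup i∈))
      ∈X⁺ : ∀ {i} → Removed i → i ∈ X
      ∈X⁺ {i} r = Vec.lookup⇒[]= i X (trans (Vec.lookup∘tabulate _ i) (dec-true (removed? i) r))
      arc : ∀ s {i} → i Fin.< δ i → lookup (double δ) (point s i) ≡ point s (δ i)
      arc s i<δi = double-arc δ s (λ f → ℕ.<-irrefl (cong toℕ (sym f)) i<δi)
      X-odd : ∀ i → i ∈ X → OddUpperEnd n (double δ) i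
      X-odd i i∈ = let _ , ev , i<δi = ∈X⁻ i∈ in par⇒2∣ (toℕ i) ev , δ i , i<δi , arc left i<δi
      on-removed : ∀ {s i} → OnEdgeFrom n (double δ) X (point s i) → ε i ≡ i
      on-removed {s} {i} (k , k∈X , which) = [ (λ { refl → εk≡k }) , lower-end ]′ (end which)
        where
        εk≡k = proj₁ (∈X⁻ k∈X)
        k<δk = proj₂ (proj₂ (∈X⁻ k∈X))
        end : _ → i ≡ k ⊎ i ≡ δ k
        end (inj₁ (inj₁ e)) = inj₁ (same-index {s} {left} e)
        end (inj₁ (inj₂ e)) = inj₂ (same-index {s} {left} (trans e (arc left k<δk)))
        end (inj₂ (inj₁ e)) = inj₁ (same-index {s} {right} e)
        end (inj₂ (inj₂ e)) = inj₂ (same-index {s} {right} (trans e (arc right k<δk)))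
        lower-end : i ≡ δ k → ε i ≡ i
        lower-end refl with er (δ k)
        ... | inj₂ (e , _) = e
        ... | inj₁ e = trans (trans e (Δ.involutive k)) (trans (sym εk≡k) (Ε.flip (trans e (Δ.involutive k))))
      upper-on : ∀ s {i} → Removed i → OnEdgeFrom n (double δ) X (point s i)
      upper-on left  r = _ , ∈X⁺ r , inj₁ (inj₁ refl)
      upper-on right r = _ , ∈X⁺ r , inj₂ (inj₁ refl)
      lower-on : ∀ s {i} → Removed i → OnEdgeFrom n (double δ) X (point s (δ i))
      lower-on left  r = _ , ∈X⁺ r , inj₁ (inj₂ (sym (arc left (proj₂ (proj₂ r)))))
      lower-on right r = _ , ∈X⁺ r , inj₂ (inj₂ (sym (arc right (proj₂ (proj₂ r)))))
      removed-on : ∀ {s i} → ε i ≡ i → OddArc δ i → OnEdgeFrom n (double δ) X (point s i)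
      removed-on {s} e (inj₁ (ev , lt)) = upper-on s (e , ev , lt)
      removed-on {s} {i} e (inj₂ (ev , lt)) = subst (λ k → OnEdgeFrom n (double δ) X (point s k)) (Δ.involutive i)
        (lower-on s (fixed , ev , subst (δ i Fin.<_) (sym (Δ.involutive i)) lt))
        where
        fixed : ε (δ i) ≡ δ i
        fixed with er (δ i)
        ... | inj₂ (e′ , _) = e′
        ... | inj₁ e′ = trans (trans e′ (Δ.involutive i)) (trans (sym e) (Ε.flip (trans e′ (Δ.involutive i))))
      agree : ∀ {p} → PointView p → lookup (double ε) p ≡ lookup (erase n (double δ) X) p
      agree (at s i) with onEdgeFrom? n (double δ) X (point s i)
      ... | yes on = trans (double-fixed ε s (on-removed {s} on))
                       (sym (trans (erase-on (double δ) X on) (mirror-point s i)))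
      ... | no off = trans (same-partner (er i) (δ i Fin.≟ i)) (sym (erase-off (double δ) X off))
        where
        same-partner : ε i ≡ δ i ⊎ (ε i ≡ i × OddArc δ i) → Dec (δ i ≡ i) →
                       lookup (double ε) (point s i) ≡ lookup (double δ) (point s i)
        same-partner (inj₂ (e , od)) _ = contradiction (removed-on {s} e od) off
        same-partner (inj₁ e) (yes f) = trans (double-fixed ε s (trans e f)) (sym (double-fixed δ s f))
        same-partner (inj₁ e) (no ne) =
          trans (double-arc ε s (ne ∘ trans (sym e))) (trans (cong (point s) e) (sym (double-arc δ s ne)))

    par-order : par (order n (double δ)) ≡ Xor.⨁ (allFin N) (λ i → does (i Fin.<? δ i))
    par-order = begin
      par (order n (double δ))
        ≡⟨ par-length-filter (leftEdge? n (double δ)) (pairs N) ⟩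
      Xor.⨁ (pairs N) (does ∘ leftEdge? n (double δ))
        ≡⟨ Xor.⨁-product _,_ (allFin N) (allFin N) (does ∘ leftEdge? n (double δ)) ⟩
      Xor.⨁ (allFin N) (λ i → Xor.⨁ (allFin N) (λ j → does (leftEdge? n (double δ) (i , j))))
        ≡⟨ Xor.⨁-cong (allFin N) (λ i → row i (i Fin.<? δ i)) ⟩
      Xor.⨁ (allFin N) (λ i → does (i Fin.<? δ i)) ∎
      where
      open ≡-Reasoning
      row : ∀ i → (d : Dec (i Fin.< δ i)) → Xor.⨁ (allFin N) (λ j → does (leftEdge? n (double δ) (i , j))) ≡ does d
      row i (yes lt) = trans
        (Xor.⨁-single (Unique.allFin⁺ N) (∈-allFin (δ i)) λ {j} _ j≢ →
          dec-false (leftEdge? n (double δ) (i , j)) λ (_ , eq) → j≢ (sym (double-left Hδ eq)))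
        (dec-true (leftEdge? n (double δ) (i , δ i)) (lt , double-arc δ left (λ f → ℕ.<-irrefl (cong toℕ (sym f)) lt)))
      row i (no ¬lt) = Xor.⨁-ε (allFin N) λ {j} _ →
        dec-false (leftEdge? n (double δ) (i , j)) λ (i<j , eq) → ¬lt (subst (i Fin.<_) (sym (double-left Hδ eq)) i<j)

  module Diagrams where

    half : ∀ {D} → D ∈ˡ 𝒯 n → HalfTL (halfOf D)
    half {D} D∈ = HalfOf.half D (∈-𝒯⁻ D∈)

    double-half : ∀ {D} → D ∈ˡ 𝒯 n → double (halfOf D) ≡ D
    double-half {D} D∈ = HalfOf.double-halfOf D (∈-𝒯⁻ D∈)

    erased : ∀ {D E} → D ∈ˡ 𝒯 n → ErasedFrom n D E → Erased (halfOf D) (halfOf E)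
    erased {D} {E} D∈ er = erased⁻ (half D∈) (subst (λ D → ErasedFrom n D E) (sym (double-half D∈)) er)

    erasedFrom : ∀ {D E} → D ∈ˡ 𝒯 n → E ∈ˡ 𝒯 n → Erased (halfOf D) (halfOf E) → ErasedFrom n D E
    erasedFrom D∈ E∈ er = subst₂ (ErasedFrom n) (double-half D∈) (double-half E∈) (erased⁺ (half D∈) (half E∈) er)

    ∈-S⁻ : ∀ {D E} → E ∈ˡ S n D → E ∈ˡ 𝒯 n × ErasedFrom n D E
    ∈-S⁻ {D} = ∈-filter⁻ (erasedFrom? n D) {xs = 𝒯 n}

    ∈-S⁺ : ∀ {D E} → D ∈ˡ 𝒯 n → E ∈ˡ 𝒯 n → Erased (halfOf D) (halfOf E) → E ∈ˡ S n D
    ∈-S⁺ {D} D∈ E∈ er = ∈-filter⁺ (erasedFrom? n D) E∈ (erasedFrom D∈ E∈ er)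

    module _ (I : Subset N) (even : 2 ∣ ∣ I ∣) where

      compat : ∀ {D} → D ∈ˡ 𝒯 n → Compatible n I D → Compat (halfOf D) (lookup I)
      compat {D} D∈ C = double-compatible⁺ (halfOf D) I (subst (Compatible n I) (sym (double-half D∈)) C)

      compatible : ∀ {D} → D ∈ˡ 𝒯 n → Compat (halfOf D) (lookup I) → Compatible n I D
      compatible {D} D∈ C = subst (Compatible n I) (double-half D∈) (double-compatible⁻ (halfOf D) I C)

      ∈-𝒟⁻ : ∀ {D} → D ∈ˡ 𝒟 n I → D ∈ˡ 𝒯 n × Compatible n I D
      ∈-𝒟⁻ = ∈-filter⁻ (compatible? n I) {xs = 𝒯 n}

      dmax? : Decidable (λ D → Any (λ D′ → IsDmaxOf n I D′ D) (𝒟 n I))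
      dmax? D = Any.any? (λ D′ → isDmaxOf? n I D′ D) (𝒟 n I)

      ∈-𝒟max⁻ : ∀ {D} → D ∈ˡ 𝒟max n I → D ∈ˡ 𝒟 n I × Any (λ D′ → IsDmaxOf n I D′ D) (𝒟 n I)
      ∈-𝒟max⁻ D∈ =
        let D∈′ , dmax = ∈-filter⁻ dmax? {xs = filter (compatible? n I) (𝒯ᵉ n)} D∈
            D∈ᵉ , C = ∈-filter⁻ (compatible? n I) {xs = 𝒯ᵉ n} D∈′
        in ∈-filter⁺ (compatible? n I) (proj₁ (∈-filter⁻ (λ D → 2 ∣? order n D) {xs = 𝒯 n} D∈ᵉ)) C , dmax

      𝒟max-unique : Unique (𝒟max n I)
      𝒟max-unique = Unique.filter⁺ dmax? (Unique.filter⁺ (compatible? n I) (Unique.filter⁺ (λ D → 2 ∣? order n D) 𝒯-unique))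

      module _ {E : Diagram n} (E∈𝒯 : E ∈ˡ 𝒯 n) (CE : Compatible n I E) where

        open Maximal (2∣⇒par (ℕ.divides n refl)) (half E∈𝒯)

        private
          C = compat E∈𝒯 CE
          μ = maximum C
          μ-half = maximum-half C

        dmax : Diagram n
        dmax = double μ

        private
          dmax∈𝒯 : dmax ∈ˡ 𝒯 n
          dmax∈𝒯 = ∈-𝒯⁺ (double-TL μ μ-half)

          halfOf-dmax : ∀ {ε} → Erased μ ε → Erased (halfOf dmax) ε
          halfOf-dmax er p with er p
          ... | inj₁ e = inj₁ (trans e (sym (halfOf-double μ p)))
          ... | inj₂ (e , od) = inj₂ (e , subst (λ q → (par (toℕ p) ≡ false × p Fin.< q) ⊎ (par (toℕ q) ≡ false × q Fin.< p))
                                            (sym (halfOf-double μ p)) od)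

          dmax-compatible : Compatible n I dmax
          dmax-compatible = double-compatible⁻ μ I (maximum-compat C)

          dmax-greatest : ∀ {F} → F ∈ˡ 𝒟 n I → E ∈ˡ S n F → Erased (halfOf dmax) (halfOf F)
          dmax-greatest F∈ E∈SF = let F∈𝒯 , CF = ∈-𝒟⁻ F∈ in
            halfOf-dmax (maximum-greatest C (half F∈𝒯) (compat F∈𝒯 CF) (erased F∈𝒯 (proj₂ (∈-S⁻ E∈SF))))

        dmax-erased : ErasedFrom n dmax E
        dmax-erased = erasedFrom dmax∈𝒯 E∈𝒯 (halfOf-dmax (erased-maximum C))

        dmax∈𝒟max : dmax ∈ˡ 𝒟max n I
        dmax∈𝒟max = ∈-filter⁺ dmax? (∈-filter⁺ (compatible? n I) (∈-filter⁺ (λ D → 2 ∣? order n D) dmax∈𝒯 even-order) dmax-compatible)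
          (lose (∈-filter⁺ (compatible? n I) E∈𝒯 CE)
            (∈-filter⁺ (erasedFrom? n dmax) E∈𝒯 dmax-erased , All.tabulate λ F∈ E∈SF G∈SF →
              let F∈𝒯 = proj₁ (∈-𝒟⁻ F∈) ; G∈𝒯 , er = ∈-S⁻ G∈SF
              in ∈-S⁺ dmax∈𝒯 G∈𝒯 (Erased-trans (dmax-greatest F∈ E∈SF) (erased F∈𝒯 er))))
          where
          open import Data.List.Membership.Propositional using (lose)
          even-order : 2 ∣ order n dmax
          even-order = par⇒2∣ (order n dmax) (trans (par-order μ-half)
            (trans (maximum-arcs-par C) (trans (sym (par-∣∣ I)) (2∣⇒par even))))

        -- Let D be the maximal diagram of some E₁. As E lies in S(D), the diagram D is erased from
        -- `dmax`, so E₁ lies in S(`dmax`) too. Maximality of D then gives S(`dmax`) ⊆ S(D), so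
        -- `dmax` is erased from D, and antisymmetry applies.
        dmax-only : ∀ {D} → D ∈ˡ 𝒟max n I → ErasedFrom n D E → D ≡ dmax
        dmax-only {D} D∈ er =
          let D∈𝒟 , some = ∈-𝒟max⁻ D∈
              E₁ , _ , E₁∈SD , above = find some
              D∈𝒯 = proj₁ (∈-𝒟⁻ D∈𝒟)
              below-dmax = dmax-greatest D∈𝒟 (∈-filter⁺ (erasedFrom? n D) E∈𝒯 er)
              E₁∈𝒯 , er₁ = ∈-S⁻ E₁∈SD
              E₁∈Sdmax = ∈-S⁺ dmax∈𝒯 E₁∈𝒯 (Erased-trans below-dmax (erased D∈𝒯 er₁))
              dmax∈Sdmax = ∈-S⁺ dmax∈𝒯 dmax∈𝒯 (Erased-refl (halfOf dmax))
              dmax∈SD = All.lookup above (∈-filter⁺ (compatible? n I) dmax∈𝒯 dmax-compatible) E₁∈Sdmax dmax∈Sdmax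
          in trans (sym (double-half D∈𝒯)) (trans
               (double-cong (Erased-antisym (erased D∈𝒯 (proj₂ (∈-S⁻ dmax∈SD))) below-dmax)) (double-half dmax∈𝒯))
          where open import Data.List.Membership.Propositional using (find)

      erased-compatible : ∀ {D E} → D ∈ˡ 𝒟max n I → E ∈ˡ 𝒯 n → ErasedFrom n D E → Compatible n I E
      erased-compatible D∈ E∈ er = let D∈𝒯 , C = ∈-𝒟⁻ (proj₁ (∈-𝒟max⁻ D∈)) in
        compatible E∈ (Erased-compat (erased D∈𝒯 er) (compat D∈𝒯 C))

      module Regroup {c ℓ} (M : CommutativeMonoid c ℓ) where

        open Fold M
        open CommutativeMonoid M using (_≈_; setoid) renaming (trans to ≈-trans)
        open import Relation.Binary.Reasoning.Setoid setoid

        -- The sets S(D), D ∈ 𝒟max(I), partition 𝒟(I).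
        regroup : ∀ g → ⨁ (𝒟max n I) (λ D → ⨁ (S n D) g) ≈ ⨁ (𝒟 n I) g
        regroup g = begin
          ⨁ (𝒟max n I) (λ D → ⨁ (S n D) g)
            ≈⟨ ⨁-cong (𝒟max n I) (λ D → ⨁-filter (erasedFrom? n D) (𝒯 n) g) ⟩
          ⨁ (𝒟max n I) (λ D → ⨁ (𝒯 n) (λ E → when (does (erasedFrom? n D E)) (g E)))
            ≈⟨ ⨁-swap (𝒟max n I) (𝒯 n) _ ⟩
          ⨁ (𝒯 n) (λ E → ⨁ (𝒟max n I) (λ D → when (does (erasedFrom? n D E)) (g E)))
            ≈⟨ ⨁-cong∈ (𝒯 n) (λ {E} E∈ → column E∈ (compatible? n I E)) ⟩
          ⨁ (𝒯 n) (λ E → when (does (compatible? n I E)) (g E))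
            ≈⟨ ⨁-filter (compatible? n I) (𝒯 n) g ⟨
          ⨁ (𝒟 n I) g ∎
          where
          -- A compatible E belongs to S(D) for exactly one maximal D; an incompatible E belongs to
          -- none, erasure preserving compatibility.
          column : ∀ {E} → E ∈ˡ 𝒯 n → (C? : Dec (Compatible n I E)) →
                   ⨁ (𝒟max n I) (λ D → when (does (erasedFrom? n D E)) (g E)) ≈ when (does C?) (g E)
          column {E} E∈ (yes C) = ≈-trans
            (⨁-single 𝒟max-unique (dmax∈𝒟max E∈ C) λ {D} D∈ D≢ →
              when-congˡ (g E) (dec-false (erasedFrom? n D E) (D≢ ∘ dmax-only E∈ C D∈)))
            (when-congˡ (g E) (dec-true (erasedFrom? n (dmax E∈ C) E) (dmax-erased E∈ C)))
          column {E} E∈ (no ¬C) = ⨁-ε (𝒟max n I) λ {D} D∈ →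
            when-congˡ (g E) (dec-false (erasedFrom? n D E) (¬C ∘ erased-compatible D∈ E∈))

-- The sign

module Triangle {c ℓ} (M : CommutativeMonoid c ℓ) where

  open Fold M
  open CommutativeMonoid M renaming (refl to ≈-refl; sym to ≈-sym; trans to ≈-trans)
  open import Relation.Binary.Reasoning.Setoid setoid

  triangle : ∀ {m} (K : Fin m → Fin m → Carrier) → (∀ i → K i i ≈ ε) →
             ⨁ (allFin m) (λ i → ⨁ (allFin m) (K i)) ≈
             ⨁ (allFin m) (λ i → ⨁ (allFin m) (λ j → when (does (i Fin.<? j)) (K i j ∙ K j i)))
  triangle {m} K diagonal = begin
    ⨁ xs (λ i → ⨁ xs (K i))
      ≈⟨ ⨁-cong xs (λ i → ⨁-cong xs (split i)) ⟩
    ⨁ xs (λ i → ⨁ xs (λ j → when (does (i Fin.<? j)) (K i j) ∙ when (does (j Fin.<? i)) (K i j)))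
      ≈⟨ ⨁-cong xs (λ i → ⨁-∙ xs _ _) ⟩
    ⨁ xs (λ i → ⨁ xs (λ j → when (does (i Fin.<? j)) (K i j)) ∙ ⨁ xs (λ j → when (does (j Fin.<? i)) (K i j)))
      ≈⟨ ⨁-∙ xs _ _ ⟩
    ⨁ xs (λ i → ⨁ xs (λ j → when (does (i Fin.<? j)) (K i j))) ∙ ⨁ xs (λ i → ⨁ xs (λ j → when (does (j Fin.<? i)) (K i j)))
      ≈⟨ ∙-congˡ (⨁-swap xs xs _) ⟩
    ⨁ xs (λ i → ⨁ xs (λ j → when (does (i Fin.<? j)) (K i j))) ∙ ⨁ xs (λ j → ⨁ xs (λ i → when (does (j Fin.<? i)) (K i j)))
      ≈⟨ ⨁-∙ xs _ _ ⟨
    ⨁ xs (λ i → ⨁ xs (λ j → when (does (i Fin.<? j)) (K i j)) ∙ ⨁ xs (λ j → when (does (i Fin.<? j)) (K j i)))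
      ≈⟨ ⨁-cong xs (λ i → ⨁-∙ xs _ _) ⟨
    ⨁ xs (λ i → ⨁ xs (λ j → when (does (i Fin.<? j)) (K i j) ∙ when (does (i Fin.<? j)) (K j i)))
      ≈⟨ ⨁-cong xs (λ i → ⨁-cong xs (λ j → when-∙ (does (i Fin.<? j)) (K i j) (K j i))) ⟨
    ⨁ xs (λ i → ⨁ xs (λ j → when (does (i Fin.<? j)) (K i j ∙ K j i))) ∎
    where
    xs = allFin m
    split : ∀ i j → K i j ≈ when (does (i Fin.<? j)) (K i j) ∙ when (does (j Fin.<? i)) (K i j)
    split i j with Fin.<-cmp i j
    ... | tri< lt _ ¬gt rewrite dec-true (i Fin.<? j) lt | dec-false (j Fin.<? i) ¬gt = ≈-sym (identityʳ _)
    ... | tri≈ ¬lt refl ¬gt rewrite dec-false (i Fin.<? i) ¬lt = ≈-trans (diagonal i) (≈-sym (identityˡ ε))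
    ... | tri> ¬lt _ gt rewrite dec-false (i Fin.<? j) ¬lt | dec-true (j Fin.<? i) gt = ≈-sym (identityˡ _)

  -- This spreads the contribution of one crossing, an unordered pair of strands, over all pairs i <
  -- j, so that the crossings can be regrouped by pairs of strands.
  pair-single : ∀ {m} (x y : Fin m) → x ≢ y → (v : Fin m → Fin m → Carrier) → v x y ≈ v y x →
    ⨁ (allFin m) (λ i → ⨁ (allFin m) (λ j → when (does (i Fin.<? j))
      (when (does (((x Fin.≟ i) ×-dec (y Fin.≟ j)) ⊎-dec ((x Fin.≟ j) ×-dec (y Fin.≟ i)))) (v i j)))) ≈ v x y
  pair-single {m} x y x≢y v sym-v = cases (Fin.<-cmp x y)
    where
    hit? : ∀ i j → Dec ((x ≡ i × y ≡ j) ⊎ (x ≡ j × y ≡ i))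
    hit? i j = ((x Fin.≟ i) ×-dec (y Fin.≟ j)) ⊎-dec ((x Fin.≟ j) ×-dec (y Fin.≟ i))
    term : Fin m → Fin m → Carrier
    term i j = when (does (i Fin.<? j)) (when (does (hit? i j)) (v i j))
    zero-term : ∀ i j → ¬ (i Fin.< j × ((x ≡ i × y ≡ j) ⊎ (x ≡ j × y ≡ i))) → term i j ≈ ε
    zero-term i j miss = cases (i Fin.<? j)
      where
      cases : (d : Dec (i Fin.< j)) → when (does d) (when (does (hit? i j)) (v i j)) ≈ ε
      cases (no ¬lt) = ≈-refl
      cases (yes lt) = when-congˡ (v i j) (dec-false (hit? i j) (λ h → miss (lt , h)))
    one-term : ∀ i j → i Fin.< j → (x ≡ i × y ≡ j) ⊎ (x ≡ j × y ≡ i) → term i j ≈ v i j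
    one-term i j lt h = ≈-trans (when-congˡ _ (dec-true (i Fin.<? j) lt)) (when-congˡ _ (dec-true (hit? i j) h))
    located : ∀ a b → a Fin.< b → (∀ {i j} → i Fin.< j → (x ≡ i × y ≡ j) ⊎ (x ≡ j × y ≡ i) → i ≡ a × j ≡ b) →
              (x ≡ a × y ≡ b) ⊎ (x ≡ b × y ≡ a) → ⨁ (allFin m) (λ i → ⨁ (allFin m) (term i)) ≈ v a b
    located a b a<b only h = ≈-trans
      (⨁-single (Unique.allFin⁺ m) (∈-allFin a) λ {i} _ i≢a → ⨁-ε (allFin m) λ {j} _ → zero-term i j (i≢a ∘ proj₁ ∘ λ (lt , h) → only lt h))
      (≈-trans (⨁-single (Unique.allFin⁺ m) (∈-allFin b) λ {j} _ j≢b → zero-term a j (j≢b ∘ proj₂ ∘ λ (lt , h) → only lt h))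
               (one-term a b a<b h))
    cases : _ → ⨁ (allFin m) (λ i → ⨁ (allFin m) (term i)) ≈ v x y
    cases (tri< lt _ ¬gt) = located x y lt (λ { _ (inj₁ (refl , refl)) → refl , refl ; lt′ (inj₂ (refl , refl)) → contradiction lt′ ¬gt })
      (inj₁ (refl , refl))
    cases (tri≈ _ eq _) = contradiction eq x≢y
    cases (tri> ¬lt _ gt) = ≈-trans (located y x gt (λ { lt′ (inj₁ (refl , refl)) → contradiction lt′ ¬lt ; _ (inj₂ (refl , refl)) → refl , refl })
      (inj₂ (refl , refl))) (≈-sym sym-v)

module XorTriangle = Triangle (CommutativeRing.+-commutativeMonoid Bool.xor-∧-commutativeRing)
module XorCycles = Cycles (CommutativeRing.+-commutativeMonoid Bool.xor-∧-commutativeRing)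

exchange-involutive : ∀ {m} (a : Crossing m) p → exchange a (exchange a p) ≡ p
exchange-involutive a p = cases (p Fin.≟ upper a) (p Fin.≟ lower a)
  where
  on-u = transpose-fst (upper a) (lower a)
  on-l = transpose-snd (upper a) (lower a)
  cases : Dec (p ≡ upper a) → Dec (p ≡ lower a) → exchange a (exchange a p) ≡ p
  cases (yes e) _ = trans (cong (exchange a) (trans (cong (exchange a) e) on-u)) (trans on-l (sym e))
  cases (no _) (yes e) = trans (cong (exchange a) (trans (cong (exchange a) e) on-l)) (trans on-u (sym e))
  cases (no p≢u) (no p≢l) = trans (cong (exchange a) fix) fix
    where
    fix : exchange a p ≡ p
    fix = transpose-other (upper a) (lower a) p≢u p≢l

-- As u and l are adjacent, every other level lies on the same side of both, and only the order of
-- these two is reversed.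
exchange-order : ∀ {m} (a : Crossing m) {p q} → p ≢ q →
  does (p Fin.<? q) xor does (exchange a p Fin.<? exchange a q) ≡
  does (((upper a Fin.≟ p) ×-dec (lower a Fin.≟ q)) ⊎-dec ((upper a Fin.≟ q) ×-dec (lower a Fin.≟ p)))
exchange-order {m} a {p} {q} p≢q = cases (position p) (position q)
  where
  open Join a id
  hit? : Dec ((u ≡ p × l ≡ q) ⊎ (u ≡ q × l ≡ p))
  hit? = ((u Fin.≟ p) ×-dec (l Fin.≟ q)) ⊎-dec ((u Fin.≟ q) ×-dec (l Fin.≟ p))
  on-u : ∀ {x} → x ≡ u → exchange a x ≡ l
  on-u refl = transpose-fst u l
  on-l : ∀ {x} → x ≡ l → exchange a x ≡ u
  on-l refl = transpose-snd u l
  off-below : ∀ {x} → x Fin.< u → exchange a x ≡ x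
  off-below x<u = transpose-other u l (λ e → ℕ.<-irrefl (cong toℕ e) x<u) (λ e → ℕ.<-irrefl (cong toℕ e) (ℕ.<-trans x<u u<l))
  off-above : ∀ {x} → l Fin.< x → exchange a x ≡ x
  off-above l<x = transpose-other u l (λ e → ℕ.<-irrefl (cong toℕ (sym e)) (ℕ.<-trans u<l l<x)) (λ e → ℕ.<-irrefl (cong toℕ (sym e)) l<x)
  keep : ∀ {p′ q′} → exchange a p ≡ p′ → exchange a q ≡ q′ → (p Fin.< q → p′ Fin.< q′) → (p′ Fin.< q′ → p Fin.< q) →
         ¬ ((u ≡ p × l ≡ q) ⊎ (u ≡ q × l ≡ p)) → does (p Fin.<? q) xor does (exchange a p Fin.<? exchange a q) ≡ does hit?
  keep {p′} {q′} refl refl f g miss = trans (cong (does (p Fin.<? q) xor_) (sym (does-⇔ (p Fin.<? q) (p′ Fin.<? q′) f g)))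
    (trans (Bool.xor-same (does (p Fin.<? q))) (sym (dec-false hit? miss)))
  before : ∀ {p′ q′} → exchange a p ≡ p′ → exchange a q ≡ q′ → p Fin.< q → p′ Fin.< q′ →
           ¬ ((u ≡ p × l ≡ q) ⊎ (u ≡ q × l ≡ p)) → does (p Fin.<? q) xor does (exchange a p Fin.<? exchange a q) ≡ does hit?
  before e e′ lt lt′ = keep e e′ (λ _ → lt′) (λ _ → lt)
  after : ∀ {p′ q′} → exchange a p ≡ p′ → exchange a q ≡ q′ → q Fin.< p → q′ Fin.< p′ →
          ¬ ((u ≡ p × l ≡ q) ⊎ (u ≡ q × l ≡ p)) → does (p Fin.<? q) xor does (exchange a p Fin.<? exchange a q) ≡ does hit?
  after e e′ gt gt′ = keep e e′ (λ lt → contradiction lt (ℕ.<-asym gt)) (λ lt → contradiction lt (ℕ.<-asym gt′))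
  u≢below : ∀ {x} → x Fin.< u → u ≢ x
  u≢below x<u refl = ℕ.<-irrefl refl x<u
  l≢below : ∀ {x} → x Fin.< u → l ≢ x
  l≢below x<u refl = ℕ.<-asym x<u u<l
  u≢above : ∀ {x} → l Fin.< x → u ≢ x
  u≢above l<x refl = ℕ.<-asym l<x u<l
  l≢above : ∀ {x} → l Fin.< x → l ≢ x
  l≢above l<x refl = ℕ.<-irrefl refl l<x
  cases : Position p → Position q → does (p Fin.<? q) xor does (exchange a p Fin.<? exchange a q) ≡ does hit?
  cases (below x) (below y) = keep (off-below x) (off-below y) id id [ u≢below x ∘ proj₁ , u≢below y ∘ proj₁ ]′
  cases (below x) (at-u refl) = before (off-below x) (on-u refl) x (ℕ.<-trans x u<l) [ u≢below x ∘ proj₁ , l≢below x ∘ proj₂ ]′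
  cases (below x) (at-l refl) = before (off-below x) (on-l refl) (ℕ.<-trans x u<l) x [ u≢below x ∘ proj₁ , l≢below x ∘ proj₂ ]′
  cases (below x) (above y) = before (off-below x) (off-above y) (ℕ.<-trans x (ℕ.<-trans u<l y)) (ℕ.<-trans x (ℕ.<-trans u<l y))
    [ u≢below x ∘ proj₁ , l≢below x ∘ proj₂ ]′
  cases (at-u refl) (below y) = after (on-u refl) (off-below y) y (ℕ.<-trans y u<l) [ l≢below y ∘ proj₂ , u≢below y ∘ proj₁ ]′
  cases (at-u refl) (at-u refl) = contradiction refl p≢q
  cases (at-u refl) (at-l refl) = trans
    (cong₂ _xor_ (dec-true (u Fin.<? l) u<l) (trans (cong₂ (λ x y → does (x Fin.<? y)) (on-u refl) (on-l refl)) (dec-false (l Fin.<? u) (ℕ.<-asym u<l))))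
    (sym (dec-true hit? (inj₁ (refl , refl))))
  cases (at-u refl) (above y) = before (on-u refl) (off-above y) (ℕ.<-trans u<l y) y [ l≢above y ∘ proj₂ , u≢above y ∘ proj₁ ]′
  cases (at-l refl) (below y) = after (on-l refl) (off-below y) (ℕ.<-trans y u<l) y [ l≢below y ∘ proj₂ , u≢below y ∘ proj₁ ]′
  cases (at-l refl) (at-u refl) = trans
    (cong₂ _xor_ (dec-false (l Fin.<? u) (ℕ.<-asym u<l)) (trans (cong₂ (λ x y → does (x Fin.<? y)) (on-l refl) (on-u refl)) (dec-true (u Fin.<? l) u<l)))
    (sym (dec-true hit? (inj₂ (refl , refl))))
  cases (at-l refl) (at-l refl) = contradiction refl p≢q
  cases (at-l refl) (above y) = before (on-l refl) (off-above y) y (ℕ.<-trans u<l y) [ l≢above y ∘ proj₂ , u≢above y ∘ proj₁ ]′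
  cases (above x) (below y) = after (off-above x) (off-below y) (ℕ.<-trans y (ℕ.<-trans u<l x)) (ℕ.<-trans y (ℕ.<-trans u<l x))
    [ u≢above x ∘ proj₁ , l≢above x ∘ proj₂ ]′
  cases (above x) (at-u refl) = after (off-above x) (on-u refl) (ℕ.<-trans u<l x) x [ u≢above x ∘ proj₁ , l≢above x ∘ proj₂ ]′
  cases (above x) (at-l refl) = after (off-above x) (on-l refl) x (ℕ.<-trans u<l x) [ u≢above x ∘ proj₁ , l≢above x ∘ proj₂ ]′
  cases (above x) (above y) = keep (off-above x) (off-above y) id id [ u≢above x ∘ proj₁ , u≢above y ∘ proj₁ ]′

hit? : ∀ {m} (e : Fin m × Fin m) i j → Dec ((proj₁ e ≡ i × proj₂ e ≡ j) ⊎ (proj₁ e ≡ j × proj₂ e ≡ i))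
hit? (x , y) i j = ((x Fin.≟ i) ×-dec (y Fin.≟ j)) ⊎-dec ((x Fin.≟ j) ×-dec (y Fin.≟ i))

-- The level of the strand with a given left endpoint, inverse to strandsFrom.
levelsFrom : ∀ {m} → (Fin m → Fin m) → LeftHalf m → Fin m → Fin m
levelsFrom pos []      = pos
levelsFrom pos (a ∷ w) = levelsFrom (exchange a ∘ pos) w

record Inverses {m} (s pos : Fin m → Fin m) : Set where
  field
    s∘pos : ∀ i → s (pos i) ≡ i
    pos∘s : ∀ p → pos (s p) ≡ p

  s-injective : ∀ {p q} → s p ≡ s q → p ≡ q
  s-injective {p} {q} eq = trans (sym (pos∘s p)) (trans (cong pos eq) (pos∘s q))

  pos-injective : ∀ {i j} → pos i ≡ pos j → i ≡ j
  pos-injective {i} {j} eq = trans (sym (s∘pos i)) (trans (cong s eq) (s∘pos j))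

id-inverses : ∀ {m} → Inverses {m} id id
id-inverses = record { s∘pos = λ _ → refl ; pos∘s = λ _ → refl }

exchange-inverses : ∀ {m} (a : Crossing m) {s pos} → Inverses s pos → Inverses (s ∘ exchange a) (exchange a ∘ pos)
exchange-inverses a {s} {pos} inv = record
  { s∘pos = λ i → trans (cong s (exchange-involutive a (pos i))) (s∘pos i)
  ; pos∘s = λ p → trans (cong (exchange a) (pos∘s (exchange a p))) (exchange-involutive a p) }
  where open Inverses inv

levels-inverses : ∀ {m} (w : LeftHalf m) {s pos} → Inverses s pos → Inverses (strandsFrom s w) (levelsFrom pos w)
levels-inverses []      inv = inv
levels-inverses (a ∷ w) inv = levels-inverses w (exchange-inverses a inv)

crossed-distinct : ∀ {m} (w : LeftHalf m) {s pos} → Inverses s pos → All (λ (x , y) → x ≢ y) (crossedFrom s w)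
crossed-distinct []      inv = []
crossed-distinct (a ∷ w) inv =
  (λ e → Join.l≢u a id (sym (Inverses.s-injective inv e))) ∷ crossed-distinct w (exchange-inverses a inv)

-- Each crossing of the strands of i and j reverses their relative order and other crossings leave
-- it alone, so the parity of their crossings compares the order on the boundary with the order on
-- the axis.
crossings-flip : ∀ {m} (w : LeftHalf m) {s pos} → Inverses s pos → ∀ {i j} → i ≢ j →
  does (pos i Fin.<? pos j) xor does (levelsFrom pos w i Fin.<? levelsFrom pos w j) ≡
  Xor.⨁ (crossedFrom s w) (λ e → does (hit? e i j))
crossings-flip []      {pos = pos} inv {i} {j} i≢j = Bool.xor-same (does (pos i Fin.<? pos j))
crossings-flip (a ∷ w) {s} {pos} inv {i} {j} i≢j = begin
  -- The order y after the first crossing is inserted twice.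
  x xor z                    ≡⟨ cong (_xor z) (sym (trans (cong (x xor_) (Bool.xor-same y)) (xor-false x))) ⟩
  (x xor (y xor y)) xor z    ≡⟨ cong (_xor z) (sym (Bool.xor-assoc x y y)) ⟩
  ((x xor y) xor y) xor z    ≡⟨ Bool.xor-assoc (x xor y) y z ⟩
  (x xor y) xor (y xor z)    ≡⟨ cong₂ _xor_ first (crossings-flip w (exchange-inverses a inv) i≢j) ⟩
  Xor.⨁ (crossedFrom s (a ∷ w)) (λ e → does (hit? e i j)) ∎
  where
  open ≡-Reasoning
  open Inverses inv
  x = does (pos i Fin.<? pos j)
  y = does (exchange a (pos i) Fin.<? exchange a (pos j))
  z = does (levelsFrom pos (a ∷ w) i Fin.<? levelsFrom pos (a ∷ w) j)
  xor-false : ∀ x → x xor false ≡ x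
  xor-false false = refl
  xor-false true  = refl
  at : ∀ {p k} → p ≡ pos k → s p ≡ k
  at refl = s∘pos _
  at⁻ : ∀ {p k} → s p ≡ k → p ≡ pos k
  at⁻ refl = sym (pos∘s _)
  first : x xor y ≡ does (hit? (s (upper a) , s (lower a)) i j)
  first = trans (exchange-order a (i≢j ∘ pos-injective)) (does-⇔ (hit? (upper a , lower a) (pos i) (pos j)) (hit? (s (upper a) , s (lower a)) i j)
    (Sum.map (Product.map at at) (Product.map at at)) (Sum.map (Product.map at⁻ at⁻) (Product.map at⁻ at⁻)))

AllPairs-++ : ∀ {a r} {A : Set a} {R : Rel A r} xs {ys} → AllPairs R (xs ++ ys) → ∀ {x y} → x ∈ˡ xs → y ∈ˡ ys → R x y
AllPairs-++ (x ∷ xs) (r ∷ rs) (here refl) y∈ = All.lookup r (∈-++⁺ʳ xs y∈)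
AllPairs-++ (x ∷ xs) (r ∷ rs) (there x∈)  y∈ = AllPairs-++ xs rs x∈ y∈

-- Regrouped by pairs of strands, crossings matter only modulo 2, and modulo 2 a pair of strands
-- crosses exactly if it is inverted on the axis. So the sign depends only on the order in which the
-- strands arrive there.
sameCrossings-pairs : ∀ {m} (χ : Fin m → Bool) (w : LeftHalf m) → let pos = levelsFrom id w in
  sameCrossings χ (crossedFrom id w) ≡
  Xor.⨁ (allFin m) (λ i → Xor.⨁ (allFin m) (λ j →
    does (i Fin.<? j) ∧ (same (χ i) (χ j) ∧ does (pos j Fin.<? pos i))))
sameCrossings-pairs {m} χ w = begin
  Xor.⨁ es (λ (x , y) → same (χ x) (χ y))
    ≡⟨ Xor.⨁-cong∈ es (λ {e} e∈ → XorTriangle.pair-single (proj₁ e) (proj₂ e) (All.lookup (crossed-distinct w id-inverses) e∈)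
         (λ i j → same (χ i) (χ j)) (same-sym (χ (proj₁ e)) (χ (proj₂ e)))) ⟨
  Xor.⨁ es (λ e → Xor.⨁ xs (λ i → Xor.⨁ xs (λ j → term e i j)))
    ≡⟨ Xor.⨁-swap es xs (λ e i → Xor.⨁ xs (λ j → term e i j)) ⟩
  Xor.⨁ xs (λ i → Xor.⨁ es (λ e → Xor.⨁ xs (λ j → term e i j)))
    ≡⟨ Xor.⨁-cong xs (λ i → Xor.⨁-swap es xs (λ e j → term e i j)) ⟩
  Xor.⨁ xs (λ i → Xor.⨁ xs (λ j → Xor.⨁ es (λ e → term e i j)))
    ≡⟨ Xor.⨁-cong xs (λ i → Xor.⨁-cong xs (λ j → pointwise i j (i Fin.<? j))) ⟩
  Xor.⨁ xs (λ i → Xor.⨁ xs (λ j → does (i Fin.<? j) ∧ (same (χ i) (χ j) ∧ does (pos j Fin.<? pos i)))) ∎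
  where
  open ≡-Reasoning
  xs = allFin m
  es = crossedFrom id w
  pos = levelsFrom id w
  same-sym : ∀ x y → same x y ≡ same y x
  same-sym x y = does-⇔ (x Bool.≟ y) (y Bool.≟ x) sym sym
  term : Fin m × Fin m → Fin m → Fin m → Bool
  term e i j = Xor.when (does (i Fin.<? j)) (Xor.when (does (hit? e i j)) (same (χ i) (χ j)))
  ∧-⨁ : ∀ c g → Xor.⨁ es (λ e → Xor.when (g e) c) ≡ c ∧ Xor.⨁ es g
  ∧-⨁ true  g = Xor.⨁-cong es (λ e → when-true (g e))
    where
    when-true : ∀ b → Xor.when b true ≡ b
    when-true true  = refl
    when-true false = refl
  ∧-⨁ false g = Xor.⨁-ε es (λ {e} _ → Xor.when-ε (g e))
  pointwise : ∀ i j → (d : Dec (i Fin.< j)) → Xor.⨁ es (λ e → Xor.when (does d) (Xor.when (does (hit? e i j)) (same (χ i) (χ j)))) ≡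
              does d ∧ (same (χ i) (χ j) ∧ does (pos j Fin.<? pos i))
  pointwise i j (no _)   = Xor.⨁-ε es (λ _ → refl)
  pointwise i j (yes lt) = trans (∧-⨁ (same (χ i) (χ j)) (λ e → does (hit? e i j))) (cong (same (χ i) (χ j) ∧_)
    (trans (sym (crossings-flip w id-inverses i≢j)) (trans (cong (_xor does (pos i Fin.<? pos j)) (dec-true (i Fin.<? j) lt)) flipped)))
    where
    i≢j : i ≢ j
    i≢j e = ℕ.<-irrefl (cong toℕ e) lt
    flipped : not (does (pos i Fin.<? pos j)) ≡ does (pos j Fin.<? pos i)
    flipped with Fin.<-cmp (pos i) (pos j)
    ... | tri< lt′ _ ¬gt = trans (cong not (dec-true (pos i Fin.<? pos j) lt′)) (sym (dec-false (pos j Fin.<? pos i) ¬gt))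
    ... | tri≈ _ eq _ = contradiction (Inverses.pos-injective (levels-inverses w id-inverses) eq) i≢j
    ... | tri> ¬lt _ gt = trans (cong not (dec-false (pos i Fin.<? pos j) ¬lt)) (sym (dec-true (pos j Fin.<? pos i) gt))

does-<-not : ∀ {m} {x y : Fin m} → x ≢ y → does (x Fin.<? y) ≡ not (does (y Fin.<? x))
does-<-not {x = x} {y} x≢y with Fin.<-cmp x y
... | tri< lt _ ¬gt = trans (dec-true (x Fin.<? y) lt) (cong not (sym (dec-false (y Fin.<? x) ¬gt)))
... | tri≈ _ eq _ = contradiction eq x≢y
... | tri> ¬lt _ gt = trans (dec-false (x Fin.<? y) ¬lt) (cong not (sym (dec-true (y Fin.<? x) gt)))

-- The parity of equally coloured crossings in a nice embedding

module NiceSign (n : ℕ) (π : Pairing (n ℕ.* 2)) (matching : IsMatching π) (w : LeftHalf (n ℕ.* 2))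
                (nice : IsNiceEmbedding n π w) where

  open IsNiceEmbedding nice

  private
    N = n ℕ.* 2

  s pos ρ : Fin N → Fin N
  s   = strandsFrom id w
  pos = levelsFrom id w
  ρ   = lookup π

  open Inverses (levels-inverses w (id-inverses {N}))

  ρ-involutive : ∀ i → ρ (ρ i) ≡ i
  ρ-involutive i = proj₂ (matching i)

  ρ-free : ∀ i → ρ i ≢ i
  ρ-free i = proj₁ (matching i)

  ρ-injective : ∀ {i j} → ρ i ≡ ρ j → i ≡ j
  ρ-injective {i} {j} eq = trans (sym (ρ-involutive i)) (trans (cong ρ eq) (ρ-involutive j))

  ρ-s : ∀ (k : Fin n) (b : Fin 2) → ρ (s (combine k b)) ≡ s (combine k (opposite b))
  ρ-s k zero       = drawsν k
  ρ-s k (suc zero) = trans (cong ρ (sym (drawsν k))) (ρ-involutive _)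

  -- The index of the axis crossing where the strand of i meets the mirror image of its partner; the
  -- strands of i and ρ i arrive there at neighbouring levels.
  block : Fin N → Fin n
  block i = proj₁ (remQuot {n} 2 (pos i))

  private
    half : Fin N → Fin 2
    half i = proj₂ (remQuot {n} 2 (pos i))

  pos-combine : ∀ i → pos i ≡ combine (block i) (half i)
  pos-combine i = sym (Fin.combine-remQuot {n} 2 (pos i))

  s-combine : ∀ i → s (combine (block i) (half i)) ≡ i
  s-combine i = trans (cong s (sym (pos-combine i))) (s∘pos i)

  pos-ρ : ∀ i → pos (ρ i) ≡ combine (block i) (opposite (half i))
  pos-ρ i = trans (cong (pos ∘ ρ) (sym (s-combine i))) (trans (cong pos (ρ-s (block i) (half i))) (pos∘s _))

  block-ρ : ∀ i → block (ρ i) ≡ block i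
  block-ρ i = cong proj₁ (trans (cong (remQuot 2) (pos-ρ i)) (Fin.remQuot-combine (block i) (opposite (half i))))

  block-< : ∀ {i j} → block i Fin.< block j → pos i Fin.< pos j
  block-< {i} {j} lt = subst₂ Fin._<_ (sym (pos-combine i)) (sym (pos-combine j)) (Fin.combine-monoˡ-< (half i) (half j) lt)

  block-≡ : ∀ {i j} → block i ≡ block j → j ≡ i ⊎ j ≡ ρ i
  block-≡ {i} {j} eq = Sum.map
    (λ h → pos-injective (trans (pos-combine j) (trans (cong₂ combine (sym eq) h) (sym (pos-combine i)))))
    (λ h → pos-injective (trans (pos-combine j) (trans (cong₂ combine (sym eq) h) (sym (pos-ρ i)))))
    (halves (half i) (half j))
    where
    halves : ∀ (b b′ : Fin 2) → b′ ≡ b ⊎ b′ ≡ opposite b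
    halves zero       zero       = inj₁ refl
    halves zero       (suc zero) = inj₂ refl
    halves (suc zero) zero       = inj₂ refl
    halves (suc zero) (suc zero) = inj₁ refl

  monochrome⁺ : ∀ {χ : Fin N → Bool} → (∀ k → χ (s (axisUpper n k)) ≡ χ (s (axisLower n k))) → ∀ i → χ i ≡ χ (ρ i)
  monochrome⁺ {χ} mono i = subst (λ i → χ i ≡ χ (ρ i)) (s-combine i) (trans (at (half i)) (cong χ (sym (ρ-s (block i) (half i)))))
    where
    at : ∀ (b : Fin 2) → χ (s (combine (block i) b)) ≡ χ (s (combine (block i) (opposite b)))
    at zero       = mono (block i)
    at (suc zero) = sym (mono (block i))

  monochrome⁻ : ∀ {χ : Fin N → Bool} → (∀ i → χ i ≡ χ (ρ i)) → ∀ k → χ (s (axisUpper n k)) ≡ χ (s (axisLower n k))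
  monochrome⁻ {χ} mono k = trans (mono (s (axisUpper n k))) (cong χ (drawsν k))

  -- A strand and the mirror image of its partner already meet on the axis.
  ordered : ∀ {i} → i Fin.< ρ i → pos i Fin.< pos (ρ i)
  ordered {i} lt = does-true (pos i Fin.<? pos (ρ i)) (Bool.not-injective
    (trans (sym (cong (_xor does (pos i Fin.<? pos (ρ i))) (dec-true (i Fin.<? ρ i) lt)))
      (trans (crossings-flip w id-inverses (ρ-free i ∘ sym)) (Xor.⨁-ε (crossedFrom id w) λ {e} e∈ → dec-false (hit? e i (ρ i)) (missed e∈)))))
    where
    axisPairs mirrored : List (Fin N × Fin N)
    axisPairs = map (λ k → s (axisUpper n k) , s (axisLower n k)) (allFin n)
    mirrored  = map (Product.map ρ ρ) (crossedFrom id w)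
    distinct : ∀ {e f} → e ∈ˡ crossedFrom id w → f ∈ˡ axisPairs → e ≢ f × e ≢ swap f
    distinct e∈ f∈ = AllPairs-++ (crossedFrom id w) meetOnce e∈ (∈-++⁺ˡ f∈)
    on-axis : ∃ λ f → f ∈ˡ axisPairs × (f ≡ (i , ρ i) ⊎ f ≡ (ρ i , i))
    on-axis = _ , ∈-map⁺ _ (∈-allFin (block i)) , cases (half i) (s-combine i)
      where
      cases : ∀ (b : Fin 2) → s (combine (block i) b) ≡ i → let f = (s (axisUpper n (block i)) , s (axisLower n (block i))) in
              f ≡ (i , ρ i) ⊎ f ≡ (ρ i , i)
      cases zero       e = inj₁ (cong₂ _,_ e (trans (sym (drawsν (block i))) (cong ρ e)))
      cases (suc zero) e = inj₂ (cong₂ _,_ (trans (sym (ρ-involutive _)) (cong ρ (trans (drawsν (block i)) e))) e)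
    missed : ∀ {e} → e ∈ˡ crossedFrom id w → ¬ ((proj₁ e ≡ i × proj₂ e ≡ ρ i) ⊎ (proj₁ e ≡ ρ i × proj₂ e ≡ i))
    missed e∈ hit with on-axis
    missed e∈ (inj₁ (refl , refl)) | _ , f∈ , inj₁ refl = proj₁ (distinct e∈ f∈) refl
    missed e∈ (inj₁ (refl , refl)) | _ , f∈ , inj₂ refl = proj₂ (distinct e∈ f∈) refl
    missed e∈ (inj₂ (refl , refl)) | _ , f∈ , inj₁ refl = proj₂ (distinct e∈ f∈) refl
    missed e∈ (inj₂ (refl , refl)) | _ , f∈ , inj₂ refl = proj₁ (distinct e∈ f∈) refl

  module _ (χ : Fin N → Bool) (mono : ∀ i → χ i ≡ χ (ρ i)) where

    -- `G` marks the equally coloured inversions of strands. `K` collects the four that can occur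
    -- between the ends of two arcs, and `K′` counts each arc once, at its smaller end.
    G K K′ : Fin N → Fin N → Bool
    G i j  = does (i Fin.<? j) ∧ (same (χ i) (χ j) ∧ does (pos j Fin.<? pos i))
    K i j  = (G i j xor G (ρ i) j) xor (G i (ρ j) xor G (ρ i) (ρ j))
    K′ i j = Xor.when (does (i Fin.<? ρ i)) (Xor.when (does (j Fin.<? ρ j)) (K i j))

    G-value : ∀ {x y c b b′} → does (x Fin.<? y) ≡ b → same (χ x) (χ y) ≡ c → does (pos y Fin.<? pos x) ≡ b′ → G x y ≡ b ∧ (c ∧ b′)
    G-value refl refl refl = refl

    xs = allFin N

    G-arcs : Xor.⨁ xs (λ i → Xor.⨁ xs (G i)) ≡ Xor.⨁ xs (λ i → Xor.⨁ xs (K′ i))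
    G-arcs = begin
      Xor.⨁ xs (λ i → Xor.⨁ xs (G i))
        ≡⟨ XorCycles.cycles ρ ρ-involutive ρ-free (λ i → Xor.⨁ xs (G i)) ⟩
      Xor.⨁ xs (λ i → Xor.when (does (i Fin.<? ρ i)) (Xor.⨁ xs (G i) xor Xor.⨁ xs (G (ρ i))))
        ≡⟨ Xor.⨁-cong xs (λ i → Xor.when-congʳ (does (i Fin.<? ρ i)) (sym (Xor.⨁-∙ xs (G i) (G (ρ i))))) ⟩
      Xor.⨁ xs (λ i → Xor.when (does (i Fin.<? ρ i)) (Xor.⨁ xs (λ j → G i j xor G (ρ i) j)))
        ≡⟨ Xor.⨁-cong xs (λ i → Xor.when-congʳ (does (i Fin.<? ρ i))
             (XorCycles.cycles ρ ρ-involutive ρ-free (λ j → G i j xor G (ρ i) j))) ⟩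
      Xor.⨁ xs (λ i → Xor.when (does (i Fin.<? ρ i)) (Xor.⨁ xs (λ j → Xor.when (does (j Fin.<? ρ j)) (K i j))))
        ≡⟨ Xor.⨁-cong xs (λ i → Xor.⨁-when (does (i Fin.<? ρ i)) xs (λ j → Xor.when (does (j Fin.<? ρ j)) (K i j))) ⟩
      Xor.⨁ xs (λ i → Xor.⨁ xs (K′ i)) ∎
      where open ≡-Reasoning

    -- Within a single arc the only possible inversion is that of its two ends, excluded by
    -- `ordered`.
    K′-diagonal : ∀ i → K′ i i ≡ false
    K′-diagonal i = cases (i Fin.<? ρ i)
      where
      irr : ∀ x → does (x Fin.<? x) ≡ false
      irr x = dec-false (x Fin.<? x) (ℕ.<-irrefl refl)
      cases : (d : Dec (i Fin.< ρ i)) → Xor.when (does d) (Xor.when (does d) (K i i)) ≡ false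
      cases (no _)   = refl
      cases (yes lt) = cong₂ _xor_
        (cong₂ _xor_ (G-value {i} {i} (irr i) refl refl) (G-value {ρ i} {i} (dec-false (ρ i Fin.<? i) (ℕ.<-asym lt)) refl refl))
        (cong₂ _xor_ (trans (G-value {i} {ρ i} (dec-true (i Fin.<? ρ i) lt) refl (dec-false (pos (ρ i) Fin.<? pos i) (ℕ.<-asym (ordered lt))))
                            (Bool.∧-zeroʳ (same (χ i) (χ (ρ i)))))
                     (G-value {ρ i} {ρ i} (irr (ρ i)) refl refl))

    -- The order P in which the two arcs reach the axis does not affect the parity.
    inversions : ∀ c P A B → (B ≡ true → A ≡ true) →
      (((true ∧ (c ∧ P)) xor (not A ∧ (c ∧ P))) xor ((true ∧ (c ∧ P)) xor (not B ∧ (c ∧ P)))) xor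
      (((false ∧ (c ∧ not P)) xor (false ∧ (c ∧ not P))) xor ((A ∧ (c ∧ not P)) xor (B ∧ (c ∧ not P))))
      ≡ c ∧ (A ∧ not B)
    inversions false false false false _ = refl
    inversions false false false true  _ = refl
    inversions false false true  false _ = refl
    inversions false false true  true  _ = refl
    inversions false true  false false _ = refl
    inversions false true  false true  _ = refl
    inversions false true  true  false _ = refl
    inversions false true  true  true  _ = refl
    inversions true  P     false true  B⇒A with () ← B⇒A refl
    inversions true  false false false _ = refl
    inversions true  false true  false _ = refl
    inversions true  false true  true  _ = refl
    inversions true  true  false false _ = refl
    inversions true  true  true  false _ = refl
    inversions true  true  true  true  _ = refl

    -- The two arcs arrive in different blocks, so one Boolean P decides the order on the axis for
    -- all four pairs of ends; the boundary order is given by A and B, the positions of j and ρ j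
    -- relative to ρ i. The arcs cross when A holds and B fails, and `inversions` is the resulting
    -- truth table.
    crossing-arcs : ∀ {i j} → i Fin.< j → i Fin.< ρ i → j Fin.< ρ j →
      K i j xor K j i ≡ same (χ i) (χ j) ∧ does (cross? π (i , j))
    crossing-arcs {i} {j} i<j i<ρi j<ρj = trans
      (cong₂ _xor_
        (cong₂ _xor_ (cong₂ _xor_ (G-value (dec-true (i Fin.<? j) i<j) refl (P-rev refl refl))
                                  (G-value (does-<-not ρi≢j) (colours (sym (mono i)) refl) (P-rev (block-ρ i) refl)))
                     (cong₂ _xor_ (G-value (dec-true (i Fin.<? ρ j) (ℕ.<-trans i<j j<ρj)) (colours refl (sym (mono j))) (P-rev refl (block-ρ j)))
                                  (G-value (does-<-not (i≢j ∘ ρ-injective)) (colours (sym (mono i)) (sym (mono j))) (P-rev (block-ρ i) (block-ρ j)))))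
        (cong₂ _xor_ (cong₂ _xor_ (G-value (dec-false (j Fin.<? i) (ℕ.<-asym i<j)) (colours′ refl refl) (P-fwd refl refl))
                                  (G-value (dec-false (ρ j Fin.<? i) (ℕ.<-asym (ℕ.<-trans i<j j<ρj))) (colours′ refl (sym (mono j))) (P-fwd refl (block-ρ j))))
                     (cong₂ _xor_ (G-value refl (colours′ (sym (mono i)) refl) (P-fwd (block-ρ i) refl))
                                  (G-value refl (colours′ (sym (mono i)) (sym (mono j))) (P-fwd (block-ρ i) (block-ρ j))))))
      (trans (inversions c P A B B⇒A) (cong (c ∧_) (trans (cong (A ∧_) (sym (does-<-not (i≢j ∘ ρ-injective))))
        (cong (_∧ (A ∧ does (ρ i Fin.<? ρ j))) (sym (dec-true (i Fin.<? j) i<j))))))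
      where
      c = same (χ i) (χ j)
      P = does (block j Fin.<? block i)
      A = does (j Fin.<? ρ i)
      B = does (ρ j Fin.<? ρ i)
      i≢j : i ≢ j
      i≢j e = ℕ.<-irrefl (cong toℕ e) i<j
      ρi≢j : ρ i ≢ j
      ρi≢j e = ℕ.<-asym (subst (j Fin.<_) (trans (cong ρ (sym e)) (ρ-involutive i)) j<ρj) i<j
      B⇒A : B ≡ true → A ≡ true
      B⇒A e = dec-true (j Fin.<? ρ i) (ℕ.<-trans j<ρj (does-true (ρ j Fin.<? ρ i) e))
      block≢ : block i ≢ block j
      block≢ e = [ i≢j ∘ sym , ρi≢j ∘ sym ]′ (block-≡ e)
      colours : ∀ {x y} → χ x ≡ χ i → χ y ≡ χ j → same (χ x) (χ y) ≡ c
      colours = cong₂ same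
      colours′ : ∀ {x y} → χ x ≡ χ i → χ y ≡ χ j → same (χ y) (χ x) ≡ c
      colours′ {x} {y} ex ey = trans (cong₂ same ey ex) (does-⇔ (χ j Bool.≟ χ i) (χ i Bool.≟ χ j) sym sym)
      P-rev : ∀ {x y} → block x ≡ block i → block y ≡ block j → does (pos y Fin.<? pos x) ≡ P
      P-rev {x} {y} ex ey with Fin.<-cmp (block j) (block i)
      ... | tri< lt _ _ = trans (dec-true (pos y Fin.<? pos x) (block-< (subst₂ Fin._<_ (sym ey) (sym ex) lt)))
                                (sym (dec-true (block j Fin.<? block i) lt))
      ... | tri≈ _ e _ = contradiction (sym e) block≢
      ... | tri> ¬lt _ gt = trans (dec-false (pos y Fin.<? pos x) (ℕ.<-asym (block-< (subst₂ Fin._<_ (sym ex) (sym ey) gt))))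
                                  (sym (dec-false (block j Fin.<? block i) ¬lt))
      P-fwd : ∀ {x y} → block x ≡ block i → block y ≡ block j → does (pos x Fin.<? pos y) ≡ not P
      P-fwd {x} {y} ex ey = trans (does-<-not (λ e → block≢ (trans (sym ex) (trans (cong block (pos-injective e)) ey)))) (cong not (P-rev ex ey))

    K′-cross : ∀ i j → Xor.when (does (i Fin.<? j)) (K′ i j xor K′ j i) ≡ same (χ i) (χ j) ∧ does (cross? π (i , j))
    K′-cross i j = cases (i Fin.<? j) (i Fin.<? ρ i) (j Fin.<? ρ j)
      where
      uncrossed : ¬ Cross π (i , j) → false ≡ same (χ i) (χ j) ∧ does (cross? π (i , j))
      uncrossed ¬cr = sym (trans (cong (same (χ i) (χ j) ∧_) (dec-false (cross? π (i , j)) ¬cr)) (Bool.∧-zeroʳ _))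
      cases : (d : Dec (i Fin.< j)) (d₁ : Dec (i Fin.< ρ i)) (d₂ : Dec (j Fin.< ρ j)) →
        Xor.when (does d) (Xor.when (does d₁) (Xor.when (does d₂) (K i j)) xor Xor.when (does d₂) (Xor.when (does d₁) (K j i)))
        ≡ same (χ i) (χ j) ∧ does (cross? π (i , j))
      cases (no ¬lt) _ _ = uncrossed (¬lt ∘ proj₁)
      cases (yes lt) (no ¬lt) d₂ = trans (Xor.when-ε (does d₂)) (uncrossed λ (lt , lt′ , _) → ¬lt (ℕ.<-trans lt lt′))
      cases (yes lt) (yes lt₁) (no ¬lt) = uncrossed λ (_ , lt , lt′) → ¬lt (ℕ.<-trans lt lt′)
      cases (yes lt) (yes lt₁) (yes lt₂) = crossing-arcs lt lt₁ lt₂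

    sign : sameCrossings χ (crossedFrom id w) ≡
           Xor.⨁ xs (λ i → Xor.⨁ xs (λ j → same (χ i) (χ j) ∧ does (cross? π (i , j))))
    sign = trans (sameCrossings-pairs χ w) (trans G-arcs (trans (XorTriangle.triangle K′ K′-diagonal)
      (Xor.⨁-cong xs λ i → Xor.⨁-cong xs (K′-cross i))))

-- Products of two pfaffians

-- The two colour classes as images of increasing maps. Monotonicity makes restriction to a class
-- preserve both the orientation of edges and their crossings.
record Splitting {m} (χ : Fin m → Bool) (a b : ℕ) : Set where
  field
    e₁   : Fin a → Fin m
    e₂   : Fin b → Fin m
    loc  : Fin m → Fin a ⊎ Fin b
    mono₁ : ∀ {i j} → i Fin.< j → e₁ i Fin.< e₁ j
    mono₂ : ∀ {i j} → i Fin.< j → e₂ i Fin.< e₂ j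
    loc-e₁ : ∀ i → loc (e₁ i) ≡ inj₁ i
    loc-e₂ : ∀ j → loc (e₂ j) ≡ inj₂ j
    e-loc : ∀ p → [ e₁ , e₂ ]′ (loc p) ≡ p
    χ-e₁ : ∀ i → χ (e₁ i) ≡ true
    χ-e₂ : ∀ j → χ (e₂ j) ≡ false

  data Located : Fin m → Set where
    in₁ : ∀ i → Located (e₁ i)
    in₂ : ∀ j → Located (e₂ j)

  located : ∀ p → Located p
  located p = subst Located (e-loc p) (at (loc p))
    where
    at : ∀ x → Located ([ e₁ , e₂ ]′ x)
    at (inj₁ i) = in₁ i
    at (inj₂ j) = in₂ j

  e₁-injective : ∀ {i j} → e₁ i ≡ e₁ j → i ≡ j
  e₁-injective {i} {j} eq with refl ← trans (sym (loc-e₁ i)) (trans (cong loc eq) (loc-e₁ j)) = refl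

  e₂-injective : ∀ {i j} → e₂ i ≡ e₂ j → i ≡ j
  e₂-injective {i} {j} eq with refl ← trans (sym (loc-e₂ i)) (trans (cong loc eq) (loc-e₂ j)) = refl

  e₁≢e₂ : ∀ {i j} → e₁ i ≢ e₂ j
  e₁≢e₂ {i} {j} eq with () ← trans (sym (loc-e₁ i)) (trans (cong loc eq) (loc-e₂ j))

strict-mono⁻ : ∀ {a m} {e : Fin a → Fin m} → (∀ {i j} → i Fin.< j → e i Fin.< e j) → ∀ {i j} → e i Fin.< e j → i Fin.< j
strict-mono⁻ mono {i} {j} lt with Fin.<-cmp i j
... | tri< i<j _ _ = i<j
... | tri≈ _ refl _ = contradiction lt (ℕ.<-irrefl refl)
... | tri> _ _ j<i = contradiction lt (ℕ.<-asym (mono j<i))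

splitting : ∀ {m} (I : Subset m) → Splitting (lookup I) ∣ I ∣ ∣ ∁ I ∣
splitting I = record
  { e₁ = lookup (members I) ; e₂ = lookup (members (∁ I)) ; loc = loc I
  ; mono₁ = λ {i} {j} → mono I {i} {j} ; mono₂ = λ {i} {j} → mono (∁ I) {i} {j} ; loc-e₁ = loc₁ I ; loc-e₂ = loc₂ I ; e-loc = e-loc I
  ; χ-e₁ = member I
  ; χ-e₂ = λ j → Bool.not-injective (trans (sym (Vec.lookup-map (lookup (members (∁ I)) j) not I)) (member (∁ I) j)) }
  where
  suc-lookup : ∀ {k m} (v : Vec (Fin m) k) i → lookup (Vec.map suc v) i ≡ suc (lookup v i)
  suc-lookup v i = Vec.lookup-map i suc v
  member : ∀ {m} (I : Subset m) i → lookup I (lookup (members I) i) ≡ true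
  member (true ∷ I) zero = refl
  member (true ∷ I) (suc i) = trans (cong (lookup (true ∷ I)) (suc-lookup (members I) i)) (member I i)
  member (false ∷ I) i = trans (cong (lookup (false ∷ I)) (suc-lookup (members I) i)) (member I i)
  mono : ∀ {m} (I : Subset m) {i j} → i Fin.< j → lookup (members I) i Fin.< lookup (members I) j
  mono (true ∷ I) {zero} {suc j} _ = subst (λ q → 0 ℕ.< toℕ q) (sym (suc-lookup (members I) j)) (s≤s z≤n)
  mono (true ∷ I) {suc i} {suc j} (s≤s lt) =
    subst₂ Fin._<_ (sym (suc-lookup (members I) i)) (sym (suc-lookup (members I) j)) (s≤s (mono I lt))
  mono (false ∷ I) {i} {j} lt =
    subst₂ Fin._<_ (sym (suc-lookup (members I) i)) (sym (suc-lookup (members I) j)) (s≤s (mono I lt))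
  loc : ∀ {m} (I : Subset m) → Fin m → Fin ∣ I ∣ ⊎ Fin ∣ ∁ I ∣
  loc (true  ∷ I) zero    = inj₁ zero
  loc (false ∷ I) zero    = inj₂ zero
  loc (true  ∷ I) (suc p) = Sum.map₁ suc (loc I p)
  loc (false ∷ I) (suc p) = Sum.map₂ suc (loc I p)
  loc₁ : ∀ {m} (I : Subset m) i → loc I (lookup (members I) i) ≡ inj₁ i
  loc₁ (true ∷ I) zero = refl
  loc₁ (true ∷ I) (suc i) = trans (cong (loc (true ∷ I)) (suc-lookup (members I) i)) (cong (Sum.map₁ suc) (loc₁ I i))
  loc₁ (false ∷ I) i = trans (cong (loc (false ∷ I)) (suc-lookup (members I) i)) (cong (Sum.map₂ suc) (loc₁ I i))
  loc₂ : ∀ {m} (I : Subset m) j → loc I (lookup (members (∁ I)) j) ≡ inj₂ j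
  loc₂ (false ∷ I) zero = refl
  loc₂ (false ∷ I) (suc i) = trans (cong (loc (false ∷ I)) (suc-lookup (members (∁ I)) i)) (cong (Sum.map₂ suc) (loc₂ I i))
  loc₂ (true ∷ I) i = trans (cong (loc (true ∷ I)) (suc-lookup (members (∁ I)) i)) (cong (Sum.map₁ suc) (loc₂ I i))
  e-loc : ∀ {m} (I : Subset m) p → [ lookup (members I) , lookup (members (∁ I)) ]′ (loc I p) ≡ p
  e-loc (true  ∷ I) zero = refl
  e-loc (false ∷ I) zero = refl
  e-loc (true ∷ I) (suc p) with loc I p | e-loc I p
  ... | inj₁ i | eq = trans (suc-lookup (members I) i) (cong suc eq)
  ... | inj₂ j | eq = trans (suc-lookup (members (∁ I)) j) (cong suc eq)
  e-loc (false ∷ I) (suc p) with loc I p | e-loc I p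
  ... | inj₁ i | eq = trans (suc-lookup (members I) i) (cong suc eq)
  ... | inj₂ j | eq = trans (suc-lookup (members (∁ I)) j) (cong suc eq)

∈-matchings⁺ : ∀ {m} {π : Pairing m} → IsMatching π → π ∈ˡ matchings m
∈-matchings⁺ {π = π} = ∈-filter⁺ isMatching? {x = π} (∈-pairings π)

∈-matchings⁻ : ∀ {m} {π : Pairing m} → π ∈ˡ matchings m → IsMatching π
∈-matchings⁻ {m} {π} π∈ = proj₂ (∈-filter⁻ isMatching? {v = π} {xs = vectors (allFin m) m} π∈)

matchings-unique : ∀ m → Unique (matchings m)
matchings-unique m = Unique.filter⁺ isMatching? (vectors-unique (Unique.allFin⁺ m) m)

Monochrome : ∀ {m} → (Fin m → Bool) → Pairing m → Set
Monochrome χ π = ∀ i → χ i ≡ χ (lookup π i)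

monochrome? : ∀ {m} χ → Decidable (Monochrome {m} χ)
monochrome? χ π = Fin.all? λ i → χ i Bool.≟ χ (lookup π i)

crossings : ∀ {m} → (Fin m → Bool) → Pairing m → Bool
crossings {m} χ π = Xor.⨁ (allFin m) (λ i → Xor.⨁ (allFin m) (λ j → same (χ i) (χ j) ∧ does (cross? π (i , j))))

par-cn : ∀ {m} (π : Pairing m) → par (cn π) ≡ Xor.⨁ (allFin m) (λ i → Xor.⨁ (allFin m) (λ j → does (cross? π (i , j))))
par-cn {m} π = trans (par-length-filter (cross? π) (pairs m)) (Xor.⨁-product _,_ (allFin m) (allFin m) (does ∘ cross? π))

module Glue {m a b} {χ : Fin m → Bool} (sp : Splitting χ a b) where

  open Splitting sp

  module _ {c ℓ} (M : CommutativeMonoid c ℓ) where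
    open Fold M
    open CommutativeMonoid M using (_≈_; _∙_; ∙-cong) renaming (trans to ≈-trans)

    ⨁-split : ∀ g → ⨁ (allFin m) g ≈ ⨁ (allFin a) (g ∘ e₁) ∙ ⨁ (allFin b) (g ∘ e₂)
    ⨁-split g = ≈-trans (⨁-↭ split g) (≈-trans (⨁-++ (map e₁ (allFin a)) _ g)
        (∙-cong (⨁-map e₁ (allFin a) g) (⨁-map e₂ (allFin b) g)))
      where
      split : allFin m ↭ map e₁ (allFin a) ++ map e₂ (allFin b)
      split = unique-↭ (Unique.allFin⁺ m)
        (Unique.++⁺ (Unique.map⁺ e₁-injective (Unique.allFin⁺ a)) (Unique.map⁺ e₂-injective (Unique.allFin⁺ b)) disjoint)
        (λ {p} _ → covered (located p)) (λ {p} _ → ∈-allFin p)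
        where
        disjoint : ∀ {p} → ¬ (p ∈ˡ map e₁ (allFin a) × p ∈ˡ map e₂ (allFin b))
        disjoint (p∈₁ , p∈₂) with ∈-map⁻ e₁ p∈₁ | ∈-map⁻ e₂ p∈₂
        ... | _ , _ , eq | _ , _ , eq′ = e₁≢e₂ (trans (sym eq) eq′)
        covered : ∀ {p} → Located p → p ∈ˡ map e₁ (allFin a) ++ map e₂ (allFin b)
        covered (in₁ i) = ∈-++⁺ˡ (∈-map⁺ e₁ (∈-allFin i))
        covered (in₂ j) = ∈-++⁺ʳ (map e₁ (allFin a)) (∈-map⁺ e₂ (∈-allFin j))

  glue : Pairing a → Pairing b → Pairing m
  glue π₁ π₂ = tabulate ([ e₁ ∘ lookup π₁ , e₂ ∘ lookup π₂ ]′ ∘ loc)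

  module _ (π₁ : Pairing a) (π₂ : Pairing b) where

    glue-e₁ : ∀ i → lookup (glue π₁ π₂) (e₁ i) ≡ e₁ (lookup π₁ i)
    glue-e₁ i = trans (Vec.lookup∘tabulate _ (e₁ i)) (cong [ e₁ ∘ lookup π₁ , e₂ ∘ lookup π₂ ]′ (loc-e₁ i))

    glue-e₂ : ∀ j → lookup (glue π₁ π₂) (e₂ j) ≡ e₂ (lookup π₂ j)
    glue-e₂ j = trans (Vec.lookup∘tabulate _ (e₂ j)) (cong [ e₁ ∘ lookup π₁ , e₂ ∘ lookup π₂ ]′ (loc-e₂ j))

    glue-matching : IsMatching π₁ → IsMatching π₂ → IsMatching (glue π₁ π₂)
    glue-matching M₁ M₂ p with located p
    ... | in₁ i = subst (λ q → q ≢ e₁ i × lookup (glue π₁ π₂) q ≡ e₁ i) (sym (glue-e₁ i))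
                    (proj₁ (M₁ i) ∘ e₁-injective , trans (glue-e₁ (lookup π₁ i)) (cong e₁ (proj₂ (M₁ i))))
    ... | in₂ j = subst (λ q → q ≢ e₂ j × lookup (glue π₁ π₂) q ≡ e₂ j) (sym (glue-e₂ j))
                    (proj₁ (M₂ j) ∘ e₂-injective , trans (glue-e₂ (lookup π₂ j)) (cong e₂ (proj₂ (M₂ j))))

    glue-monochrome : Monochrome χ (glue π₁ π₂)
    glue-monochrome p with located p
    ... | in₁ i = trans (χ-e₁ i) (sym (trans (cong χ (glue-e₁ i)) (χ-e₁ _)))
    ... | in₂ j = trans (χ-e₂ j) (sym (trans (cong χ (glue-e₂ j)) (χ-e₂ _)))

    -- Increasing embeddings preserve and reflect crossings within a class, and crossings between
    -- arcs of different colours are not counted.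
    crossings-glue : crossings χ (glue π₁ π₂) ≡ par (cn π₁) xor par (cn π₂)
    crossings-glue = trans (⨁-split xor-monoid (λ p → Xor.⨁ (allFin m) (term p))) (cong₂ _xor_
      (trans (Xor.⨁-cong (allFin a) row₁) (sym (par-cn π₁))) (trans (Xor.⨁-cong (allFin b) row₂) (sym (par-cn π₂))))
      where
      xor-monoid = CommutativeRing.+-commutativeMonoid Bool.xor-∧-commutativeRing
      term : Fin m → Fin m → Bool
      term p q = same (χ p) (χ q) ∧ does (cross? (glue π₁ π₂) (p , q))
      xor-false : ∀ x → x xor false ≡ x
      xor-false false = refl
      xor-false true  = refl
      row₁ : ∀ i → Xor.⨁ (allFin m) (term (e₁ i)) ≡ Xor.⨁ (allFin a) (λ j → does (cross? π₁ (i , j)))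
      row₁ i = trans (⨁-split xor-monoid (term (e₁ i))) (trans (cong₂ _xor_
        (Xor.⨁-cong (allFin a) λ j → trans (cong₂ (λ x y → same x y ∧ does (cross? (glue π₁ π₂) (e₁ i , e₁ j))) (χ-e₁ i) (χ-e₁ j))
          (does-⇔ (cross? (glue π₁ π₂) (e₁ i , e₁ j)) (cross? π₁ (i , j))
            (λ (l₁ , l₂ , l₃) → strict-mono⁻ mono₁ l₁ , strict-mono⁻ mono₁ (subst (e₁ j Fin.<_) (glue-e₁ i) l₂) ,
                                strict-mono⁻ mono₁ (subst₂ Fin._<_ (glue-e₁ i) (glue-e₁ j) l₃))
            (λ (l₁ , l₂ , l₃) → mono₁ l₁ , subst (e₁ j Fin.<_) (sym (glue-e₁ i)) (mono₁ l₂) ,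
                                subst₂ Fin._<_ (sym (glue-e₁ i)) (sym (glue-e₁ j)) (mono₁ l₃))))
        (Xor.⨁-ε (allFin b) λ {j} _ → cong₂ (λ x y → same x y ∧ does (cross? (glue π₁ π₂) (e₁ i , e₂ j))) (χ-e₁ i) (χ-e₂ j)))
        (xor-false _))
      row₂ : ∀ i → Xor.⨁ (allFin m) (term (e₂ i)) ≡ Xor.⨁ (allFin b) (λ j → does (cross? π₂ (i , j)))
      row₂ i = trans (⨁-split xor-monoid (term (e₂ i))) (cong₂ _xor_
        (Xor.⨁-ε (allFin a) λ {j} _ → cong₂ (λ x y → same x y ∧ does (cross? (glue π₁ π₂) (e₂ i , e₁ j))) (χ-e₂ i) (χ-e₁ j))
        (Xor.⨁-cong (allFin b) λ j → trans (cong₂ (λ x y → same x y ∧ does (cross? (glue π₁ π₂) (e₂ i , e₂ j))) (χ-e₂ i) (χ-e₂ j))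
          (does-⇔ (cross? (glue π₁ π₂) (e₂ i , e₂ j)) (cross? π₂ (i , j))
            (λ (l₁ , l₂ , l₃) → strict-mono⁻ mono₂ l₁ , strict-mono⁻ mono₂ (subst (e₂ j Fin.<_) (glue-e₂ i) l₂) ,
                                strict-mono⁻ mono₂ (subst₂ Fin._<_ (glue-e₂ i) (glue-e₂ j) l₃))
            (λ (l₁ , l₂ , l₃) → mono₂ l₁ , subst (e₂ j Fin.<_) (sym (glue-e₂ i)) (mono₂ l₂) ,
                                subst₂ Fin._<_ (sym (glue-e₂ i)) (sym (glue-e₂ j)) (mono₂ l₃)))))

  glue-injective : ∀ {π₁ π₁′ π₂ π₂′} → glue π₁ π₂ ≡ glue π₁′ π₂′ → π₁ ≡ π₁′ × π₂ ≡ π₂′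
  glue-injective {π₁} {π₁′} {π₂} {π₂′} eq =
    lookup-ext (λ i → e₁-injective (trans (sym (glue-e₁ π₁ π₂ i)) (trans (cong (λ π → lookup π (e₁ i)) eq) (glue-e₁ π₁′ π₂′ i)))) ,
    lookup-ext (λ j → e₂-injective (trans (sym (glue-e₂ π₁ π₂ j)) (trans (cong (λ π → lookup π (e₂ j)) eq) (glue-e₂ π₁′ π₂′ j))))

  module _ {π : Pairing m} (matching : IsMatching π) (mono : Monochrome χ π) where

    -- The default value i is never taken: π is monochrome, so the partner of `e₁ i` is again in the
    -- first class.
    restrict₁ : Pairing a
    restrict₁ = tabulate λ i → [ id , (λ _ → i) ]′ (loc (lookup π (e₁ i)))

    restrict₂ : Pairing b
    restrict₂ = tabulate λ j → [ (λ _ → j) , id ]′ (loc (lookup π (e₂ j)))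

    e₁-restrict : ∀ i → e₁ (lookup restrict₁ i) ≡ lookup π (e₁ i)
    e₁-restrict i = trans (cong e₁ (Vec.lookup∘tabulate _ i)) (cases (located (lookup π (e₁ i))) refl)
      where
      cases : ∀ {q} → Located q → lookup π (e₁ i) ≡ q → e₁ ([ id , (λ _ → i) ]′ (loc (lookup π (e₁ i)))) ≡ lookup π (e₁ i)
      cases (in₁ k) eq = trans (cong (e₁ ∘ [ id , (λ _ → i) ]′) (trans (cong loc eq) (loc-e₁ k))) (sym eq)
      cases (in₂ k) eq with () ← trans (sym (χ-e₁ i)) (trans (mono (e₁ i)) (trans (cong χ eq) (χ-e₂ k)))

    e₂-restrict : ∀ j → e₂ (lookup restrict₂ j) ≡ lookup π (e₂ j)
    e₂-restrict j = trans (cong e₂ (Vec.lookup∘tabulate _ j)) (cases (located (lookup π (e₂ j))) refl)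
      where
      cases : ∀ {q} → Located q → lookup π (e₂ j) ≡ q → e₂ ([ (λ _ → j) , id ]′ (loc (lookup π (e₂ j)))) ≡ lookup π (e₂ j)
      cases (in₂ k) eq = trans (cong (e₂ ∘ [ (λ _ → j) , id ]′) (trans (cong loc eq) (loc-e₂ k))) (sym eq)
      cases (in₁ k) eq with () ← trans (sym (χ-e₂ j)) (trans (mono (e₂ j)) (trans (cong χ eq) (χ-e₁ k)))

    restrict₁-matching : IsMatching restrict₁
    restrict₁-matching i = (λ e → proj₁ (matching (e₁ i)) (trans (sym (e₁-restrict i)) (cong e₁ e))) ,
      e₁-injective (trans (e₁-restrict _) (trans (cong (lookup π) (e₁-restrict i)) (proj₂ (matching (e₁ i)))))

    restrict₂-matching : IsMatching restrict₂
    restrict₂-matching j = (λ e → proj₁ (matching (e₂ j)) (trans (sym (e₂-restrict j)) (cong e₂ e))) ,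
      e₂-injective (trans (e₂-restrict _) (trans (cong (lookup π) (e₂-restrict j)) (proj₂ (matching (e₂ j)))))

    glue-restrict : glue restrict₁ restrict₂ ≡ π
    glue-restrict = lookup-ext λ p → agree (located p)
      where
      agree : ∀ {p} → Located p → lookup (glue restrict₁ restrict₂) p ≡ lookup π p
      agree (in₁ i) = trans (glue-e₁ restrict₁ restrict₂ i) (e₁-restrict i)
      agree (in₂ j) = trans (glue-e₂ restrict₁ restrict₂ j) (e₂-restrict j)

  glue-↭ : cartesianProductWith glue (matchings a) (matchings b) ↭ filter (monochrome? χ) (matchings m)
  glue-↭ = unique-↭
    (Unique.cartesianProductWith⁺ glue glue-injective (matchings-unique a) (matchings-unique b))
    (Unique.filter⁺ (monochrome? χ) (matchings-unique m))
    glued unglued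
    where
    glued : ∀ {π} → π ∈ˡ cartesianProductWith glue (matchings a) (matchings b) → π ∈ˡ filter (monochrome? χ) (matchings m)
    glued π∈ with π₁ , π₂ , π₁∈ , π₂∈ , refl ← ∈-cartesianProductWith⁻ glue (matchings a) (matchings b) π∈ =
      ∈-filter⁺ (monochrome? χ) (∈-matchings⁺ {π = glue π₁ π₂} (glue-matching π₁ π₂ (∈-matchings⁻ {π = π₁} π₁∈) (∈-matchings⁻ {π = π₂} π₂∈)))
        (glue-monochrome π₁ π₂)
    unglued : ∀ {π} → π ∈ˡ filter (monochrome? χ) (matchings m) → π ∈ˡ cartesianProductWith glue (matchings a) (matchings b)
    unglued {π} π∈ = subst (_∈ˡ cartesianProductWith glue (matchings a) (matchings b)) (glue-restrict {π} M mono)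
      (∈-cartesianProductWith⁺ glue (∈-matchings⁺ {π = restrict₁ {π} M mono} (restrict₁-matching {π} M mono))
                                    (∈-matchings⁺ {π = restrict₂ {π} M mono} (restrict₂-matching {π} M mono)))
      where
      M : IsMatching π
      M = ∈-matchings⁻ {π = π} (proj₁ (∈-filter⁻ (monochrome? χ) {xs = matchings m} π∈))
      mono : Monochrome χ π
      mono = proj₂ (∈-filter⁻ (monochrome? χ) {xs = matchings m} π∈)

module PfaffianProduct {c ℓ} (R : CommutativeRing c ℓ) where

  open CommutativeRing R renaming (refl to ≈-refl; sym to ≈-sym; trans to ≈-trans) hiding (zero)
  open import Algebra.Properties.Semiring.Exp semiring using (_^_)
  open import Relation.Binary.Reasoning.Setoid setoid
  open Transfer R
  module Product′ = Fold *-commutativeMonoid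
  open import Algebra.Properties.CommutativeSemigroup *-commutativeSemigroup using (interchange)

  sg-par : ∀ k → (- 1#) ^ k ≈ sg (par k)
  sg-par zero    = ≈-refl
  sg-par (suc k) = ≈-trans (*-congˡ (sg-par k)) (≈-sym (sg-xor true (par k)))

  -- Every vertex is the smaller end of at most one edge. As a product over vertices the monomial
  -- splits along the two colour classes, which the list of edges does not show directly.
  monomial-vertices : ∀ {m} (A : Matrix R m) (π : Pairing m) →
    monomial R A π ≈ Product′.⨁ (allFin m) (λ i → Product′.when (does (i Fin.<? lookup π i)) (A i (lookup π i)))
  monomial-vertices {m} A π = begin
    monomial R A π
      ≈⟨ Product′.⨁-filter (edge? π) (pairs m) (λ (i , j) → A i j) ⟩
    Product′.⨁ (pairs m) (λ (i , j) → Product′.when (does (edge? π (i , j))) (A i j))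
      ≈⟨ Product′.⨁-product _,_ (allFin m) (allFin m) (λ (i , j) → Product′.when (does (edge? π (i , j))) (A i j)) ⟩
    Product′.⨁ (allFin m) (λ i → Product′.⨁ (allFin m) (λ j → Product′.when (does (edge? π (i , j))) (A i j)))
      ≈⟨ Product′.⨁-cong (allFin m) (λ i → ≈-trans
           (Product′.⨁-single (Unique.allFin⁺ m) (∈-allFin (lookup π i)) (λ {j} _ j≢ →
             Product′.when-congˡ (A i j) (dec-false (edge? π (i , j)) (λ (_ , eq) → j≢ (sym eq)))))
           (Product′.when-congˡ (A i (lookup π i)) (does-⇔ (edge? π (i , lookup π i)) (i Fin.<? lookup π i) proj₁ (λ lt → lt , refl)))) ⟩
    Product′.⨁ (allFin m) (λ i → Product′.when (does (i Fin.<? lookup π i)) (A i (lookup π i))) ∎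

  -- Multiplying out gives pairs of matchings of the two classes, and gluing turns these into the
  -- monochrome matchings of all vertices; the two crossing numbers add up modulo 2 to the equally
  -- coloured crossings.
  pf-split : ∀ {m a b} {χ : Fin m → Bool} (sp : Splitting χ a b) (A : Matrix R m) → let open Splitting sp in
    pf R (λ i j → A (e₁ i) (e₁ j)) * pf R (λ i j → A (e₂ i) (e₂ j)) ≈
    ⨁ (matchings m) (λ π → when (does (monochrome? χ π)) (sg (crossings χ π) * monomial R A π))
  pf-split {m} {a} {b} {χ} sp A = begin
    pf R A₁ * pf R A₂
      ≈⟨ ⨁-*ʳ (pf R A₂) (matchings a) _ ⟩
    ⨁ (matchings a) (λ π₁ → ((- 1#) ^ cn π₁ * monomial R A₁ π₁) * pf R A₂)
      ≈⟨ ⨁-cong (matchings a) (λ π₁ → ⨁-*ˡ _ (matchings b) _) ⟩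
    ⨁ (matchings a) (λ π₁ → ⨁ (matchings b) (λ π₂ → ((- 1#) ^ cn π₁ * monomial R A₁ π₁) * ((- 1#) ^ cn π₂ * monomial R A₂ π₂)))
      ≈⟨ ⨁-cong (matchings a) (λ π₁ → ⨁-cong (matchings b) (term π₁)) ⟩
    ⨁ (matchings a) (λ π₁ → ⨁ (matchings b) (λ π₂ → sg (crossings χ (glue π₁ π₂)) * monomial R A (glue π₁ π₂)))
      ≈⟨ ⨁-product glue (matchings a) (matchings b) _ ⟨
    ⨁ (cartesianProductWith glue (matchings a) (matchings b)) (λ π → sg (crossings χ π) * monomial R A π)
      ≈⟨ ⨁-↭ glue-↭ _ ⟩
    ⨁ (filter (monochrome? χ) (matchings m)) (λ π → sg (crossings χ π) * monomial R A π)
      ≈⟨ ⨁-filter (monochrome? χ) (matchings m) _ ⟩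
    ⨁ (matchings m) (λ π → when (does (monochrome? χ π)) (sg (crossings χ π) * monomial R A π)) ∎
    where
    open Splitting sp
    open Glue sp
    A₁ : Matrix R a
    A₁ i j = A (e₁ i) (e₁ j)
    A₂ : Matrix R b
    A₂ i j = A (e₂ i) (e₂ j)
    factor : ∀ π {k} (π′ : Pairing k) (e : Fin k → Fin m) → (∀ {i j} → i Fin.< j → e i Fin.< e j) →
      (∀ i → lookup π (e i) ≡ e (lookup π′ i)) → ∀ i →
      Product′.when (does (e i Fin.<? lookup π (e i))) (A (e i) (lookup π (e i))) ≈
      Product′.when (does (i Fin.<? lookup π′ i)) (A (e i) (e (lookup π′ i)))
    factor π π′ e mono eq i = ≈-trans
      (reflexive (cong (λ q → Product′.when (does (e i Fin.<? q)) (A (e i) q)) (eq i)))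
      (Product′.when-congˡ _ (does-⇔ (e i Fin.<? e (lookup π′ i)) (i Fin.<? lookup π′ i) (strict-mono⁻ mono) mono))
    monomial-glue : ∀ π₁ π₂ → monomial R A₁ π₁ * monomial R A₂ π₂ ≈ monomial R A (glue π₁ π₂)
    monomial-glue π₁ π₂ = ≈-sym (begin
      monomial R A (glue π₁ π₂)
        ≈⟨ monomial-vertices A (glue π₁ π₂) ⟩
      Product′.⨁ (allFin m) _
        ≈⟨ ⨁-split *-commutativeMonoid _ ⟩
      Product′.⨁ (allFin a) _ * Product′.⨁ (allFin b) _
        ≈⟨ *-cong (Product′.⨁-cong (allFin a) (factor (glue π₁ π₂) π₁ e₁ mono₁ (glue-e₁ π₁ π₂)))
                  (Product′.⨁-cong (allFin b) (factor (glue π₁ π₂) π₂ e₂ mono₂ (glue-e₂ π₁ π₂))) ⟩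
      Product′.⨁ (allFin a) _ * Product′.⨁ (allFin b) _
        ≈⟨ *-cong (monomial-vertices A₁ π₁) (monomial-vertices A₂ π₂) ⟨
      monomial R A₁ π₁ * monomial R A₂ π₂ ∎)
    term : ∀ π₁ π₂ → ((- 1#) ^ cn π₁ * monomial R A₁ π₁) * ((- 1#) ^ cn π₂ * monomial R A₂ π₂) ≈
                     sg (crossings χ (glue π₁ π₂)) * monomial R A (glue π₁ π₂)
    term π₁ π₂ = begin
      ((- 1#) ^ cn π₁ * monomial R A₁ π₁) * ((- 1#) ^ cn π₂ * monomial R A₂ π₂)
        ≈⟨ interchange _ _ _ _ ⟩
      ((- 1#) ^ cn π₁ * (- 1#) ^ cn π₂) * (monomial R A₁ π₁ * monomial R A₂ π₂)
        ≈⟨ *-cong (≈-trans (*-cong (sg-par (cn π₁)) (sg-par (cn π₂))) (≈-sym (sg-xor (par (cn π₁)) (par (cn π₂)))))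
                  (monomial-glue π₁ π₂) ⟩
      sg (par (cn π₁) xor par (cn π₂)) * monomial R A (glue π₁ π₂)
        ≈⟨ *-congʳ (reflexive (cong sg (crossings-glue π₁ π₂))) ⟨
      sg (crossings χ (glue π₁ π₂)) * monomial R A (glue π₁ π₂) ∎

-- The expansion

module Expansion {c ℓ} (R : CommutativeRing c ℓ) (n : ℕ) where

  open CommutativeRing R renaming (refl to ≈-refl; sym to ≈-sym; trans to ≈-trans) hiding (zero)
  open import Algebra.Properties.Semiring.Exp semiring using (_^_)
  open import Relation.Binary.Reasoning.Setoid setoid
  open Transfer R
  open Points n

  module _ (I : Subset N) where

    private
      χ = lookup I

    -- A picture has exactly one shape among the symmetric diagrams, so at most one compatible
    -- diagram contributes.
    shapes : ∀ w (x : Resolution n w) →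
      ⨁ (𝒟 n I) (λ E → when (does (hasShape? n w E x)) (wt R n w x)) ≈
      when (does (compat? (Picture.pictureShape n w (proj₁ x) (proj₂ x)) χ)) (wt R n w x)
    shapes w x@(c , d) = cases (compat? τ χ)
      where
      open Picture n w c d
      τ = pictureShape
      ∈𝒟⁻ : ∀ {E} → E ∈ˡ 𝒟 n I → E ∈ˡ 𝒯 n × Compatible n I E
      ∈𝒟⁻ = ∈-filter⁻ (compatible? n I) {xs = 𝒯 n}
      only : ∀ {E} → E ∈ˡ 𝒟 n I → HasShape n w x E → E ≡ double τ
      only E∈ = hasShape⁻ (∈-𝒯⁻ (proj₁ (∈𝒟⁻ E∈)))
      cases : (C? : Dec (Compat τ χ)) → ⨁ (𝒟 n I) (λ E → when (does (hasShape? n w E x)) (wt R n w x)) ≈ when (does C?) (wt R n w x)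
      cases (yes C) = ≈-trans
        (⨁-single (Unique.filter⁺ (compatible? n I) 𝒯-unique)
          (∈-filter⁺ (compatible? n I) (∈-𝒯⁺ (double-TL τ pictureShape-half)) (double-compatible⁻ τ I C))
          λ {E} E∈ E≢ → when-congˡ _ (dec-false (hasShape? n w E x) (E≢ ∘ only E∈)))
        (when-congˡ _ (dec-true (hasShape? n w (double τ) x) hasShape⁺))
      cases (no ¬C) = ⨁-ε (𝒟 n I) λ {E} E∈ → when-congˡ _ (dec-false (hasShape? n w E x) λ has →
        ¬C (double-compatible⁺ τ I (subst (Compatible n I) (only E∈ has) (proj₂ (∈𝒟⁻ E∈)))))

    f-sum : ∀ {π} → IsMatching π → ∀ {w} → IsNiceEmbedding n π w →
            ⨁ (𝒟 n I) (f R n w) ≈ when (does (monochrome? χ π)) (sg (crossings χ π))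
    f-sum {π} matching {w} nice = begin
      ⨁ (𝒟 n I) (f R n w)
        ≈⟨ ⨁-cong (𝒟 n I) (λ E → ⨁-filter (hasShape? n w E) (resolutions n w) (wt R n w)) ⟩
      ⨁ (𝒟 n I) (λ E → ⨁ (resolutions n w) (λ x → when (does (hasShape? n w E x)) (wt R n w x)))
        ≈⟨ ⨁-swap (𝒟 n I) (resolutions n w) _ ⟩
      ⨁ (resolutions n w) (λ x → ⨁ (𝒟 n I) (λ E → when (does (hasShape? n w E x)) (wt R n w x)))
        ≈⟨ ⨁-cong (resolutions n w) (λ x → ≈-trans (shapes w x)
             (when-congʳ (does (compat? (Picture.pictureShape n w (proj₁ x) (proj₂ x)) χ)) (weight x))) ⟩
      ⨁ (resolutions n w) (λ (c , d) → when (does (compat? (shape (axisShape d) w c) χ))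
        ((1# + 1#) ^ loopCount (axisShape d) w c * (- 1#) ^ (number vertical d ℕ.+ number horizontal c)))
        ≈⟨ resolutionSum n w χ ⟩
      when (does (Fin.all? λ k → χ (s (axisUpper n k)) Bool.≟ χ (s (axisLower n k)))) (sg (sameCrossings χ (crossedFrom id w)))
        -- The two strands of a block belong to partners under π, since the embedding draws ν(π);
        -- equal colours in every block thus mean that π is monochrome.
        ≈⟨ when-congˡ _ (does-⇔ (Fin.all? λ k → χ (s (axisUpper n k)) Bool.≟ χ (s (axisLower n k))) (monochrome? χ π) monochrome⁺ monochrome⁻) ⟩
      when (does (monochrome? χ π)) (sg (sameCrossings χ (crossedFrom id w)))
        ≈⟨ when-cong⇒ (does (monochrome? χ π)) (λ mono → reflexive (cong sg (sign χ (does-true (monochrome? χ π) mono)))) ⟩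
      when (does (monochrome? χ π)) (sg (crossings χ π)) ∎
      where
      open NiceSign n π matching w nice using (s; sign; monochrome⁺; monochrome⁻)
      weight : ∀ x → wt R n w x ≈ (1# + 1#) ^ loopCount (axisShape (proj₂ x)) w (proj₁ x) *
                                  (- 1#) ^ (number vertical (proj₂ x) ℕ.+ number horizontal (proj₁ x))
      weight (c , d) = *-congʳ (reflexive (cong ((1# + 1#) ^_) (Picture.loops-loopCount n w c d)))

    Pfaf-sum : (ε : Pairing N → LeftHalf N) → (∀ π → IsMatching π → IsNiceEmbedding n π (ε π)) → (A : Matrix R N) → 2 ∣ ∣ I ∣ →
      ⨁ (𝒟max n I) (λ D → Pfaf R n ε D A) ≈
      ⨁ (matchings N) (λ π → when (does (monochrome? χ π)) (sg (crossings χ π) * monomial R A π))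
    Pfaf-sum ε nice A even = begin
      ⨁ (𝒟max n I) (λ D → Pfaf R n ε D A)
        ≈⟨ Erasure.Diagrams.Regroup.regroup n I even +-commutativeMonoid (λ E → Pfaf′ R n ε E A) ⟩
      ⨁ (𝒟 n I) (λ E → ⨁ (matchings N) (λ π → f R n (ε π) E * monomial R A π))
        ≈⟨ ⨁-swap (𝒟 n I) (matchings N) _ ⟩
      ⨁ (matchings N) (λ π → ⨁ (𝒟 n I) (λ E → f R n (ε π) E * monomial R A π))
        ≈⟨ ⨁-cong∈ (matchings N) (λ {π} π∈ → let M = ∈-matchings⁻ {π = π} π∈ in begin
             ⨁ (𝒟 n I) (λ E → f R n (ε π) E * monomial R A π)
               ≈⟨ ⨁-*ʳ (monomial R A π) (𝒟 n I) (f R n (ε π)) ⟨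
             ⨁ (𝒟 n I) (f R n (ε π)) * monomial R A π
               ≈⟨ *-congʳ (f-sum M (nice π M)) ⟩
             when (does (monochrome? χ π)) (sg (crossings χ π)) * monomial R A π
               ≈⟨ when-*ʳ (does (monochrome? χ π)) _ _ ⟩
             when (does (monochrome? χ π)) (sg (crossings χ π) * monomial R A π) ∎) ⟩
      ⨁ (matchings N) (λ π → when (does (monochrome? χ π)) (sg (crossings χ π) * monomial R A π)) ∎

-- The product of complementary pfaffians as a sum of TL-pfaffinants

open import Data.Nat.Base using (_*_)

theorem13 : ∀ {c ℓ} (R : CommutativeRing c ℓ) (n : ℕ) → 1 ≤ n →
    (ε : Pairing (n * 2) → LeftHalf (n * 2)) →
    (∀ π → IsMatching π → IsNiceEmbedding n π (ε π)) →
    (A : Matrix R (n * 2)) → IsSkewSymmetric R A →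
    (I : Subset (n * 2)) → 2 ∣ ∣ I ∣ →
    CommutativeRing._≈_ R (pf-product R I A) (∑ R (𝒟max n I) (λ D → Pfaf R n ε D A))
theorem13 R n _ ε nice A _ I even = CommutativeRing.trans R
  -- The two sides meet in the sum over the matchings that preserve I, signed by the parity of their
  -- equally coloured crossings.
  (PfaffianProduct.pf-split R (splitting I) A)
  (CommutativeRing.sym R (Expansion.Pfaf-sum R n I ε nice A even))
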